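{- Let $r$ and $k$ be integers such that $-1\le k\le 5$ and $r\ge k+2$. Then (a) $F_v(2_r;r-k+1)\ge r+2k+3$; (b) $F_v(2_r;r-k+1)=r+2k+3$ if either $k\in\{0,2,3,4,5\}$ and $r\ge 2k+2$, or $k\in\{ -1,1\}$ and $r\ge 2k+3$.
   Context: All graphs are finite, simple and undirected; $\omega(G)$ denotes the clique number of $G$. For positive integers $a_1,\dots,a_r$, the notation $G\overset{v}{\to}(a_1,\dots,a_r)$ means that for every partition $V(G)=V_1\cup\dots\cup V_r$ into pairwise disjoint (possibly empty) sets there is some $i\in\{1,\dots,r\}$ such that $V_i$ contains an $a_i$-clique (a set of $a_i$ pairwise adjacent vertices). $(2_r)$ denotes the sequence $(2,\dots,2)$ of $r$ twos. $H_v(a_1,\dots,a_r;q)$ is the set of graphs $G$ with $G\overset{v}{\to}(a_1,\dots,a_r)$ and $\omega(G)<q$, and the vertex Folkman number $F_v(a_1,\dots,a_r;q)$ is the minimum of $|V(G)|$ over $G\in H_v(a_1,\dots,a_r;q)$ (this exists iff $q>\max\{a_1,\dots,a_r\}$). In particular $F_v(2_r;q)$ is the minimum number of vertices of a graph with chromatic number at least $r+1$ and clique number less than $q$. -}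

module Defs where

open import Data.Nat using (ℕ; _≤_; _<_)
open import Data.Fin using (Fin)
open import Data.Bool using (Bool; true; false)
open import Data.Product using (Σ; ∃; ∃-syntax; _×_)
open import Relation.Binary.PropositionalEquality using (_≡_; _≢_)
open import Relation.Nullary using (¬_)
open import Function.Definitions using (Injective)

record Graph (n : ℕ) : Set where
  field
    adj     : Fin n → Fin n → Bool
    sym     : ∀ u v → adj u v ≡ adj v u
    irrefl  : ∀ v → adj v v ≡ false

open Graph public

IsClique : ∀ {n s} → Graph n → (Fin s → Fin n) → Set
IsClique {n} {s} G f = Injective _≡_ _≡_ f × (∀ i j → i ≢ j → adj G (f i) (f j) ≡ true)

HasClique : ∀ {n} → Graph n → ℕ → Set
HasClique {n} G s = Σ (Fin s → Fin n) λ f → IsClique G f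

HasCliqueIn : ∀ {n r} → Graph n → (Fin n → Fin r) → Fin r → ℕ → Set
HasCliqueIn {n} G c i s =
  Σ (Fin s → Fin n) λ f → IsClique G f × (∀ j → c (f j) ≡ i)

CliqueNumberLt : ∀ {n} → Graph n → ℕ → Set
CliqueNumberLt G q = ¬ HasClique G q

-- G →ᵥ (a₁,…,a_r): every partition V = V₁ ∪ … ∪ V_r (encoded as a map
-- c : V → Fin r, V_i = c⁻¹(i), parts possibly empty) has some i with an
-- a_i-clique inside V_i.
VArrows : ∀ {n} → Graph n → (r : ℕ) → (Fin r → ℕ) → Set
VArrows {n} G r a = ∀ (c : Fin n → Fin r) → ∃[ i ] HasCliqueIn G c i (a i)

twos : (r : ℕ) → Fin r → ℕ
twos r _ = 2

InHv : ∀ {n} → Graph n → (r : ℕ) → (Fin r → ℕ) → ℕ → Set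
InHv G r a q = VArrows G r a × CliqueNumberLt G q

FvIs : (r : ℕ) → (Fin r → ℕ) → ℕ → ℕ → Set
FvIs r a q N =
  (Σ (Graph N) λ G → InHv G r a q) ×
  (∀ (m : ℕ) (G : Graph m) → InHv G r a q → N ≤ m)

{-# OPTIONS --safe #-}
-- For part (a) it suffices that every graph on n vertices has a colouring with c
-- colours and a clique of size a such that 3c ≤ n + 2a or c + 12 ≤ n.  A stable
-- triple can be removed at the price of one colour, so assume there is none; then a
-- colouring is a matching of the complement H, which is triangle-free.  If a maximum
-- matching of H misses two vertices, the argument behind Gallai's lemma splits H into
-- two parts without edges between them, and the claim is additive over such parts.
-- Otherwise n is twice the size of the matching up to one, and the clique is
-- supplied by the Ramsey bounds R(3,j+1) ≤ 4j-1 for j ≤ 6.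
--
-- The deep case is R(3,7) ≤ 23.  A search shows that a triangle-free graph on 17
-- vertices without stable 6-set has at least 40 edges.  Counting edges around the
-- vertices of degree 5, a counterexample on 23 vertices is 6-regular, so the
-- non-neighbours of a vertex span 33 edges, and two non-adjacent vertices have at most
-- three common neighbours.  Three are impossible, by a search extending the graphs on
-- 12 vertices spanned by their common non-neighbours, and at most two everywhere
-- contradicts a double count.
--
-- For part (b), a graph on 2r + 1 vertices without stable triples is not r-colourable;
-- complements of Ramsey graphs (for k = 1 the join of two 5-cycles instead) give the
-- smallest r, and adding universal vertices the others.
module Submission where

-- The claim about c and a is read off from the theorem. A graph that arrows `twos r` without a
-- clique of size r-k+1 has c ≥ r+1 and a ≤ r-k, so 3c ≤ n + 2a becomes n ≥ r+2k+3 exactly, and c +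
-- 12 ≤ n becomes n ≥ r+13, which is enough as long as k ≤ 5. The coefficient 3 makes the removal of
-- a stable triple neutral. The 12 marks the end of the linear Ramsey bound: R(3,8) = 28 exceeds
-- 4·7-1, and matchings with at most 11 pairs call for j ≤ 6 only. Maximum matchings are obtained
-- under double negation; the final inequality is decidable, so the negations disappear at the end.
-- The obstacle is the size of the Ramsey searches. No graph on more than 13 vertices is catalogued:
-- larger ones are cut at a vertex, or at a non-adjacent pair, into a catalogued part and a few
-- stable sets glued onto it, and degree sums exclude the parts outside the catalogues. Every test
-- in a search is a necessary condition on a real configuration, so what has to be proved is only
-- that no real configuration is lost.

module Search where

  open import Data.Bool using (Bool; true; false; _∧_; _∨_; not; if_then_else_)
  open import Data.Nat using (ℕ; zero; suc; _+_; _∸_; _*_; _≡ᵇ_; _≤ᵇ_)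
  open import Data.List
    using (List; []; _∷_; _++_; map; length; replicate; reverse; concatMap; filterᵇ; null;
      zipWith)
  open import Data.Bool.ListAction using (all; any)
  open import Data.Product using (_×_; _,_; proj₁; proj₂)
  open import Relation.Binary.PropositionalEquality using (_≡_; refl)

  -- Masks, stable sets, and gluing of independent vertices onto a graph.

  Mask : Set
  Mask = List Bool

  -- The strict upper triangle of an adjacency matrix: one row per vertex, listing its
  -- adjacency to the later vertices.
  Pattern : Set
  Pattern = List Mask

  𝟙 : Bool → ℕ
  𝟙 true = 1
  𝟙 false = 0

  disjoint : Mask → Mask → Bool
  disjoint [] _ = true
  disjoint (_ ∷ _) [] = true
  disjoint (false ∷ p) (_ ∷ q) = disjoint p q
  disjoint (true ∷ p) (true ∷ q) = false
  disjoint (true ∷ p) (false ∷ q) = disjoint p q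

  ∑ : ∀ {A : Set} → (A → ℕ) → List A → ℕ
  ∑ f [] = 0
  ∑ f (x ∷ xs) = f x + ∑ f xs

  count : ∀ {A : Set} → (A → Bool) → List A → ℕ
  count f = ∑ (λ x → 𝟙 (f x))

  size : Mask → ℕ
  size = ∑ 𝟙

  edges : Pattern → ℕ
  edges = ∑ size

  stable : Pattern → List Mask
  stable [] = [] ∷ []
  stable (r ∷ P) = extend (stable P)
    where
    extend : List Mask → List Mask
    extend S = map (true ∷_) (filterᵇ (disjoint r) S) ++ map (false ∷_) S

  -- Unordered choices with repetition; the state records what the members chosen so far
  -- forbid.
  module Choose {S : Set} (admits : S → Mask → Bool) (step : Mask → S → S) where

    choose : ℕ → List Mask → S → List (List Mask)
    choose zero _ _ = [] ∷ []
    choose (suc m) [] _ = []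
    choose (suc m) (c ∷ cs) s =
      map (c ∷_) (choose m (filterᵇ (admits (step c s)) (c ∷ cs)) (step c s)) ++ choose (suc m) cs s

  -- Layer b (counted from 0) holds the stable sets that at most b of the masks still to
  -- be chosen may avoid.
  Layers : Set
  Layers = List (List Mask)

  hitsAll : Layers → Mask → Bool
  hitsAll [] _ = true
  hitsAll (L ∷ _) r = not (any (disjoint r) L)

  -- A set avoided by `r` has spent one unit of its allowance and moves down a layer. There are as
  -- many layers as masks still to be chosen, so the sets of the last layer that `r` hits are
  -- dropped: too few masks remain to exceed their allowance.
  advance : Mask → Layers → Layers
  advance r [] = []
  advance r (L ∷ []) = []
  advance r (L ∷ L' ∷ Ls) =
    (filterᵇ (λ I → not (disjoint r I)) L ++ filterᵇ (disjoint r) L') ∷ advance r (L' ∷ Ls)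

  ofSize : ℕ → List Mask → List Mask
  ofSize s = filterᵇ (λ I → size I ≡ᵇ s)

  -- A stable set and the new vertices avoiding it form a stable set, hence size `k ∸ b` goes with
  -- allowance `b`. With `m` new vertices, sets of size at most `k - m` can never be completed
  -- beyond `k`.
  layers : ℕ → ℕ → ℕ → List Mask → Layers
  layers k b zero S = []
  layers k b (suc m) S = ofSize (k ∸ b) S ∷ layers k (suc b) m S

  glueFrom : ℕ → ℕ → (ℕ → Bool) → List Mask → List (List Mask)
  glueFrom k m ok S = Choose.choose hitsAll advance m (filterᵇ (hitsAll Ls) (filterᵇ (λ r → ok (size r)) S)) Ls
    where
    Ls : Layers
    Ls = layers k 0 m S

  opaque

    -- The possible rows of m pairwise non-adjacent new vertices, subject to the condition
    -- that a stable set of P and the new vertices avoiding it number at most k.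
    glue : ℕ → ℕ → (ℕ → Bool) → Pattern → List (List Mask)
    glue k m ok P = glueFrom k m ok (stable P)

  attach : List Mask → Pattern → Pattern
  attach [] P = P
  attach (r ∷ rs) P = (replicate (length rs) false ++ r) ∷ attach rs P

  -- Isomorphism test by backtracking.

  record Item : Set where
    constructor item
    field
      label  : ℕ
      column : Mask
      row    : Mask

  eqMask : Mask → Mask → Bool
  eqMask [] [] = true
  eqMask (true ∷ p) (true ∷ q) = eqMask p q
  eqMask (false ∷ p) (false ∷ q) = eqMask p q
  eqMask _ _ = false

  bit : Mask → ℕ → Bool
  bit [] _ = false
  bit (b ∷ p) zero = b
  bit (b ∷ p) (suc i) = bit p i

  remove : Mask → ℕ → Mask
  remove [] _ = []
  remove (b ∷ p) zero = p
  remove (b ∷ p) (suc i) = b ∷ remove p i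

  record Pick : Set where
    constructor pick
    field
      position : ℕ
      label    : ℕ
      column   : Mask
      others   : List Item

  consColumns : Mask → List Item → List Item
  consColumns = zipWith λ { b (item l c r) → item l (b ∷ c) r }

  -- Once the vertex at position `i` is picked, its bit passes from the row of an earlier item to
  -- the column of that item.
  skip : Item → Pick → Pick
  skip (item l c r) (pick i l' c' its) = pick (suc i) l' c' (item l (bit r i ∷ c) (remove r i) ∷ its)

  picks : List Item → List Pick
  picks [] = []
  picks (item l c r ∷ its) = pick 0 l c (consColumns r its) ∷ map (skip (item l c r)) (picks its)

  mutual
    -- The first pattern is rebuilt from its last vertex backwards. The `column` of a candidate
    -- lists its adjacency to the vertices placed so far, latest first, which is exactly the row it
    -- has to match.
    iso : List (ℕ × Mask) → List Item → Bool
    iso [] its = null its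
    iso (q ∷ qs) its = isoPicks q qs (picks its)

    isoPicks : ℕ × Mask → List (ℕ × Mask) → List Pick → Bool
    isoPicks q qs [] = false
    isoPicks q qs (pick _ l c its ∷ ps) =
      (((proj₁ q ≡ᵇ l) ∧ eqMask (proj₂ q) c) ∧ iso qs its) ∨ isoPicks q qs ps

  dot : Mask → List ℕ → ℕ
  dot [] _ = 0
  dot (_ ∷ _) [] = 0
  dot (true ∷ r) (w ∷ ws) = w + dot r ws
  dot (false ∷ r) (w ∷ ws) = dot r ws

  -- The labels are an isomorphism invariant which only prunes the search.
  refine : Pattern → List ℕ → List ℕ
  refine [] _ = []
  refine (_ ∷ _) [] = []
  refine (r ∷ P) (w ∷ ws) =
    (7 * w + dot r (map (λ x → x * x) ws)) ∷ zipWith (λ b x → if b then w * w + x else x) r (refine P ws)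

  labels : Pattern → List ℕ
  labels P = refine P (refine P (refine P (replicate (length P) 1)))

  labelled : List ℕ → Pattern → List (ℕ × Mask)
  labelled _ [] = []
  labelled [] (r ∷ P) = (0 , r) ∷ labelled [] P
  labelled (l ∷ ls) (r ∷ P) = (l , r) ∷ labelled ls P

  isomorphic : Pattern → Pattern → Bool
  isomorphic Q P =
    (edges Q ≡ᵇ edges P) ∧
    iso (reverse (labelled (labels Q) Q)) (map (λ { (l , r) → item l [] r }) (labelled (labels P) P))

  -- Catalogues of small triangle-free graphs up to isomorphism.

  nubIso : List Pattern → List Pattern
  nubIso [] = []
  nubIso (P ∷ Ps) = insert (nubIso Ps)
    where
    insert : List Pattern → List Pattern
    insert Qs = if any (λ Q → isomorphic Q P) Qs then Qs else P ∷ Qs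

  extensions : ℕ → List Pattern → List Pattern
  extensions k Ps = nubIso (concatMap (λ P → map (λ rs → attach rs P) (glue k 1 (λ _ → true) P)) Ps)

  between : ℕ → ℕ → ℕ → Bool
  between lo hi s = (lo ≤ᵇ s) ∧ (s ≤ᵇ hi)

  cone : List Mask → Pattern → Pattern
  cone rs P = (replicate (length rs) true ++ replicate (length P) false) ∷ attach rs P

  -- These are graphs on 12 vertices without stable 5-set, seen from a vertex of degree 3: its 8
  -- non-neighbours have no stable 4-set, and since all degrees are 3 or 4, each neighbour has 2 or
  -- 3 neighbours among them.
  cones : List Pattern → List Pattern
  cones Ps = nubIso (concatMap (λ P → map (λ rs → cone rs P) (glue 4 3 (between 2 3) P)) Ps)

  opaque

    -- The name refers to R(3,4): no triangle and no stable 4-set.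
    graphs[3,4] : ℕ → List Pattern
    graphs[3,4] zero = [] ∷ []
    graphs[3,4] (suc n) = extensions 3 (graphs[3,4] n)

    graphs[3,4]-zero : graphs[3,4] 0 ≡ [] ∷ []
    graphs[3,4]-zero = refl

    graphs[3,4]-suc : ∀ n → graphs[3,4] (suc n) ≡ extensions 3 (graphs[3,4] n)
    graphs[3,4]-suc n = refl

    graphs12 : List Pattern
    graphs12 = cones (graphs[3,4] 8)

    graphs12-cones : graphs12 ≡ cones (graphs[3,4] 8)
    graphs12-cones = refl

    graphs13 : List Pattern
    graphs13 = extensions 4 graphs12

    graphs13-extensions : graphs13 ≡ extensions 4 graphs12
    graphs13-extensions = refl

  -- Tests on the catalogued graphs.

  addMask : Mask → List ℕ → List ℕ
  addMask = zipWith (λ b n → 𝟙 b + n)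

  addMasks : List Mask → List ℕ → List ℕ
  addMasks [] ns = ns
  addMasks (r ∷ rs) ns = addMask r (addMasks rs ns)

  degrees : Pattern → List ℕ
  degrees [] = []
  degrees (r ∷ P) = size r ∷ addMask r (degrees P)

  -- The numbers are missing degrees; a vertex that lacks nothing accepts no further neighbour.
  fits : List ℕ → Mask → Bool
  fits [] _ = true
  fits (_ ∷ _) [] = true
  fits (zero ∷ ns) (b ∷ p) = not b ∧ fits ns p
  fits (suc _ ∷ ns) (_ ∷ p) = fits ns p

  deduct : Mask → List ℕ → List ℕ
  deduct = zipWith (λ b n → n ∸ 𝟙 b)

  within : ℕ → List Mask → List Mask → Bool
  within k S rs = all (λ I → count (λ r → disjoint r I) rs + size I ≤ᵇ k) S

  -- In the setting of the pair search P is the pattern of the common non-neighbours of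
  -- non-adjacent vertices u and v with three common neighbours, in a 6-regular graph on 23
  -- vertices; s and t are the rows of N(u) ∖ N(v) and N(v) ∖ N(u).  A vertex of
  -- N(u) ∖ N(v) has five neighbours in P and N(v) ∖ N(u), and the rows of its neighbours
  -- are disjoint from its own.
  sided : List Mask → List Mask → Bool
  sided s t = all (λ r → 5 ≤ᵇ size r + count (disjoint r) t) s

  -- The non-neighbours of v span 33 edges, three of which contain u.
  triples : Pattern → List (List Mask)
  triples P = filterᵇ (λ rs → edges P + ∑ size rs ≡ᵇ 30) (glue 5 3 (between 2 4) P)

  -- The rows of the common neighbours raise every degree to 6.
  completions : Pattern → List Mask → List Mask → List (List Mask)
  completions P s t = Choose.choose fits deduct 3 (filterᵇ (fits D) (ofSize 4 (stable P))) D
    where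
    D : List ℕ
    D = map (6 ∸_) (addMasks s (addMasks t (degrees P)))

  -- The common neighbours together with either side make up a full neighbourhood, which is stable,
  -- so the bound 6 on stable sets can be tested on both unions.
  survives : Pattern → List Mask → List Mask → Bool
  survives P s t =
    sided s t ∧ any (λ cs → within 6 (stable P) (cs ++ s) ∧ within 6 (stable P) (cs ++ t)) (completions P s t)

  noPair : Pattern → List (List Mask) → Bool
  noPair P T = all (λ s → all (λ t → not (survives P s t)) T) T

  check23 : Pattern → Bool
  check23 P = noPair P (triples P)

  -- `P` stands for the 12 non-neighbours of a vertex of degree 4, and the summand 4 for the edges
  -- at that vertex. Its neighbours have degree 4 or 5, hence 3 or 4 neighbours in `P`.
  check17 : Pattern → Bool
  check17 P = all (λ rs → 40 ≤ᵇ edges P + (4 + ∑ size rs)) (glue 5 4 (between 3 4) P)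

  -- In a 5-regular graph on 18 vertices, 25 of the 45 edges meet the neighbourhood of a given
  -- vertex, so its 12 non-neighbours span 20.
  check18 : Pattern → Bool
  check18 P = not (edges P ≡ᵇ 20) ∨ null (glue 5 5 (4 ≡ᵇ_) P)

-- Sums over lists, and sublists up to permutation.

module Lists where

  open import Data.Bool using (Bool; true; false)
  open import Data.Nat using (ℕ; _+_; _*_; _≤_; z≤n; s≤s)
  open import Data.Nat.Properties
  open import Data.List using (List; []; _∷_; _++_; map; length; filterᵇ)
  open import Data.List.Properties using (++-assoc)
  open import Data.List.Relation.Unary.All as All using (All; []; _∷_)
  import Data.List.Relation.Unary.All.Properties as All
  open import Data.List.Relation.Unary.Any using (here; there)
  open import Data.List.Membership.Propositional using (_∈_)
  open import Data.List.Membership.Propositional.Properties using (∈-∃++)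
  open import Data.List.Relation.Binary.Permutation.Propositional
    using (_↭_; ↭-refl; ↭-sym; ↭-trans; ↭-reflexive; ↭-prep)
  open import Data.List.Relation.Binary.Permutation.Propositional.Properties
    using (All-resp-↭; shift; ++⁺ʳ; ++-comm; ++-identityʳ)
  open import Data.Product using (_×_; _,_; ∃; ∃₂)
  open import Data.Sum using (_⊎_; inj₁; inj₂)
  open import Function using (_∘_)
  open import Relation.Binary.PropositionalEquality using (_≡_; refl; sym; trans; cong; cong₂; subst)
  open import Data.Nat.Tactic.RingSolver using (solve-∀)
  open Search using (𝟙; ∑; count)

  private variable
    A B : Set

  ∑-++ : (f : A → ℕ) (xs ys : List A) → ∑ f (xs ++ ys) ≡ ∑ f xs + ∑ f ys
  ∑-++ f [] ys = refl
  ∑-++ f (x ∷ xs) ys = trans (cong (f x +_) (∑-++ f xs ys)) (sym (+-assoc (f x) _ _))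

  ∑-↭ : (f : A → ℕ) {xs ys : List A} → xs ↭ ys → ∑ f xs ≡ ∑ f ys
  ∑-↭ f _↭_.refl = refl
  ∑-↭ f (_↭_.prep x p) = cong (f x +_) (∑-↭ f p)
  ∑-↭ f (_↭_.swap x y p) = trans (cong (λ s → f x + (f y + s)) (∑-↭ f p)) (exchange (f x) (f y) _)
    where
    exchange : ∀ a b c → a + (b + c) ≡ b + (a + c)
    exchange = solve-∀
  ∑-↭ f (_↭_.trans p q) = trans (∑-↭ f p) (∑-↭ f q)

  ∑-map : (f : B → ℕ) (g : A → B) (xs : List A) → ∑ f (map g xs) ≡ ∑ (f ∘ g) xs
  ∑-map f g [] = refl
  ∑-map f g (x ∷ xs) = cong (f (g x) +_) (∑-map f g xs)

  ∑-+ : (f g : A → ℕ) (xs : List A) → ∑ (λ x → f x + g x) xs ≡ ∑ f xs + ∑ g xs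
  ∑-+ f g [] = refl
  ∑-+ f g (x ∷ xs) = trans (cong (f x + g x +_) (∑-+ f g xs)) (interchange (f x) (g x) _ _)
    where
    interchange : ∀ a b c d → a + b + (c + d) ≡ a + c + (b + d)
    interchange = solve-∀

  ∑-swap : (f : A → B → ℕ) (xs : List A) (ys : List B) →
    ∑ (λ x → ∑ (f x) ys) xs ≡ ∑ (λ y → ∑ (λ x → f x y) xs) ys
  ∑-swap f [] [] = refl
  ∑-swap f [] (y ∷ ys) = ∑-swap f [] ys
  ∑-swap f (x ∷ xs) ys =
    trans (cong (∑ (f x) ys +_) (∑-swap f xs ys)) (sym (∑-+ (f x) (λ y → ∑ (λ x → f x y) xs) ys))

  ∑-cong : {f g : A → ℕ} (xs : List A) → All (λ x → f x ≡ g x) xs → ∑ f xs ≡ ∑ g xs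
  ∑-cong [] [] = refl
  ∑-cong (x ∷ xs) (e ∷ es) = cong₂ _+_ e (∑-cong xs es)

  ∑-mono : {f g : A → ℕ} (xs : List A) → All (λ x → f x ≤ g x) xs → ∑ f xs ≤ ∑ g xs
  ∑-mono [] [] = z≤n
  ∑-mono (x ∷ xs) (e ∷ es) = +-mono-≤ e (∑-mono xs es)

  ∑-const : (n : ℕ) (xs : List A) → ∑ (λ _ → n) xs ≡ length xs * n
  ∑-const n [] = refl
  ∑-const n (x ∷ xs) = cong (n +_) (∑-const n xs)

  ∑-*ˡ : (n : ℕ) (f : A → ℕ) (xs : List A) → ∑ (λ x → n * f x) xs ≡ n * ∑ f xs
  ∑-*ˡ n f [] = sym (*-zeroʳ n)
  ∑-*ˡ n f (x ∷ xs) = trans (cong (n * f x +_) (∑-*ˡ n f xs)) (sym (*-distribˡ-+ n (f x) _))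

  ∑-≡ : ∀ {n} {f : A → ℕ} (xs : List A) → All (λ x → f x ≡ n) xs → ∑ f xs ≡ length xs * n
  ∑-≡ {n = n} xs es = trans (∑-cong xs es) (∑-const n xs)

  ∑-≥ : ∀ {n} {f : A → ℕ} (xs : List A) → All (λ x → n ≤ f x) xs → length xs * n ≤ ∑ f xs
  ∑-≥ {n = n} xs es = subst (_≤ _) (∑-const n xs) (∑-mono xs es)

  ∑-≤ : ∀ {n} {f : A → ℕ} (xs : List A) → All (λ x → f x ≤ n) xs → ∑ f xs ≤ length xs * n
  ∑-≤ {n = n} xs es = subst (_ ≤_) (∑-const n xs) (∑-mono xs es)

  count-true : {f : A → Bool} {xs : List A} → All (λ x → f x ≡ true) xs → count f xs ≡ length xs
  count-true {xs = xs} es = trans (∑-≡ xs (All.map (cong 𝟙) es)) (*-identityʳ (length xs))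

  count-false : {f : A → Bool} {xs : List A} → All (λ x → f x ≡ false) xs → count f xs ≡ 0
  count-false {xs = xs} es = trans (∑-≡ xs (All.map (cong 𝟙) es)) (*-zeroʳ (length xs))

  count-≤ : (f : A → Bool) (xs : List A) → count f xs ≤ length xs
  count-≤ f [] = z≤n
  count-≤ f (x ∷ xs) with f x
  ... | true = s≤s (count-≤ f xs)
  ... | false = ≤-trans (count-≤ f xs) (n≤1+n _)

  partitionᵇ : (f : A → Bool) (xs : List A) →
    ∃₂ λ ys zs → xs ↭ ys ++ zs × All (λ x → f x ≡ true) ys × All (λ x → f x ≡ false) zs
  partitionᵇ f [] = [] , [] , ↭-refl , [] , []
  partitionᵇ f (x ∷ xs) with partitionᵇ f xs | f x in eq
  ... | ys , zs , p , t , u | true = x ∷ ys , zs , ↭-prep x p , eq ∷ t , u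
  ... | ys , zs , p , t , u | false = ys , x ∷ zs , ↭-trans (↭-prep x p) (↭-sym (shift x ys zs)) , t , eq ∷ u

  extract : ∀ {x : A} {xs} → x ∈ xs → ∃ λ ys → xs ↭ x ∷ ys
  extract {x = x} x∈xs with ∈-∃++ x∈xs
  ... | ys , zs , refl = ys ++ zs , shift x ys zs

  filterᵇ-∈ : (f : A → Bool) {x : A} {xs : List A} → x ∈ xs → f x ≡ true → x ∈ filterᵇ f xs
  filterᵇ-∈ f {x} (here refl) eq rewrite eq = here refl
  filterᵇ-∈ f {x} {y ∷ xs} (there i) eq with f y
  ... | true = there (filterᵇ-∈ f i eq)
  ... | false = filterᵇ-∈ f i eq

  filterᵇ-∈⁻ : (f : A → Bool) {x : A} (xs : List A) → x ∈ filterᵇ f xs → x ∈ xs × f x ≡ true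
  filterᵇ-∈⁻ f (y ∷ xs) i with f y in eq
  filterᵇ-∈⁻ f (y ∷ xs) (here refl) | true = here refl , eq
  filterᵇ-∈⁻ f (y ∷ xs) (there i) | true with filterᵇ-∈⁻ f xs i
  ... | j , e = there j , e
  filterᵇ-∈⁻ f (y ∷ xs) i | false with filterᵇ-∈⁻ f xs i
  ... | j , e = there j , e

  locate : (f : A → Bool) (xs : List A) → All (λ x → f x ≡ false) xs ⊎ ∃ λ x → x ∈ xs × f x ≡ true
  locate f [] = inj₁ []
  locate f (x ∷ xs) with f x in eq | locate f xs
  ... | true | _ = inj₂ (x , here refl , eq)
  ... | false | inj₁ all = inj₁ (eq ∷ all)
  ... | false | inj₂ (y , i , e) = inj₂ (y , there i , e)

  infix 4 _⊑_
  -- Vertex sets are lists up to order; with the complement `zs` at hand, every manipulation of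
  -- subsets is a permutation.
  _⊑_ : List A → List A → Set
  xs ⊑ ys = ∃ λ zs → ys ↭ xs ++ zs

  ⊑-trans : {xs ys zs : List A} → xs ⊑ ys → ys ⊑ zs → xs ⊑ zs
  ⊑-trans {xs = xs} (us , p) (vs , q) =
    us ++ vs , ↭-trans q (↭-trans (++⁺ʳ vs p) (↭-reflexive (++-assoc xs us vs)))

  ↭⇒⊑ : {xs ys : List A} → ys ↭ xs → xs ⊑ ys
  ↭⇒⊑ {xs = xs} p = [] , ↭-trans p (↭-sym (++-identityʳ xs))

  ⊑-All : {P : A → Set} {xs ys : List A} → xs ⊑ ys → All P ys → All P xs
  ⊑-All {xs = xs} (zs , p) all = All.++⁻ˡ xs (All-resp-↭ p all)

  ⊑-++ˡ : (xs ys : List A) → xs ⊑ xs ++ ys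
  ⊑-++ˡ xs ys = ys , ↭-refl

  ⊑-++ʳ : (xs ys : List A) → ys ⊑ xs ++ ys
  ⊑-++ʳ xs ys = xs , ++-comm xs ys

-- Completeness of the searches: no configuration that occurs is lost.

module Soundness where

  open import Data.Bool using (Bool; true; false; not; _∧_)
  open import Data.Bool.ListAction using (all; any)
  open import Data.Empty using (⊥; ⊥-elim)
  open import Data.Unit using (⊤; tt)
  open import Data.Nat using (ℕ; zero; suc; _+_; _∸_; _≤_; _<_; _≡ᵇ_; _≤ᵇ_)
  open import Data.Nat.Properties hiding (_≟_)
  open import Data.List using (List; []; _∷_; _++_; map; length; filterᵇ; replicate; reverse; _ʳ++_)
  open import Data.List.Properties
    using (length-++; length-map; map-++; reverse-map; reverse-involutive)
  open import Data.List.Relation.Unary.All as All using (All; []; _∷_)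
  import Data.List.Relation.Unary.All.Properties as All
  open import Data.List.Relation.Unary.AllPairs as AllPairs using (AllPairs; []; _∷_)
  import Data.List.Relation.Unary.AllPairs.Properties as AllPairs
  open import Data.List.Relation.Unary.Any as Any using (Any; here; there)
  open import Data.List.Membership.Propositional using (_∈_)
  open import Data.List.Membership.Propositional.Properties
    using (∈-++⁺ˡ; ∈-++⁺ʳ; ∈-++⁻; ∈-map⁺; ∈-map⁻; ∈-concatMap⁺)
  open import Data.List.Relation.Binary.Permutation.Propositional
    using (_↭_; ↭-refl; ↭-sym; ↭-trans; ↭-prep; ↭-swap)
  open import Data.List.Relation.Binary.Permutation.Propositional.Properties
    using (↭-length; All-resp-↭; shift; ++⁺; ++⁺ʳ; ++-identityʳ; map⁺; ↭-map-inv; ↭-singleton-inv)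
  import Data.List.Relation.Binary.Permutation.Setoid.Properties as Permutation
  open import Data.Product using (_×_; _,_; proj₁; proj₂; ∃; ∃₂)
  open import Data.Sum using (_⊎_; inj₁; inj₂)
  open import Function using (_∘_; case_of_)
  open import Relation.Nullary using (contradiction)
  open import Relation.Binary.PropositionalEquality
    using (_≡_; refl; sym; trans; cong; cong₂; subst; subst₂; setoid)
  open Search
  open Lists

  ≤ᵇ-false : ∀ {m n} → (m ≤ᵇ n) ≡ false → n < m
  ≤ᵇ-false {m} {n} eq = ≰⇒> λ m≤n → case trans (sym eq) (T⇒≡ (≤⇒≤ᵇ m≤n)) of λ ()
    where
    open import Data.Bool using (T)
    T⇒≡ : ∀ {b} → T b → b ≡ true
    T⇒≡ {true} _ = refl

  ≤ᵇ-true : ∀ {m n} → (m ≤ᵇ n) ≡ true → m ≤ n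
  ≤ᵇ-true {m} {n} eq = ≤ᵇ⇒≤ m n (subst T (sym eq) tt)
    where open import Data.Bool using (T)

  ≤⇒≤ᵇ-true : ∀ {m n} → m ≤ n → (m ≤ᵇ n) ≡ true
  ≤⇒≤ᵇ-true {m} {n} m≤n with m ≤ᵇ n in eq
  ... | true = refl
  ... | false = contradiction m≤n (<⇒≱ (≤ᵇ-false eq))

  ≡ᵇ-true : ∀ {m n} → (m ≡ᵇ n) ≡ true → m ≡ n
  ≡ᵇ-true {m} {n} eq = ≡ᵇ⇒≡ m n (subst T (sym eq) tt)
    where open import Data.Bool using (T)

  ≡⇒≡ᵇ-true : ∀ {m n} → m ≡ n → (m ≡ᵇ n) ≡ true
  ≡⇒≡ᵇ-true {m} refl = reflexive m
    where
    reflexive : ∀ m → (m ≡ᵇ m) ≡ true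
    reflexive zero = refl
    reflexive (suc m) = reflexive m

  ∧-true : ∀ {a b} → a ∧ b ≡ true → a ≡ true × b ≡ true
  ∧-true {true} {true} _ = refl , refl

  any-sound : ∀ {A : Set} (f : A → Bool) (xs : List A) → any f xs ≡ true → ∃ λ x → x ∈ xs × f x ≡ true
  any-sound f (x ∷ xs) eq with f x in e
  ... | true = x , here refl , e
  ... | false with any-sound f xs eq
  ... | y , i , e′ = y , there i , e′

  any-false : ∀ {A : Set} (f : A → Bool) {xs : List A} → All (λ x → f x ≡ false) xs → any f xs ≡ false
  any-false f [] = refl
  any-false f (e ∷ es) rewrite e = any-false f es

  any-complete : ∀ {A : Set} (f : A → Bool) {x : A} {xs : List A} → x ∈ xs → f x ≡ true → any f xs ≡ true
  any-complete f (here refl) e rewrite e = refl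
  any-complete f {xs = y ∷ _} (there i) e with f y
  ... | true = refl
  ... | false = any-complete f i e

  all-sound : ∀ {A : Set} (f : A → Bool) {x : A} (xs : List A) → all f xs ≡ true → x ∈ xs → f x ≡ true
  all-sound f (x ∷ xs) eq (here refl) = proj₁ (∧-true eq)
  all-sound f (x ∷ xs) eq (there i) = all-sound f xs (proj₂ (∧-true {f x} eq)) i

  all-complete : ∀ {A : Set} (f : A → Bool) {xs : List A} → (∀ {x} → x ∈ xs → f x ≡ true) → all f xs ≡ true
  all-complete f {[]} _ = refl
  all-complete f {x ∷ xs} h rewrite h (here refl) = all-complete f (h ∘ there)

  -- The dichotomy behind a choice with repetition: the candidate `c` occurs and is taken once, or
  -- it can be discarded for good.
  split-∷ : ∀ {A : Set} {c : A} {cs} rs → All (_∈ c ∷ cs) rs → All (_∈ cs) rs ⊎ ∃ λ rs′ → rs ↭ c ∷ rs′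
  split-∷ [] [] = inj₁ []
  split-∷ (r ∷ rs) (here refl ∷ mem) = inj₂ (rs , ↭-refl)
  split-∷ {c = c} (r ∷ rs) (there i ∷ mem) with split-∷ rs mem
  ... | inj₁ mem′ = inj₁ (i ∷ mem′)
  ... | inj₂ (rs′ , p) = inj₂ (r ∷ rs′ , ↭-trans (↭-prep r p) (↭-swap r c ↭-refl))

  module Complete {S : Set} (admits : S → Mask → Bool) (step : Mask → S → S)
    (Inv : S → List Mask → Set)
    (inv-↭ : ∀ {s rs rs′} → rs ↭ rs′ → Inv s rs → Inv s rs′)
    (inv-step : ∀ {s r rs} → Inv s (r ∷ rs) → Inv (step r s) rs)
    (inv-admits : ∀ {s r rs} → Inv s (r ∷ rs) → admits s r ≡ true) where

    open Choose admits step

    admitted : ∀ {s rs} → Inv s rs → All (λ r → admits s r ≡ true) rs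
    admitted inv = All.tabulate λ r∈rs → inv-admits (inv-↭ (proj₂ (extract r∈rs)) inv)

    Completeness : ℕ → List Mask → Set
    Completeness m cs = ∀ s rs → length rs ≡ m → All (_∈ cs) rs → Inv s rs →
      ∃ λ rs′ → rs ↭ rs′ × rs′ ∈ choose m cs s

    choose-suc : ∀ m → (∀ cs → Completeness m cs) → ∀ cs → Completeness (suc m) cs
    choose-suc m ih [] s (r ∷ rs) _ (() ∷ _) _
    choose-suc m ih (c ∷ cs) s rs len mem inv with split-∷ rs mem
    ... | inj₁ mem′ with choose-suc m ih cs s rs len mem′ inv
    ... | rs′ , p , i = rs′ , p , ∈-++⁺ʳ (map (c ∷_) (choose m (filterᵇ (admits (step c s)) (c ∷ cs)) (step c s))) i
    choose-suc m ih (c ∷ cs) s rs len mem inv | inj₂ (rs′ , p)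
      with ih (filterᵇ (admits (step c s)) (c ∷ cs)) (step c s) rs′
             (suc-injective (trans (sym (↭-length p)) len))
             (All.zipWith (λ (i , e) → filterᵇ-∈ (admits (step c s)) i e)
               (All.tail (All-resp-↭ p mem) , admitted (inv-step (inv-↭ p inv))))
             (inv-step (inv-↭ p inv))
    ... | rs″ , q , i = c ∷ rs″ , ↭-trans p (↭-prep c q) , ∈-++⁺ˡ (∈-map⁺ (c ∷_) i)

    choose-complete : ∀ m cs → Completeness m cs
    choose-complete zero cs s [] _ _ _ = [] , ↭-refl , here refl
    choose-complete (suc m) = choose-suc m (choose-complete m)

  Avoided : ℕ → List Mask → List Mask → Set
  Avoided b rs L = All (λ I → count (λ r → disjoint r I) rs ≤ b) L

  Budget : ℕ → Layers → List Mask → Set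
  Budget b [] rs = ⊤
  Budget b (L ∷ Ls) rs = Avoided b rs L × Budget (suc b) Ls rs

  budget-↭ : ∀ b Ls {rs rs′} → rs ↭ rs′ → Budget b Ls rs → Budget b Ls rs′
  budget-↭ b [] p _ = tt
  budget-↭ b (L ∷ Ls) p (a , bs) = All.map (λ {I} → subst (_≤ b) (∑-↭ _ p)) a , budget-↭ (suc b) Ls p bs

  budget-step : ∀ b Ls {r rs} → Budget b Ls (r ∷ rs) → Budget b (advance r Ls) rs
  budget-step b [] _ = tt
  budget-step b (L ∷ []) _ = tt
  budget-step b (L ∷ L′ ∷ Ls) {r} {rs} (a , a′ , bs) =
    All.++⁺ (All.tabulate hit) (All.tabulate missed) , budget-step (suc b) (L′ ∷ Ls) (a′ , bs)
    where
    hit : ∀ {I} → I ∈ filterᵇ (λ I → not (disjoint r I)) L → count (λ r → disjoint r I) rs ≤ b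
    hit i = ≤-trans (m≤n+m _ _) (All.lookup a (proj₁ (filterᵇ-∈⁻ _ L i)))
    missed : ∀ {I} → I ∈ filterᵇ (disjoint r) L′ → count (λ r → disjoint r I) rs ≤ b
    missed {I} i with filterᵇ-∈⁻ (disjoint r) L′ i
    ... | j , e = ≤-pred (subst (λ d → 𝟙 d + _ ≤ suc b) e (All.lookup a′ j))

  budget-hits : ∀ Ls {r rs} → Budget 0 Ls (r ∷ rs) → hitsAll Ls r ≡ true
  budget-hits [] _ = refl
  budget-hits (L ∷ Ls) {r} {rs} (a , _) = cong not (any-false (disjoint r) (All.map unavoided a))
    where
    unavoided : ∀ {I} → count (λ r → disjoint r I) (r ∷ rs) ≤ 0 → disjoint r I ≡ false
    unavoided {I} le with disjoint r I
    ... | false = refl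
    unavoided () | true

  Within : ℕ → List Mask → List Mask → Set
  Within k S rs = ∀ {I} → I ∈ S → count (λ r → disjoint r I) rs + size I ≤ k

  layers-budget : ∀ k b m {S rs} → Within k S rs → Budget b (layers k b m S) rs
  layers-budget k b zero w = tt
  layers-budget k b (suc m) {S} {rs} w = All.tabulate avoided , layers-budget k (suc b) m w
    where
    avoided : ∀ {I} → I ∈ ofSize (k ∸ b) S → count (λ r → disjoint r I) rs ≤ b
    avoided {I} i with filterᵇ-∈⁻ (λ I → size I ≡ᵇ k ∸ b) S i
    ... | j , e = +-cancelʳ-≤ (k ∸ b) _ _ (≤-trans
      (subst (λ s → count (λ r → disjoint r I) rs + s ≤ k) (≡ᵇ-true e) (w j)) (m≤n+m∸n k b))

  opaque
    unfolding glue

    glue-complete : ∀ {k m ok P rs} → Within k (stable P) rs → length rs ≡ m →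
      All (_∈ stable P) rs → All (λ r → ok (size r) ≡ true) rs →
      ∃ λ rs′ → rs ↭ rs′ × rs′ ∈ glue k m ok P
    glue-complete {k} {m} {ok} {P} {rs} w len mem oks =
      choose-complete m _ Ls rs len
        (All.zipWith (λ (i , e) → filterᵇ-∈ (hitsAll Ls) i e)
          (All.zipWith (λ (i , e) → filterᵇ-∈ (λ r → ok (size r)) i e) (mem , oks) , admitted start))
        start
      where
      Ls : Layers
      Ls = layers k 0 m (stable P)
      open Complete hitsAll advance (Budget 0) (λ {s} → budget-↭ 0 s) (λ {s} → budget-step 0 s) (λ {s} → budget-hits s)
      start : Budget 0 Ls rs
      start = layers-budget k 0 m w

  eqMask-sound : ∀ p q → eqMask p q ≡ true → p ≡ q
  eqMask-sound [] [] _ = refl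
  eqMask-sound (true ∷ p) (true ∷ q) e = cong (true ∷_) (eqMask-sound p q e)
  eqMask-sound (false ∷ p) (false ∷ q) e = cong (false ∷_) (eqMask-sound p q e)

  select : ∀ {A : Set} → Mask → List A → List A
  select [] _ = []
  select (_ ∷ _) [] = []
  select (true ∷ p) (x ∷ xs) = x ∷ select p xs
  select (false ∷ p) (x ∷ xs) = select p xs

  select-⊑ : ∀ {A : Set} (p : Mask) (xs : List A) → select p xs ⊑ xs
  select-⊑ [] xs = xs , ↭-refl
  select-⊑ (_ ∷ _) [] = [] , ↭-refl
  select-⊑ (true ∷ p) (x ∷ xs) with select-⊑ p xs
  ... | zs , q = zs , ↭-prep x q
  select-⊑ (false ∷ p) (x ∷ xs) with select-⊑ p xs
  ... | zs , q = x ∷ zs , ↭-trans (↭-prep x q) (↭-sym (shift x (select p xs) zs))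

  disjoint-select : ∀ {A : Set} (f : A → Bool) (xs : List A) (p : Mask) →
    disjoint (map f xs) p ≡ true → All (λ x → f x ≡ false) (select p xs)
  disjoint-select f [] [] _ = []
  disjoint-select f [] (_ ∷ _) _ = []
  disjoint-select f (x ∷ xs) [] _ = []
  disjoint-select f (x ∷ xs) (b ∷ p) e with f x in eq | b
  ... | false | true = eq ∷ disjoint-select f xs p e
  ... | false | false = disjoint-select f xs p e
  ... | true | false = disjoint-select f xs p e

  disjoint-map : ∀ {A : Set} (f g : A → Bool) (xs : List A) →
    (∀ x → f x ≡ true → g x ≡ true → ⊥) → disjoint (map f xs) (map g xs) ≡ true
  disjoint-map f g [] _ = refl
  disjoint-map f g (x ∷ xs) excl with f x in p | g x in q
  ... | false | _ = disjoint-map f g xs excl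
  ... | true | false = disjoint-map f g xs excl
  ... | true | true = ⊥-elim (excl x p q)

  module Realisation {V : Set} (h : V → V → Bool)
    (h-sym : ∀ x y → h x y ≡ h y x)
    (triangle-free : ∀ x y z → h x y ≡ true → h y z ≡ true → h x z ≡ true → ⊥) where

    Independent : List V → Set
    Independent = AllPairs (λ x y → h x y ≡ false)

    independent-↭ : ∀ {xs ys} → xs ↭ ys → Independent xs → Independent ys
    independent-↭ = Permutation.AllPairs-resp-↭ (setoid V) (λ {x} {y} e → trans (h-sym y x) e)
      ((λ { refl e → e }) , (λ { refl e → e })) ∘ Perm.↭⇒↭ₛ
      where import Data.List.Relation.Binary.Permutation.Propositional as Perm

    independent-⊑ : ∀ {xs ys} → xs ⊑ ys → Independent ys → Independent xs
    independent-⊑ {xs} (zs , p) ind = prefix xs (independent-↭ p ind)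
      where
      prefix : ∀ xs {zs} → Independent (xs ++ zs) → Independent xs
      prefix [] _ = []
      prefix (x ∷ xs) (e ∷ es) = All.++⁻ˡ xs e ∷ prefix xs es

    -- Multiplicities count: a vertex repeated in a list acts as a pair of non-adjacent twins.
    α≤ : ℕ → List V → Set
    α≤ k xs = ∀ {as} → as ⊑ xs → Independent as → length as ≤ k

    α-⊑ : ∀ {k xs ys} → xs ⊑ ys → α≤ k ys → α≤ k xs
    α-⊑ s a t = a (⊑-trans t s)

    row : List V → V → Mask
    row ks a = map (h a) ks

    pattern-of : List V → Pattern
    pattern-of [] = []
    pattern-of (k ∷ ks) = row ks k ∷ pattern-of ks

    length-pattern : ∀ ks → length (pattern-of ks) ≡ length ks
    length-pattern [] = refl
    length-pattern (k ∷ ks) = cong suc (length-pattern ks)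

    -- A neighbourhood in a triangle-free graph is stable; this is why the rows of new vertices are
    -- sought among the stable sets.
    row-stable : ∀ a ks → row ks a ∈ stable (pattern-of ks)
    row-stable a [] = here refl
    row-stable a (k ∷ ks) with h a k in eq
    ... | false = ∈-++⁺ʳ (map (true ∷_) (filterᵇ (disjoint (row ks k)) (stable (pattern-of ks))))
                         (∈-map⁺ (false ∷_) (row-stable a ks))
    ... | true = ∈-++⁺ˡ (∈-map⁺ (true ∷_) (filterᵇ-∈ (disjoint (row ks k)) (row-stable a ks)
                   (disjoint-map (h k) (h a) ks λ x p q → triangle-free a k x eq p q)))

    stable-sound : ∀ ks {I} → I ∈ stable (pattern-of ks) →
      Independent (select I ks) × length (select I ks) ≡ size I
    stable-sound [] (here refl) = [] , refl
    stable-sound (k ∷ ks) i with ∈-++⁻ (map (true ∷_) (filterᵇ (disjoint (row ks k)) (stable (pattern-of ks)))) i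
    ... | inj₂ j with ∈-map⁻ (false ∷_) j
    ... | I , I∈ , refl = stable-sound ks I∈
    stable-sound (k ∷ ks) i | inj₁ j with ∈-map⁻ (true ∷_) j
    ... | I , I∈ , refl with filterᵇ-∈⁻ (disjoint (row ks k)) (stable (pattern-of ks)) I∈
    ... | I∈′ , e with stable-sound ks I∈′
    ... | ind , len = disjoint-select (h k) ks I e ∷ ind , cong suc len

    -- The new vertices that avoid `I`, together with the vertices of `I`, are pairwise
    -- non-adjacent.
    within-α : ∀ {k as ks} → Independent as → α≤ k (as ++ ks) → Within k (stable (pattern-of ks)) (map (row ks) as)
    within-α {k} {as} {ks} ind a {I} I∈ with partitionᵇ (λ x → disjoint (row ks x) I) as | stable-sound ks I∈
    ... | ts , us , p , dis , hit | indI , lenI = subst (_≤ k) lengths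
      (a ts++I⊑ (AllPairs.++⁺ (independent-⊑ (us , p) ind) indI
         (All.map (λ {x} → disjoint-select (h x) ks I) dis)))
      where
      ts++I⊑ : ts ++ select I ks ⊑ as ++ ks
      ts++I⊑ with select-⊑ I ks
      ... | zs , q = us ++ zs , ↭-trans (++⁺ p q) (interchange ts us (select I ks) zs)
        where
        open import Algebra.Bundles using (CommutativeMonoid)
        open import Data.List.Relation.Binary.Permutation.Propositional.Properties using (++-commutativeMonoid)
        open import Algebra.Properties.CommutativeSemigroup (CommutativeMonoid.commutativeSemigroup (++-commutativeMonoid {A = V})) using (interchange)
      lengths : length (ts ++ select I ks) ≡ count (λ r → disjoint r I) (map (row ks) as) + size I
      lengths = trans (length-++ ts) (cong₂ _+_ (sym counted) lenI)
        where
        counted : count (λ r → disjoint r I) (map (row ks) as) ≡ length ts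
        counted = trans (∑-map _ (row ks) as) (trans (∑-↭ _ p) (trans (∑-++ _ ts us)
          (trans (cong₂ _+_ (count-true dis) (count-false hit)) (+-identityʳ _))))

    glue-realised : ∀ {k m ok as ks} → Independent as → α≤ k (as ++ ks) → length as ≡ m →
      All (λ a → ok (size (row ks a)) ≡ true) as →
      ∃ λ as′ → as ↭ as′ × map (row ks) as′ ∈ glue k m ok (pattern-of ks)
    glue-realised {k} {m} {ok} {as} {ks} ind a len oks
      with glue-complete {k} {m} {ok} {pattern-of ks} (within-α ind a) (trans (length-map (row ks) as) len)
             (All.map⁺ (All.tabulate λ {x} _ → row-stable x ks)) (All.map⁺ oks)
    ... | rs′ , p , i with ↭-map-inv (row ks) p
    ... | as′ , refl , q = as′ , q , i

    row-false : ∀ {a as} → All (λ x → h a x ≡ false) as → row as a ≡ replicate (length as) false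
    row-false [] = refl
    row-false (e ∷ es) = cong₂ _∷_ e (row-false es)

    row-true : ∀ {a as} → All (λ x → h a x ≡ true) as → row as a ≡ replicate (length as) true
    row-true [] = refl
    row-true (e ∷ es) = cong₂ _∷_ e (row-true es)

    pattern-attach : ∀ {as ks} → Independent as →
      pattern-of (as ++ ks) ≡ attach (map (row ks) as) (pattern-of ks)
    pattern-attach [] = refl
    pattern-attach {a ∷ as} {ks} (e ∷ es) = cong₂ _∷_
      (trans (map-++ (h a) as ks) (cong (_++ row ks a)
        (trans (row-false e) (cong (λ n → replicate n false) (sym (length-map (row ks) as))))))
      (pattern-attach es)

    pattern-cone : ∀ {v as ks} → All (λ x → h v x ≡ true) as → All (λ x → h v x ≡ false) ks → Independent as →
      pattern-of (v ∷ as ++ ks) ≡ cone (map (row ks) as) (pattern-of ks)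
    pattern-cone {v} {as} {ks} t f ind = cong₂ _∷_
      (trans (map-++ (h v) as ks) (cong₂ _++_
        (trans (row-true t) (cong (λ n → replicate n true) (sym (length-map (row ks) as))))
        (trans (row-false f) (cong (λ n → replicate n false) (sym (length-pattern ks))))))
      (pattern-attach ind)

    Realises : List V → Pattern → Set
    Realises xs P = ∃ λ ks → xs ↭ ks × pattern-of ks ≡ P

    -- The items of the vertices ks still to be placed after cs has been placed.
    data Items (cs : List V) : List V → List Item → Set where
      []  : Items cs [] []
      _∷_ : ∀ l {k ks its} → Items cs ks its → Items cs (k ∷ ks) (item l (row cs k) (row ks k) ∷ its)

    items-cons : ∀ {cs ks its} k → Items cs ks its → Items (k ∷ cs) ks (consColumns (row ks k) its)
    items-cons k [] = []
    items-cons {cs} k (_∷_ l {x} {ks} {its} i) =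
      subst (λ b → Items (k ∷ cs) (x ∷ ks) (item l (b ∷ row cs x) (row ks x) ∷ consColumns (row ks k) its))
        (h-sym x k) (l ∷ items-cons k i)

    picks-sound : ∀ {cs ks its} → Items cs ks its → ∀ {i l c its′} → pick i l c its′ ∈ picks its →
      ∃₂ λ k ks′ → ks ↭ k ∷ ks′ × c ≡ row cs k × Items (k ∷ cs) ks′ its′
        × (∀ (f : V → Bool) → bit (map f ks) i ≡ f k × remove (map f ks) i ≡ map f ks′)
    picks-sound {ks = k ∷ ks} (l ∷ its) (here refl) =
      k , ks , ↭-refl , refl , items-cons k its , λ f → refl , refl
    picks-sound {cs} {ks = x ∷ ks} (l ∷ its) (there p) with ∈-map⁻ (skip (item l (row cs x) (row ks x))) p
    ... | pick i l′ c its″ , q , refl with picks-sound its q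
    ... | k , ks′ , ↭k , refl , its‴ , bits =
      k , x ∷ ks′ , ↭-trans (↭-prep x ↭k) (↭-swap x k ↭-refl) , refl ,
      subst₂ (λ b r → Items (k ∷ cs) (x ∷ ks′) (item l (b ∷ row cs x) r ∷ its″))
        (sym (proj₁ (bits (h x)))) (sym (proj₂ (bits (h x)))) (l ∷ its‴) ,
      λ f → proj₁ (bits f) , cong (f x ∷_) (proj₂ (bits f))

    mutual
      iso-sound : ∀ qs {cs ks its} → Items cs ks its → iso qs its ≡ true →
        ∃ λ zs → ks ++ cs ↭ zs × pattern-of zs ≡ map proj₂ qs ʳ++ pattern-of cs
      iso-sound [] {cs} [] _ = cs , ↭-refl , refl
      iso-sound [] (_ ∷ _) ()
      iso-sound (q ∷ qs) its e = isoPicks-sound q qs its (picks _) (λ i → i) e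

      isoPicks-sound : ∀ q qs {cs ks its} → Items cs ks its → ∀ ps → (∀ {p} → p ∈ ps → p ∈ picks its) →
        isoPicks q qs ps ≡ true →
        ∃ λ zs → ks ++ cs ↭ zs × pattern-of zs ≡ map proj₂ (q ∷ qs) ʳ++ pattern-of cs
      isoPicks-sound q qs its [] _ ()
      isoPicks-sound q qs {cs} its (pick i l c its′ ∷ ps) sub e
        with (proj₁ q ≡ᵇ l) ∧ eqMask (proj₂ q) c in e₁ | iso qs its′ in e₂
      ... | false | _ = isoPicks-sound q qs its ps (sub ∘ there) e
      ... | true | false = isoPicks-sound q qs its ps (sub ∘ there) e
      ... | true | true with picks-sound its (sub (here refl))
      ... | k , ks′ , ↭k , refl , its″ , _ with iso-sound qs its″ e₂
      ... | zs , p , pat =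
        zs , ↭-trans (++⁺ʳ cs ↭k) (↭-trans (↭-sym (shift k ks′ cs)) p) ,
        trans pat (cong (λ r → map proj₂ qs ʳ++ (r ∷ pattern-of cs))
          (sym (eqMask-sound (proj₂ q) _ (proj₂ (∧-true {proj₁ q ≡ᵇ l} e₁)))))

    items-start : ∀ ls ks → Items [] ks (map (λ { (l , r) → item l [] r }) (labelled ls (pattern-of ks)))
    items-start ls [] = []
    items-start [] (k ∷ ks) = 0 ∷ items-start [] ks
    items-start (l ∷ ls) (k ∷ ks) = l ∷ items-start ls ks

    -- Only a positive answer carries information: it moves a realisation to the pattern that
    -- `nubIso` retains. An overlooked isomorphism would merely leave a duplicate.
    isomorphic-sound : ∀ {xs P Q} → isomorphic Q P ≡ true → Realises xs P → Realises xs Q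
    isomorphic-sound {Q = Q} e (ks , p , refl)
      with iso-sound (reverse (labelled (labels Q) Q)) (items-start (labels (pattern-of ks)) ks)
             (proj₂ (∧-true {edges Q ≡ᵇ _} e))
    ... | zs , q , pat = zs , ↭-trans p (↭-trans (↭-sym (++-identityʳ ks)) q) , trans pat
      (trans (cong reverse (trans (reverse-map proj₂ (labelled (labels Q) Q)) (cong reverse (unlabel (labels Q) Q))))
             (reverse-involutive Q))
      where
      unlabel : ∀ ls P → map proj₂ (labelled ls P) ≡ P
      unlabel _ [] = refl
      unlabel [] (r ∷ P) = cong (r ∷_) (unlabel [] P)
      unlabel (l ∷ ls) (r ∷ P) = cong (r ∷_) (unlabel ls P)

    nubIso-complete : ∀ {xs P} Ps → Realises xs P → P ∈ Ps → Any (Realises xs) (nubIso Ps)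
    nubIso-complete (Q ∷ Ps) real i with any (λ R → isomorphic R Q) (nubIso Ps) in e | i
    ... | true | here refl with any-sound (λ R → isomorphic R Q) (nubIso Ps) e
    ... | R , j , eR = Any.map (λ { refl → isomorphic-sound {Q = R} eR real }) j
    nubIso-complete (Q ∷ Ps) real i | true | there j = nubIso-complete Ps real j
    nubIso-complete (Q ∷ Ps) real i | false | here refl = here real
    nubIso-complete (Q ∷ Ps) real i | false | there j = there (nubIso-complete Ps real j)

    realised : ∀ {xs} Ps → Any (Realises xs) Ps → ∃ λ ks → xs ↭ ks × pattern-of ks ∈ Ps
    realised (P ∷ Ps) (here (ks , p , refl)) = ks , p , here refl
    realised (P ∷ Ps) (there r) with realised Ps r
    ... | ks , p , i = ks , p , there i

    extensions-complete : ∀ {k x xs} Ps → Any (Realises xs) Ps → α≤ k (x ∷ xs) →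
      Any (Realises (x ∷ xs)) (extensions k Ps)
    extensions-complete {k} {x} {xs} Ps r a with realised Ps r
    ... | ks , p , P∈ with glue-realised {as = x ∷ []} {ks} ([] ∷ []) (α-⊑ (↭⇒⊑ (↭-prep x p)) a) refl (refl ∷ [])
    ... | as , q , i with ↭-singleton-inv (↭-sym q)
    ... | refl = nubIso-complete _ (x ∷ ks , ↭-prep x p , pattern-attach {x ∷ []} {ks} ([] ∷ []))
      (∈-concatMap⁺ (λ P → map (λ rs → attach rs P) (glue k 1 (λ _ → true) P))
        (Any.map (λ { refl → ∈-map⁺ (λ rs → attach rs (pattern-of ks)) i }) P∈))

    graphs[3,4]-complete : ∀ n xs → length xs ≡ n → α≤ 3 xs → Any (Realises xs) (graphs[3,4] n)
    graphs[3,4]-complete zero [] _ _ = subst (Any _) (sym graphs[3,4]-zero) (here ([] , ↭-refl , refl))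
    graphs[3,4]-complete (suc n) (x ∷ xs) len a = subst (Any _) (sym (graphs[3,4]-suc n))
      (extensions-complete (graphs[3,4] n)
        (graphs[3,4]-complete n xs (suc-injective len) (α-⊑ (⊑-++ʳ (x ∷ []) xs) a)) a)

-- Outcomes of the exhaustive searches.

module Computation where

  open import Data.Bool using (true)
  open import Data.Bool.ListAction using (all)
  open import Data.List using ([]; null)
  open import Relation.Binary.PropositionalEquality using (_≡_; refl)
  open Search

  opaque
    unfolding graphs13 glue

    -- This is R(3,4) ≤ 9.
    graphs[3,4]-9 : graphs[3,4] 9 ≡ []
    graphs[3,4]-9 = refl

    graphs13-unextendable : all (λ P → null (glue 5 3 (between 0 4) P)) graphs13 ≡ true
    graphs13-unextendable = refl

    graphs12-check17 : all check17 graphs12 ≡ true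
    graphs12-check17 = refl

    graphs12-check18 : all check18 graphs12 ≡ true
    graphs12-check18 = refl

    graphs12-check23 : all check23 graphs12 ≡ true
    graphs12-check23 = refl

-- The Ramsey bounds: degree sums, and R(3,j+1) for j up to 5.

module Ramsey where

  open import Data.Bool using (Bool; true; false; not; _∧_; _∨_)
  open import Data.Bool.ListAction using (all; any)
  open import Data.Empty using (⊥; ⊥-elim)
  open import Data.Nat using (ℕ; zero; suc; _+_; _*_; _∸_; _≤_; _≡ᵇ_; _≤ᵇ_; z≤n; s≤s; _≤?_)
  open import Data.Nat.Properties
  open import Data.List using (List; []; _∷_; _++_; map; length; null; take; drop)
  open import Data.List.Properties
    using (length-++; ++-assoc; length-map; take++drop≡id; length-take; map-cong-local; map-++;
      map-∘)
  open import Data.List.Relation.Unary.All as All using (All; []; _∷_)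
  import Data.List.Relation.Unary.All.Properties as All
  open import Data.List.Relation.Unary.AllPairs as AllPairs using (AllPairs; []; _∷_)
  import Data.List.Relation.Unary.AllPairs.Properties as AllPairs
  open import Data.List.Relation.Unary.Any as Any using (Any; here; there)
  open import Data.List.Membership.Propositional using (_∈_)
  open import Data.List.Membership.Propositional.Properties
    using (∈-++⁺ˡ; ∈-++⁺ʳ; ∈-map⁺; ∈-map⁻; ∈-concatMap⁺)
  open import Data.List.Relation.Binary.Permutation.Propositional
    using (_↭_; ↭-refl; ↭-sym; ↭-trans; ↭-reflexive; ↭-prep)
  open import Data.List.Relation.Binary.Permutation.Propositional.Properties
    using (↭-length; All-resp-↭; ∈-resp-↭; shift; ++⁺; ++⁺ˡ; ++⁺ʳ; ++-comm; map⁺; ↭-map-inv;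
      ++-commutativeMonoid)
  open import Data.Product using (_×_; _,_; proj₁; proj₂; ∃; ∃₂)
  open import Data.Sum using (_⊎_; inj₁; inj₂)
  open import Function using (_∘_; case_of_)
  open import Relation.Nullary using (¬_; contradiction; yes; no)
  open import Relation.Binary.PropositionalEquality
    using (_≡_; _≢_; refl; sym; trans; cong; cong₂; subst; module ≡-Reasoning)
  open import Data.Nat.Tactic.RingSolver using (solve-∀)
  open Computation
  open Search
  open Lists
  open Soundness

  ≢ᵇ-false : ∀ {m n} → (m ≡ᵇ n) ≡ false → m ≢ n
  ≢ᵇ-false {m} e refl = case trans (sym e) (≡⇒≡ᵇ-true {m} refl) of λ ()

  between-true : ∀ {lo hi s} → lo ≤ s → s ≤ hi → between lo hi s ≡ true
  between-true p q = cong₂ _∧_ (≤⇒≤ᵇ-true p) (≤⇒≤ᵇ-true q)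

  null-∉ : ∀ {A : Set} {x : A} {xs} → null xs ≡ true → x ∈ xs → ⊥
  null-∉ {xs = []} _ ()

  ∑-tight : ∀ {A : Set} {n} {f : A → ℕ} {xs : List A} → All (λ x → f x ≤ n) xs → length xs * n ≤ ∑ f xs →
    All (λ x → f x ≡ n) xs
  ∑-tight [] _ = []
  ∑-tight {n = n} {f} {x ∷ xs} (le ∷ les) tot = ≤-antisym le n≤fx ∷ ∑-tight les rest
    where
    n≤fx : n ≤ f x
    n≤fx = +-cancelʳ-≤ (length xs * n) _ _ (≤-trans tot (+-monoʳ-≤ (f x) (∑-≤ xs les)))
    rest : length xs * n ≤ ∑ f xs
    rest = +-cancelˡ-≤ n _ _ (≤-trans tot (+-monoˡ-≤ _ le))

  module TriangleFree {V : Set} (h : V → V → Bool)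
    (h-sym : ∀ x y → h x y ≡ h y x)
    (h-irrefl : ∀ x → h x x ≡ false)
    (triangle-free : ∀ x y z → h x y ≡ true → h y z ≡ true → h x z ≡ true → ⊥) where

    open Realisation h h-sym triangle-free public

    deg : V → List V → ℕ
    deg v = count (h v)

    cut : List V → List V → ℕ
    cut as bs = ∑ (λ a → deg a bs) as

    -- The sum of the degrees, hence twice the number of edges.
    vol : List V → ℕ
    vol xs = cut xs xs

    cut-sym : ∀ as bs → cut as bs ≡ cut bs as
    cut-sym as bs = trans (∑-swap (λ a b → 𝟙 (h a b)) as bs)
      (∑-cong bs (All.tabulate λ {b} _ → ∑-cong as (All.tabulate λ {a} _ → cong 𝟙 (h-sym a b))))

    cut-↭ʳ : ∀ as {bs cs} → bs ↭ cs → cut as bs ≡ cut as cs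
    cut-↭ʳ as p = ∑-cong as (All.tabulate λ {a} _ → ∑-↭ (𝟙 ∘ h a) p)

    vol-↭ : ∀ {xs ys} → xs ↭ ys → vol xs ≡ vol ys
    vol-↭ {xs} {ys} p = trans (∑-↭ (λ a → deg a xs) p) (cut-↭ʳ ys p)

    size-row : ∀ v ks → size (row ks v) ≡ deg v ks
    size-row v ks = ∑-map 𝟙 (h v) ks

    ∑-size-rows : ∀ as ks → ∑ size (map (row ks) as) ≡ cut as ks
    ∑-size-rows as ks = trans (∑-map size (row ks) as) (∑-cong as (All.tabulate λ {a} _ → size-row a ks))

    deg-irrefl : ∀ v xs → deg v (v ∷ xs) ≡ deg v xs
    deg-irrefl v xs rewrite h-irrefl v = refl

    deg-≤ : ∀ v xs → deg v xs ≤ length xs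
    deg-≤ v = count-≤ (h v)

    vol-∷ : ∀ v xs → vol (v ∷ xs) ≡ 2 * deg v xs + vol xs
    vol-∷ v xs = trans (cong₂ _+_ (deg-irrefl v xs) (trans (∑-+ (λ x → 𝟙 (h x v)) (λ x → deg x xs) xs)
        (cong (_+ vol xs) (∑-cong xs (All.tabulate λ {x} _ → cong 𝟙 (h-sym x v))))))
      (double (deg v xs) (vol xs))
      where
      double : ∀ a b → a + (a + b) ≡ 2 * a + b
      double = solve-∀

    vol-edges : ∀ ks → vol ks ≡ 2 * edges (pattern-of ks)
    vol-edges [] = refl
    vol-edges (k ∷ ks) = trans (vol-∷ k ks) (trans (cong₂ (λ a b → 2 * a + b) (sym (size-row k ks)) (vol-edges ks))
      (sym (*-distribˡ-+ 2 (size (row ks k)) _)))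

    independent-deg : ∀ {xs} → Independent xs → All (λ x → deg x xs ≡ 0) xs
    independent-deg {xs} ind = All.tabulate λ {x} x∈xs → case extract x∈xs of λ where
      (ys , p) → trans (∑-↭ (𝟙 ∘ h x) p) (trans (deg-irrefl x ys) (count-false (AllPairs.head (independent-↭ p ind))))

    adjacent-nonadjacent : ∀ {v xs} → All (λ x → h v x ≡ true) xs → Independent xs
    adjacent-nonadjacent [] = []
    adjacent-nonadjacent {v} {x ∷ xs} (e ∷ es) = All.map (λ {y} e′ → not-both y e′) es ∷ adjacent-nonadjacent es
      where
      not-both : ∀ y → h v y ≡ true → h x y ≡ false
      not-both y e′ with h x y in exy
      ... | false = refl
      ... | true = ⊥-elim (triangle-free v x y e exy e′)

    record Hood (v : V) (xs : List V) : Set where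
      field
        {near far} : List V
        splits     : xs ↭ v ∷ near ++ far
        adjacent   : All (λ x → h v x ≡ true) near
        apart      : All (λ x → h v x ≡ false) far

      near-independent : Independent near
      near-independent = adjacent-nonadjacent adjacent

      near-apart : All (λ x → h x v ≡ true) near
      near-apart = All.map (λ {x} → trans (h-sym x v)) adjacent

      deg-split : ∀ w → deg w xs ≡ 𝟙 (h w v) + (deg w near + deg w far)
      deg-split w = trans (∑-↭ (𝟙 ∘ h w) splits) (cong (𝟙 (h w v) +_) (∑-++ (𝟙 ∘ h w) near far))

      deg-near : deg v xs ≡ length near
      deg-near = trans (deg-split v) (trans (cong₂ (λ a b → 𝟙 a + (b + deg v far)) (h-irrefl v) (count-true adjacent))
        (trans (cong (length near +_) (count-false apart)) (+-identityʳ _)))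

      deg-of-near : All (λ w → deg w xs ≡ suc (deg w far)) near
      deg-of-near = All.zipWith (λ {w} (e , z) → trans (deg-split w)
        (cong₂ (λ a b → 𝟙 a + (b + deg w far)) e z)) (near-apart , independent-deg near-independent)

      deg-of-far : All (λ w → deg w xs ≡ deg w near + deg w far) far
      deg-of-far = All.map (λ {w} e → trans (deg-split w)
        (cong (λ a → 𝟙 a + (deg w near + deg w far)) (trans (h-sym w v) e))) apart

      ∑-near : ∑ (λ w → deg w xs) near ≡ length near + cut near far
      ∑-near = trans (∑-cong near deg-of-near) (trans (∑-+ (λ _ → 1) (λ w → deg w far) near)
        (cong (_+ cut near far) (trans (∑-const 1 near) (*-identityʳ _))))

      -- The neighbours of `v` are pairwise non-adjacent, so each edge not inside `far` has exactly
      -- one end in `near`.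
      vol-split : vol xs ≡ vol far + 2 * ∑ (λ w → deg w xs) near
      vol-split = begin
        vol xs ≡⟨ ∑-↭ (λ w → deg w xs) splits ⟩
        deg v xs + ∑ (λ w → deg w xs) (near ++ far) ≡⟨ cong₂ _+_ deg-near (∑-++ (λ w → deg w xs) near far) ⟩
        length near + (∑ (λ w → deg w xs) near + ∑ (λ w → deg w xs) far)
          ≡⟨ cong (λ s → length near + (∑ (λ w → deg w xs) near + s)) far-sum ⟩
        length near + (∑ (λ w → deg w xs) near + (cut near far + vol far))
          ≡⟨ rearrange (length near) _ (cut near far) (vol far) ⟩
        vol far + ((length near + cut near far) + ∑ (λ w → deg w xs) near)
          ≡⟨ cong (λ s → vol far + (s + ∑ (λ w → deg w xs) near)) (sym ∑-near) ⟩
        vol far + (∑ (λ w → deg w xs) near + ∑ (λ w → deg w xs) near)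
          ≡⟨ cong (vol far +_) (double (∑ (λ w → deg w xs) near)) ⟩
        vol far + 2 * ∑ (λ w → deg w xs) near ∎
        where
        open ≡-Reasoning
        far-sum : ∑ (λ w → deg w xs) far ≡ cut near far + vol far
        far-sum = trans (∑-cong far deg-of-far) (trans (∑-+ (λ w → deg w near) (λ w → deg w far) far) (cong (_+ vol far) (cut-sym far near)))
        rearrange : ∀ n s c k → n + (s + (c + k)) ≡ k + ((n + c) + s)
        rearrange = solve-∀
        double : ∀ s → s + s ≡ 2 * s
        double = solve-∀

      length-split : length xs ≡ suc (deg v xs + length far)
      length-split = trans (↭-length splits) (cong suc (trans (length-++ near) (cong (_+ length far) (sym deg-near))))

      near-⊑ : near ⊑ xs
      near-⊑ = v ∷ far , ↭-trans splits (↭-sym (shift v near far))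

      far-⊑ : v ∷ far ⊑ xs
      far-⊑ = near , ↭-trans splits (↭-prep v (++-comm near far))

      rest-⊑ : near ++ far ⊑ xs
      rest-⊑ = v ∷ [] , ↭-trans splits (++-comm (v ∷ []) (near ++ far))

      α-far : ∀ {k} → α≤ (suc k) xs → α≤ k far
      α-far a {as} (zs , p) ind = ≤-pred (a {v ∷ as} (⊑-trans (zs , ↭-prep v p) far-⊑) (⊑-All (zs , p) apart ∷ ind))

      deg-α : ∀ {k} → α≤ k xs → deg v xs ≤ k
      deg-α a = subst (_≤ _) (sym deg-near) (a near-⊑ near-independent)

    open Hood

    hood : ∀ {v xs} → v ∈ xs → Hood v xs
    hood {v} i with extract i
    ... | ys , p with partitionᵇ (h v) ys
    ... | near , far , q , t , f = record { splits = ↭-trans p (↭-prep v q) ; adjacent = t ; apart = f }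

    Bound : ℕ → ℕ → Set
    Bound k n = ∀ xs → α≤ k xs → length xs ≤ n

    bound-by : ∀ {k n} → (∀ xs → length xs ≡ suc n → α≤ k xs → ⊥) → Bound k n
    bound-by {k} {n} none xs a with length xs ≤? n
    ... | yes le = le
    ... | no ¬le = ⊥-elim (none (take (suc n) xs)
      (trans (length-take (suc n) xs) (m≤n⇒m⊓n≡m (≰⇒> ¬le)))
      (α-⊑ (drop (suc n) xs , ↭-reflexive (sym (take++drop≡id (suc n) xs))) a))

    -- A neighbourhood is stable, so it has at most `suc k` elements; adding the vertex to a stable
    -- set of its non-neighbours shows that these satisfy the previous bound.
    bound-suc : ∀ {k n} → Bound k n → Bound (suc k) (suc (suc k + n))
    bound-suc b [] a = z≤n
    bound-suc b (x ∷ xs) a = ≤-trans (≤-reflexive (length-split H))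
      (s≤s (+-mono-≤ (deg-α H a) (b (far H) (α-far H a))))
      where
      H : Hood x (x ∷ xs)
      H = hood (here refl)

    -- The source of all lower bounds on degrees: the non-neighbours of `v` have smaller stable sets
    -- and are therefore few.
    degree-bound : ∀ {k n v xs} → Bound k n → α≤ (suc k) xs → v ∈ xs → length xs ≤ suc (deg v xs + n)
    degree-bound {n = n} {v} {xs} b a i = ≤-trans (≤-reflexive (length-split H)) (s≤s (+-monoʳ-≤ _ (b (far H) (α-far H a))))
      where H = hood i

    bound₀ : Bound 0 0
    bound₀ [] a = z≤n
    bound₀ (x ∷ xs) a = case a (⊑-++ˡ (x ∷ []) xs) ([] ∷ []) of λ ()

    bound₁ : Bound 1 2
    bound₁ = bound-suc bound₀

    bound₂ : Bound 2 5
    bound₂ = bound-suc bound₁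

    bound₃ : Bound 3 8
    bound₃ = bound-by λ xs len a → case subst (Any (Realises xs)) graphs[3,4]-9 (graphs[3,4]-complete 9 xs len a) of λ ()

    bound₄ : Bound 4 13
    bound₄ = bound-suc bound₃

    degree≥ : ∀ {k n v xs} → Bound k n → α≤ (suc k) xs → ∀ d → length xs ≡ suc (d + n) → v ∈ xs → d ≤ deg v xs
    degree≥ {n = n} {v} {xs} b a d len i = +-cancelʳ-≤ n _ _ (≤-pred (subst (_≤ suc (deg v xs + n)) len (degree-bound b a i)))

    degree≤ : ∀ {k v xs} → α≤ k xs → v ∈ xs → deg v xs ≤ k
    degree≤ a i = deg-α (hood i) a

    far-length : ∀ {v xs m} (H : Hood v xs) d → length xs ≡ suc (d + m) → deg v xs ≡ d → length (far H) ≡ m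
    far-length {m = m} H d len e = +-cancelˡ-≡ d _ _ (suc-injective (trans (cong (λ x → suc (x + length (far H))) (sym e))
      (trans (sym (length-split H)) len)))

    graphs12-complete : ∀ {v xs} → length xs ≡ 12 → α≤ 4 xs → v ∈ xs → deg v xs ≡ 3 → Any (Realises xs) graphs12
    graphs12-complete {v} {xs} len a i dv with realised (graphs[3,4] 8)
      (graphs[3,4]-complete 8 (far (hood i)) (far-length (hood i) 3 len dv) (α-far (hood i) a))
    ... | ks , p , P∈ with glue-realised {4} {3} {between 2 3} {near (hood i)} {ks} (near-independent (hood i))
          (α-⊑ (⊑-trans (↭⇒⊑ (++⁺ˡ (near (hood i)) p)) (rest-⊑ (hood i))) a)
          (trans (sym (deg-near (hood i))) dv) sizes
      where
      H = hood i
      sizes : All (λ x → between 2 3 (size (row ks x)) ≡ true) (near H)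
      sizes = All.zipWith (λ {x} (e , x∈) → let
          s : size (row ks x) ≡ deg x (far H)
          s = trans (size-row x ks) (sym (∑-↭ (𝟙 ∘ h x) p))
        in subst (λ d → between 2 3 d ≡ true) (sym s) (between-true
             (≤-pred (subst (3 ≤_) e (degree≥ bound₃ a 3 len x∈)))
             (≤-pred (subst (_≤ 4) e (degree≤ a x∈)))))
        (deg-of-near H , ⊑-All (near-⊑ H) (All.tabulate λ j → j))
    ... | as′ , q , r = subst (Any _) (sym graphs12-cones) (nubIso-complete _
      (v ∷ as′ ++ ks , ↭-trans (splits H) (↭-prep v (++⁺ q p)) ,
       pattern-cone (All-resp-↭ q (adjacent H)) (All-resp-↭ p (apart H)) (independent-↭ q (near-independent H)))
      (∈-concatMap⁺ (λ P → map (λ rs → cone rs P) (glue 4 3 (between 2 3) P))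
        (Any.map (λ { refl → ∈-map⁺ (λ rs → cone rs (pattern-of ks)) r }) P∈)))
      where H = hood i

    neighbour : ∀ {v xs d} → deg v xs ≡ suc d → ∃ λ w → w ∈ xs × h v w ≡ true
    neighbour {v} {xs} e with locate (h v) xs
    ... | inj₁ none = case trans (sym e) (count-false none) of λ ()
    ... | inj₂ found = found

    -- By R(3,4) ≤ 9 every degree is at least 13 - 1 - 8 = 4, hence equal to 4. Deleting `x` turns a
    -- neighbour of `x` into a vertex of degree 3, which puts the remaining 12 vertices into
    -- `graphs12`.
    graphs13-complete : ∀ {xs} → length xs ≡ 13 → α≤ 4 xs → Any (Realises xs) graphs13
    graphs13-complete {x ∷ ys} len a with neighbour {x} {ys} (trans (sym (deg-irrefl x ys)) (four (here refl)))
      where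
      four : ∀ {w} → w ∈ x ∷ ys → deg w (x ∷ ys) ≡ 4
      four w∈ = ≤-antisym (degree≤ a w∈) (degree≥ bound₃ a 4 len w∈)
    ... | w , w∈ , e = subst (Any _) (sym graphs13-extensions) (extensions-complete graphs12
      (graphs12-complete (suc-injective len) (α-⊑ (⊑-++ʳ (x ∷ []) ys) a) w∈ three) a)
      where
      three : deg w ys ≡ 3
      three = suc-injective (trans (cong (λ b → 𝟙 b + deg w ys) (sym (trans (h-sym w x) e)))
        (≤-antisym (degree≤ a (there w∈)) (degree≥ bound₃ a 4 len (there w∈))))

    members : (xs : List V) → All (_∈ xs) xs
    members xs = All.tabulate (λ i → i)

    deg-↭ : ∀ v {xs ys} → xs ↭ ys → deg v xs ≡ deg v ys
    deg-↭ v p = ∑-↭ (𝟙 ∘ h v) p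

    rest-α : ∀ {v k xs ks} (H : Hood v xs) → α≤ k xs → far H ↭ ks → α≤ k (near H ++ ks)
    rest-α H a p = α-⊑ (⊑-trans (↭⇒⊑ (++⁺ˡ (near H) p)) (rest-⊑ H)) a

    row-sizes : ∀ {v xs ks} (H : Hood v xs) → far H ↭ ks → (P : ℕ → Set) →
      (∀ {w} → w ∈ xs → ∀ d → deg w xs ≡ suc d → P d) → All (λ w → P (size (row ks w))) (near H)
    row-sizes {ks = ks} H p P good = All.zipWith
      (λ {w} (e , i) → good i _ (trans e (cong suc (trans (deg-↭ w p) (sym (size-row w ks))))))
      (deg-of-near H , ⊑-All (near-⊑ H) (members _))

    twelve-degree : ∀ {w xs} → length xs ≡ 12 → α≤ 4 xs → w ∈ xs → 3 ≤ deg w xs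
    twelve-degree len a i = degree≥ bound₃ a 3 len i

    -- All degrees are at least 12 - 1 - 8 = 3. A vertex of degree 3 leads into the catalogue;
    -- otherwise the degree sum is at least 12 · 4.
    twelve : ∀ {xs} → length xs ≡ 12 → α≤ 4 xs → Any (Realises xs) graphs12 ⊎ 48 ≤ vol xs
    twelve {xs} len a with locate (λ w → deg w xs ≡ᵇ 3) xs
    ... | inj₂ (w , i , e) = inj₁ (graphs12-complete len a i (≡ᵇ-true e))
    ... | inj₁ none = inj₂ (subst (λ n → n * 4 ≤ vol xs) len (∑-≥ xs
      (All.zipWith (λ (e , i) → ≤∧≢⇒< (twelve-degree len a i) (≢ᵇ-false e ∘ sym)) (none , members xs))))

    seventeen-degree : ∀ {w xs} → length xs ≡ 17 → α≤ 5 xs → w ∈ xs → 3 ≤ deg w xs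
    seventeen-degree len a i = degree≥ bound₄ a 3 len i

    -- Such a vertex has 13 non-neighbours without stable 5-set, and its three neighbours would be
    -- glued onto one of `graphs13`.
    seventeen-degree≢3 : ∀ {v xs} → length xs ≡ 17 → α≤ 5 xs → v ∈ xs → deg v xs ≢ 3
    seventeen-degree≢3 {v} {xs} len a i dv
      with realised graphs13 (graphs13-complete (far-length (hood i) 3 len dv) (α-far (hood i) a))
    ... | ks , p , P∈ with glue-realised {5} {3} {between 0 4} (near-independent H) (rest-α H a p)
          (trans (sym (deg-near H)) dv) (row-sizes H p (λ s → between 0 4 s ≡ true) λ j d e →
            between-true z≤n (≤-pred (subst (_≤ 5) e (degree≤ a j))))
      where H = hood i
    ... | as′ , _ , r = null-∉ (all-sound (λ P → null (glue 5 3 (between 0 4) P)) graphs13 graphs13-unextendable P∈) r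

    seventeen-degree≥4 : ∀ {w xs} → length xs ≡ 17 → α≤ 5 xs → w ∈ xs → 4 ≤ deg w xs
    seventeen-degree≥4 len a i = ≤∧≢⇒< (seventeen-degree len a i) (seventeen-degree≢3 len a i ∘ sym)

    seventeen-far-heavy : ∀ {v xs} (H : Hood v xs) → deg v xs ≡ 4 → All (λ w → 4 ≤ deg w xs) xs →
      48 ≤ vol (far H) → 80 ≤ vol xs
    seventeen-far-heavy {v} {xs} H dv four big = begin
      48 + 2 * 16 ≤⟨ +-mono-≤ big (*-monoʳ-≤ 2 near-16) ⟩
      vol (far H) + 2 * ∑ (λ w → deg w xs) (near H) ≡⟨ sym (vol-split H) ⟩
      vol xs ∎
      where
      open ≤-Reasoning
      near-16 : 16 ≤ ∑ (λ w → deg w xs) (near H)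
      near-16 = subst (λ n → n * 4 ≤ ∑ (λ w → deg w xs) (near H)) (trans (sym (deg-near H)) dv)
        (∑-≥ (near H) (⊑-All (near-⊑ H) four))

    seventeen-glued : ∀ {v xs ks} (H : Hood v xs) → length xs ≡ 17 → α≤ 5 xs → deg v xs ≡ 4 → far H ↭ ks →
      pattern-of ks ∈ graphs12 → 80 ≤ vol xs
    seventeen-glued {v} {xs} {ks} H len a dv p P∈ = conclude
      (glue-realised {5} {4} {between 3 4} (near-independent H) (rest-α H a p)
        (trans (sym (deg-near H)) dv) (row-sizes H p (λ s → between 3 4 s ≡ true) sizes))
      where
      sizes : ∀ {w} → w ∈ xs → ∀ d → deg w xs ≡ suc d → between 3 4 d ≡ true
      sizes j d e = between-true
        (≤-pred (subst (4 ≤_) e (seventeen-degree≥4 len a j)))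
        (≤-pred (subst (_≤ 5) e (degree≤ a j)))
      P : Pattern
      P = pattern-of ks
      conclude : (∃ λ as′ → near H ↭ as′ × map (row ks) as′ ∈ glue 5 4 (between 3 4) P) → 80 ≤ vol xs
      conclude (as′ , q , r) = begin
        2 * 40 ≤⟨ *-monoʳ-≤ 2 counted ⟩
        2 * (edges P + (4 + ∑ size (map (row ks) as′))) ≡⟨ *-distribˡ-+ 2 (edges P) _ ⟩
        2 * edges P + 2 * (4 + ∑ size (map (row ks) as′))
          ≡⟨ cong₂ (λ a b → a + 2 * b) (sym (trans (vol-↭ p) (vol-edges ks))) (sym rows) ⟩
        vol (far H) + 2 * ∑ (λ w → deg w xs) (near H) ≡⟨ sym (vol-split H) ⟩
        vol xs ∎
        where
        open ≤-Reasoning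
        counted : 40 ≤ edges P + (4 + ∑ size (map (row ks) as′))
        counted = ≤ᵇ-true (all-sound (λ rs → 40 ≤ᵇ edges P + (4 + ∑ size rs)) (glue 5 4 (between 3 4) P)
          (all-sound check17 graphs12 graphs12-check17 P∈) r)
        rows : ∑ (λ w → deg w xs) (near H) ≡ 4 + ∑ size (map (row ks) as′)
        rows = trans (∑-near H) (cong₂ _+_ (trans (sym (deg-near H)) dv)
          (trans (cut-↭ʳ (near H) p) (trans (∑-↭ (λ w → deg w ks) q) (sym (∑-size-rows as′ ks)))))

    -- Without vertices of degree 4 the sum is at least 17 · 5. Around a vertex of degree 4, the 12
    -- non-neighbours either have degree sum at least 48, and 48 + 2 · 16 = 80, or they are
    -- catalogued and `check17` applies.
    seventeen-vol : ∀ {xs} → length xs ≡ 17 → α≤ 5 xs → 80 ≤ vol xs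
    seventeen-vol {xs} len a with locate (λ w → deg w xs ≡ᵇ 4) xs
    ... | inj₁ none = ≤-trans (m≤n+m 80 5) (≤-trans (≤-reflexive (cong (_* 5) (sym len))) (∑-≥ xs
      (All.zipWith (λ {w} (e , i) → ≤∧≢⇒< (seventeen-degree≥4 len a i) (≢ᵇ-false {deg w xs} {4} e ∘ sym))
        (none , members xs))))
    ... | inj₂ (v , i , e) = cases (twelve (far-length H 4 len dv) (α-far H a))
      where
      H : Hood v xs
      H = hood i
      dv : deg v xs ≡ 4
      dv = ≡ᵇ-true {deg v xs} {4} e
      cases : Any (Realises (far H)) graphs12 ⊎ 48 ≤ vol (far H) → 80 ≤ vol xs
      cases (inj₂ big) = seventeen-far-heavy H dv (All.tabulate (seventeen-degree≥4 len a)) big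
      cases (inj₁ r) = let ks , p , P∈ = realised graphs12 r in seventeen-glued H len a dv p P∈

    vol-delete : ∀ {v xs} → v ∈ xs → ∃ λ ys → xs ↭ v ∷ ys × vol xs ≡ 2 * deg v xs + vol ys
    vol-delete {v} i with extract i
    ... | ys , p = ys , p , trans (vol-↭ p) (trans (vol-∷ v ys)
      (cong (λ d → 2 * d + vol ys) (sym (trans (deg-↭ v p) (deg-irrefl v ys)))))

    eighteen-vol : ∀ {v xs} → length xs ≡ 18 → α≤ 5 xs → v ∈ xs → 2 * deg v xs + 80 ≤ vol xs
    eighteen-vol {v} {xs} len a i with vol-delete i
    ... | ys , p , e = subst (2 * deg v xs + 80 ≤_) (sym e) (+-monoʳ-≤ (2 * deg v xs)
      (seventeen-vol (suc-injective (trans (sym (↭-length p)) len)) (α-⊑ (v ∷ [] , ↭-trans p (++-comm (v ∷ []) ys)) a)))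

    -- With a vertex of degree 5 the sum is at least 10 + 80 = 18 · 5, which is also the maximum, so
    -- every degree is 5. Without one it is at most 18 · 4 = 72, against the lower bound 80.
    eighteen-regular : ∀ {xs} → length xs ≡ 18 → α≤ 5 xs → All (λ w → deg w xs ≡ 5) xs
    eighteen-regular {xs} len a with locate (λ w → deg w xs ≡ᵇ 5) xs
    ... | inj₂ (v , i , e) = ∑-tight (All.tabulate (degree≤ a)) (≤-trans (≤-reflexive (cong (_* 5) len))
      (subst (λ d → 2 * d + 80 ≤ vol xs) (≡ᵇ-true {deg v xs} {5} e) (eighteen-vol len a i)))
    ... | inj₁ none = contradiction (≤-trans big small) (<⇒≱ (m≤n+m 73 7))
      where
      small : vol xs ≤ 72
      small = ≤-trans (∑-≤ {n = 4} xs
        (All.zipWith (λ {w} (e , i) → ≤-pred (≤∧≢⇒< (degree≤ a i) (≢ᵇ-false {deg w xs} {5} e))) (none , members xs)))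
        (≤-reflexive (cong (_* 4) len))
      big : 80 ≤ vol xs
      big = heavy xs len a
        where
        heavy : ∀ xs → length xs ≡ 18 → α≤ 5 xs → 80 ≤ vol xs
        heavy (x ∷ ys) len a = ≤-trans (m≤n+m 80 (2 * deg x (x ∷ ys))) (eighteen-vol len a (here refl))

    bound₅ : Bound 5 17
    bound₅ = bound-by eighteen
      where
      eighteen : ∀ xs → length xs ≡ 18 → α≤ 5 xs → ⊥
      eighteen (x ∷ ys) len a = impossible
        where
        xs = x ∷ ys
        regular : All (λ w → deg w xs ≡ 5) xs
        regular = eighteen-regular len a
        H : Hood x xs
        H = hood (here refl)
        near-5 : length (near H) ≡ 5
        near-5 = trans (sym (deg-near H)) (All.head regular)
        vol-far : vol (far H) ≡ 40
        vol-far = +-cancelʳ-≡ 50 _ _ (trans (cong (λ s → vol (far H) + 2 * s)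
          (sym (trans (∑-≡ (near H) (⊑-All (near-⊑ H) regular)) (cong (_* 5) near-5))))
          (trans (sym (vol-split H)) (trans (∑-≡ xs regular) (cong (_* 5) len))))
        impossible : ⊥
        impossible with twelve (far-length H 5 len (All.head regular)) (α-far H a)
        ... | inj₂ big = contradiction (subst (48 ≤_) vol-far big) (<⇒≱ (m≤n+m 41 7))
        ... | inj₁ r with realised graphs12 r
        ... | ks , p , P∈ with glue-realised {5} {5} {4 ≡ᵇ_} (near-independent H) (rest-α H a p) near-5
              (row-sizes H p (λ s → (4 ≡ᵇ s) ≡ true) λ j d e → ≡⇒≡ᵇ-true {4} (suc-injective (trans (sym (All.lookup regular j)) e)))
        ... | as′ , _ , r′ = null-∉ (not-20 (all-sound check18 graphs12 graphs12-check18 P∈)) r′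
          where
          P : Pattern
          P = pattern-of ks
          edges-20 : edges P ≡ 20
          edges-20 = *-cancelˡ-≡ _ _ 2 (trans (sym (vol-edges ks)) (trans (sym (vol-↭ p)) vol-far))
          not-20 : check18 P ≡ true → null (glue 5 5 (4 ≡ᵇ_) P) ≡ true
          not-20 = subst (λ n → not (n ≡ᵇ 20) ∨ null (glue 5 5 (4 ≡ᵇ_) P) ≡ true) edges-20

    open import Algebra.Solver.CommutativeMonoid (++-commutativeMonoid {A = V}) using (solve; _⊕_; _⊜_)

    scaled : ∀ {m} n k → m ≡ n → m * k ≡ n * k
    scaled n k refl = refl

    -- R(3,7) ≤ 23: excluding vertices of degree 5.

    module Irregular {xs : List V} (len : length xs ≡ 23) (a : α≤ 6 xs) where

      five : V → ℕ
      five v = 𝟙 (deg v xs ≡ᵇ 5)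

      n₅ : ℕ
      n₅ = ∑ five xs

      -- By R(3,6) ≤ 18 every degree is at least 23 - 1 - 17 = 5, and a neighbourhood, being stable,
      -- has at most 6 elements.
      deg+five : ∀ {v} → v ∈ xs → deg v xs + five v ≡ 6
      deg+five {v} i = six (deg v xs) (degree≥ bound₅ a 5 len i) (degree≤ a i)
        where
        six : ∀ d → 5 ≤ d → d ≤ 6 → d + 𝟙 (d ≡ᵇ 5) ≡ 6
        six 5 _ _ = refl
        six 6 _ _ = refl
        six (suc (suc (suc (suc (suc (suc (suc _))))))) _ (s≤s (s≤s (s≤s (s≤s (s≤s (s≤s ()))))))
        six 4 (s≤s (s≤s (s≤s (s≤s ())))) _
        six 3 (s≤s (s≤s (s≤s ()))) _
        six 2 (s≤s (s≤s ())) _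
        six 1 (s≤s ()) _

      vol+n₅ : vol xs + n₅ ≡ 138
      vol+n₅ = trans (sym (∑-+ (λ v → deg v xs) five xs))
        (trans (∑-≡ {n = 6} xs (All.tabulate deg+five)) (scaled 23 6 len))

      fives : V → ℕ
      fives v = ∑ (λ x → 𝟙 (h v x) * five x) xs

      fives-near : ∀ {v} (H : Hood v xs) → fives v ≡ ∑ five (near H)
      fives-near {v} H = begin
        fives v ≡⟨ ∑-↭ f (splits H) ⟩
        f v + ∑ f (near H ++ far H) ≡⟨ cong₂ _+_ (cong (λ b → 𝟙 b * five v) (h-irrefl v)) (∑-++ f (near H) (far H)) ⟩
        ∑ f (near H) + ∑ f (far H) ≡⟨ cong₂ _+_
          (∑-cong (near H) (All.map (λ {x} e → trans (cong (λ b → 𝟙 b * five x) e) (+-identityʳ _)) (adjacent H)))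
          (trans (∑-≡ {n = 0} (far H) (All.map (λ {x} e → cong (λ b → 𝟙 b * five x) e) (apart H))) (*-zeroʳ (length (far H)))) ⟩
        ∑ five (near H) + 0 ≡⟨ +-identityʳ _ ⟩
        ∑ five (near H) ∎
        where
        open ≡-Reasoning
        f : V → ℕ
        f x = 𝟙 (h v x) * five x

      -- The total `138 - n₅` is at least 80, from the 17 non-neighbours, plus twice the degree sum
      -- `30 - fives v` of the five neighbours.
      fives≥ : ∀ {v} → v ∈ xs → deg v xs ≡ 5 → n₅ + 2 ≤ 2 * fives v
      fives≥ {v} i dv = +-cancelʳ-≤ (80 + 2 * s) _ _ (begin
        (n₅ + 2) + (80 + 2 * s) ≤⟨ +-monoʳ-≤ (n₅ + 2) heavy ⟩
        (n₅ + 2) + vol xs ≡⟨ shuffle n₅ (vol xs) ⟩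
        (vol xs + n₅) + 2 ≡⟨ cong (_+ 2) vol+n₅ ⟩
        80 + 2 * 30 ≡⟨ cong (λ m → 80 + 2 * m) (sym thirty) ⟩
        80 + 2 * (s + fives v) ≡⟨ regroup s (fives v) ⟩
        2 * fives v + (80 + 2 * s) ∎)
        where
        open ≤-Reasoning
        H : Hood v xs
        H = hood i
        s : ℕ
        s = ∑ (λ w → deg w xs) (near H)
        heavy : 80 + 2 * s ≤ vol xs
        heavy = ≤-trans (+-monoˡ-≤ (2 * s) (seventeen-vol (far-length H 5 len dv) (α-far H a)))
          (≤-reflexive (sym (vol-split H)))
        thirty : s + fives v ≡ 30
        thirty = trans (cong (s +_) (fives-near H)) (trans (sym (∑-+ (λ w → deg w xs) five (near H)))
          (trans (∑-≡ {n = 6} (near H) (⊑-All (near-⊑ H) (All.tabulate deg+five)))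
            (cong (_* 6) (trans (sym (deg-near H)) dv))))
        shuffle : ∀ n m → (n + 2) + m ≡ (m + n) + 2
        shuffle = solve-∀
        regroup : ∀ s t → 80 + 2 * (s + t) ≡ 2 * t + (80 + 2 * s)
        regroup = solve-∀

      -- Adjacent vertices have no common neighbour, so no vertex of degree 5 is counted twice.
      fives-adjacent : ∀ {v w} → h v w ≡ true → fives v + fives w ≤ n₅
      fives-adjacent {v} {w} e = ≤-trans (≤-reflexive (sym (∑-+ (λ x → 𝟙 (h v x) * five x) (λ x → 𝟙 (h w x) * five x) xs)))
        (∑-mono xs (All.tabulate λ {x} _ → once x))
        where
        once : ∀ x → 𝟙 (h v x) * five x + 𝟙 (h w x) * five x ≤ five x
        once x with h v x in p | h w x in q
        ... | true | true = ⊥-elim (triangle-free v w x e q p)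
        ... | true | false = ≤-reflexive (trans (+-identityʳ _) (+-identityʳ _))
        ... | false | true = ≤-reflexive (+-identityʳ _)
        ... | false | false = z≤n

      -- A vertex v of degree 5 satisfies n₅ + 2 ≤ 2 fives v, so it has a neighbour w of
      -- degree 5, and fives v + fives w exceeds n₅.
      no-five : ∀ {v} → v ∈ xs → deg v xs ≢ 5
      no-five {v} i dv = absurd (locate (λ x → h v x ∧ (deg x xs ≡ᵇ 5)) xs)
        where
        absurd : All (λ x → h v x ∧ (deg x xs ≡ᵇ 5) ≡ false) xs ⊎ (∃ λ x → x ∈ xs × h v x ∧ (deg x xs ≡ᵇ 5) ≡ true) → ⊥
        absurd (inj₁ none) = contradiction
          (≤-trans (fives≥ i dv) (≤-reflexive (cong (2 *_)
            (trans (∑-≡ {n = 0} xs (All.map (λ {x} → zero-product (h v x) _) none)) (*-zeroʳ (length xs))))))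
          (<⇒≱ (≤-trans (s≤s z≤n) (m≤n+m 2 n₅)))
          where
          zero-product : ∀ b c → b ∧ c ≡ false → 𝟙 b * 𝟙 c ≡ 0
          zero-product false _ _ = refl
          zero-product true false _ = refl
        absurd (inj₂ (w , j , e)) = contradiction (begin
          4 + 2 * n₅ ≡⟨ shuffle n₅ ⟩
          (n₅ + 2) + (n₅ + 2) ≤⟨ +-mono-≤ (fives≥ i dv) (fives≥ j (≡ᵇ-true {deg w xs} {5} (proj₂ (∧-true {h v w} e)))) ⟩
          2 * fives v + 2 * fives w ≡⟨ sym (*-distribˡ-+ 2 (fives v) (fives w)) ⟩
          2 * (fives v + fives w) ≤⟨ *-monoʳ-≤ 2 (fives-adjacent (proj₁ (∧-true {h v w} e))) ⟩
          2 * n₅ ∎) (<⇒≱ (m≤n+m (suc (2 * n₅)) 3))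
          where
          open ≤-Reasoning
          shuffle : ∀ n → 4 + 2 * n ≡ (n + 2) + (n + 2)
          shuffle = solve-∀

      regular : All (λ v → deg v xs ≡ 6) xs
      regular = All.tabulate λ {v} i → ≤-antisym (degree≤ a i)
        (≤∧≢⇒< (degree≥ bound₅ a 5 len i) (no-five i ∘ sym))

    deg-α′ : ∀ {k ws} v → α≤ k ws → deg v ws ≤ k
    deg-α′ {k} {ws} v a = bounded (partitionᵇ (h v) ws)
      where
      bounded : (∃₂ λ ys zs → ws ↭ ys ++ zs × All (λ x → h v x ≡ true) ys × All (λ x → h v x ≡ false) zs) → deg v ws ≤ k
      bounded (ys , zs , p , t , f) = ≤-trans (≤-reflexive (trans (deg-↭ v p) (trans (∑-++ (𝟙 ∘ h v) ys zs)
        (trans (cong₂ _+_ (count-true t) (count-false f)) (+-identityʳ _))))) (a (zs , p) (adjacent-nonadjacent t))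

    α-apart : ∀ {k x xs ys} → x ∷ ys ⊑ xs → All (λ y → h x y ≡ false) ys → α≤ (suc k) xs → α≤ k ys
    α-apart {x = x} s f a {as} (zs , p) ind =
      ≤-pred (a {x ∷ as} (⊑-trans (zs , ↭-prep x p) s) (⊑-All (zs , p) f ∷ ind))

    -- The vertices of `ws` without neighbour in `as` can be joined to `as` in a stable set, so
    -- there are at most `n` of them; each other vertex of `ws` accounts for an edge of the cut.
    cover : ∀ {k n} → Bound k n → ∀ as ws → Independent as → α≤ (length as + k) (as ++ ws) → length ws ≤ n + cut as ws
    cover {n = n} b [] ws _ a = ≤-trans (b ws a) (≤-reflexive (sym (+-identityʳ n)))
    cover {k} {n} b (x ∷ as) ws (e ∷ ind) a = uncovered (partitionᵇ (h x) ws)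
      where
      uncovered : (∃₂ λ ys zs → ws ↭ ys ++ zs × All (λ y → h x y ≡ true) ys × All (λ y → h x y ≡ false) zs) →
        length ws ≤ n + (deg x ws + cut as ws)
      uncovered (ys , zs , p , t , f) = begin
        length ws ≡⟨ trans (↭-length p) (length-++ ys) ⟩
        length ys + length zs ≤⟨ +-monoʳ-≤ (length ys) (cover b as zs ind (α-apart sub (All.++⁺ e f) a)) ⟩
        length ys + (n + cut as zs) ≤⟨ +-mono-≤ ys≤ (+-monoʳ-≤ n zs≤) ⟩
        deg x ws + (n + cut as ws) ≡⟨ shuffle (deg x ws) n (cut as ws) ⟩
        n + (deg x ws + cut as ws) ∎
        where
        open ≤-Reasoning
        shuffle : ∀ d n c → d + (n + c) ≡ n + (d + c)
        shuffle = solve-∀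
        sub : x ∷ (as ++ zs) ⊑ x ∷ as ++ ws
        sub = ys , ↭-prep x (↭-trans (++⁺ˡ as (↭-trans p (++-comm ys zs))) (↭-reflexive (sym (++-assoc as zs ys))))
        ys≤ : length ys ≤ deg x ws
        ys≤ = ≤-trans (≤-reflexive (sym (count-true t))) (≤-trans (m≤m+n _ (deg x zs))
          (≤-reflexive (sym (trans (deg-↭ x p) (∑-++ (𝟙 ∘ h x) ys zs)))))
        zs≤ : cut as zs ≤ cut as ws
        zs≤ = ∑-mono as (All.tabulate λ {y} _ → ≤-trans (m≤n+m (deg y zs) (deg y ys))
          (≤-reflexive (sym (trans (deg-↭ y p) (∑-++ (𝟙 ∘ h y) ys zs)))))

    -- R(3,7) ≤ 23: correctness of the pair search.

    addMask-row : ∀ x (g : V → ℕ) ks → addMask (row ks x) (map g ks) ≡ map (λ w → 𝟙 (h w x) + g w) ks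
    addMask-row x g [] = refl
    addMask-row x g (k ∷ ks) = cong₂ _∷_ (cong (λ b → 𝟙 b + g k) (h-sym x k)) (addMask-row x g ks)

    addMasks-rows : ∀ as (g : V → ℕ) ks → addMasks (map (row ks) as) (map g ks) ≡ map (λ w → deg w as + g w) ks
    addMasks-rows [] g ks = refl
    addMasks-rows (x ∷ as) g ks = trans (cong (addMask (row ks x)) (addMasks-rows as g ks))
      (trans (addMask-row x (λ w → deg w as + g w) ks)
        (map-cong-local (All.tabulate λ {w} _ → sym (+-assoc (𝟙 (h w x)) (deg w as) (g w)))))

    degrees-pattern : ∀ ks → degrees (pattern-of ks) ≡ map (λ w → deg w ks) ks
    degrees-pattern [] = refl
    degrees-pattern (k ∷ ks) = cong₂ _∷_ (trans (size-row k ks) (sym (deg-irrefl k ks)))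
      (trans (cong (addMask (row ks k)) (degrees-pattern ks)) (addMask-row k (λ w → deg w ks) ks))

    -- The invariant of the search in `completions`: the missing degrees are those that the vertices
    -- not yet chosen will supply.
    Deficit : List V → List ℕ → List Mask → Set
    Deficit ks D rs = ∃ λ cs → rs ≡ map (row ks) cs × D ≡ map (λ w → deg w cs) ks

    deficit-↭ : ∀ {ks D rs rs′} → rs ↭ rs′ → Deficit ks D rs → Deficit ks D rs′
    deficit-↭ {ks} p (cs , refl , refl) with ↭-map-inv (row ks) p
    ... | cs′ , refl , q = cs′ , refl , map-cong-local (All.tabulate λ {w} _ → deg-↭ w q)

    deduct-row : ∀ c cs ks → deduct (row ks c) (map (λ w → deg w (c ∷ cs)) ks) ≡ map (λ w → deg w cs) ks
    deduct-row c cs [] = refl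
    deduct-row c cs (k ∷ ks) = cong₂ _∷_
      (trans (cong (λ b → 𝟙 (h k c) + deg k cs ∸ 𝟙 b) (h-sym c k)) (m+n∸m≡n (𝟙 (h k c)) (deg k cs)))
      (deduct-row c cs ks)

    fits-row : ∀ c cs ks → fits (map (λ w → deg w (c ∷ cs)) ks) (row ks c) ≡ true
    fits-row c cs [] = refl
    fits-row c cs (k ∷ ks) rewrite h-sym k c with h c k
    ... | true = fits-row c cs ks
    ... | false with deg k cs
    ... | zero = fits-row c cs ks
    ... | suc _ = fits-row c cs ks

    deficit-step : ∀ {ks D r rs} → Deficit ks D (r ∷ rs) → Deficit ks (deduct r D) rs
    deficit-step {ks} (c ∷ cs , refl , refl) = cs , refl , deduct-row c cs ks

    deficit-fits : ∀ {ks D r rs} → Deficit ks D (r ∷ rs) → fits D r ≡ true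
    deficit-fits {ks} (c ∷ cs , refl , refl) = fits-row c cs ks

    completions-complete : ∀ {ks as bs cs} → All (λ w → deg w cs + (deg w as + (deg w bs + deg w ks)) ≡ 6) ks →
      All (λ c → deg c ks ≡ 4) cs → length cs ≡ 3 →
      ∃ λ cs′ → cs ↭ cs′ × map (row ks) cs′ ∈ completions (pattern-of ks) (map (row ks) as) (map (row ks) bs)
    completions-complete {ks} {as} {bs} {cs} six four three = conclude (choose-complete 3 _ D (rows cs)
        (trans (length-map (row ks) cs) three)
        (All.zipWith (λ (k , e) → filterᵇ-∈ (fits D) k e) (candidates , admitted start)) start)
      where
      rows : List V → List Mask
      rows = map (row ks)
      P : Pattern
      P = pattern-of ks
      D : List ℕ
      D = map (6 ∸_) (addMasks (rows as) (addMasks (rows bs) (degrees P)))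
      open Complete fits deduct (Deficit ks) deficit-↭ deficit-step deficit-fits
      D≡ : D ≡ map (λ w → deg w cs) ks
      D≡ = trans (cong (map (6 ∸_)) (trans (cong (addMasks (rows as))
            (trans (cong (addMasks (rows bs)) (degrees-pattern ks)) (addMasks-rows bs (λ w → deg w ks) ks)))
            (addMasks-rows as (λ w → deg w bs + deg w ks) ks)))
        (trans (sym (map-∘ ks)) (map-cong-local (All.map (λ {w} e →
          trans (cong (_∸ (deg w as + (deg w bs + deg w ks))) (sym e)) (m+n∸n≡m (deg w cs) (deg w as + (deg w bs + deg w ks)))) six)))
      start : Deficit ks D (rows cs)
      start = cs , refl , D≡
      candidates : All (_∈ ofSize 4 (stable P)) (rows cs)
      candidates = All.map⁺ (All.map (λ {c} e → filterᵇ-∈ (λ I → size I ≡ᵇ 4) (row-stable c ks)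
        (≡⇒≡ᵇ-true {n = 4} (trans (size-row c ks) e))) four)
      conclude : (∃ λ rs′ → rows cs ↭ rs′ × rs′ ∈ completions P (rows as) (rows bs)) →
        ∃ λ cs′ → cs ↭ cs′ × rows cs′ ∈ completions P (rows as) (rows bs)
      conclude (rs′ , p , i) with ↭-map-inv (row ks) p
      ... | cs′ , refl , q = cs′ , q , i

    -- Adjacent vertices have disjoint rows, so the number of disjoint rows is at least the degree
    -- into `bs`.
    sided-complete : ∀ {ks as bs} → All (λ x → deg x bs + deg x ks ≡ 5) as →
      sided (map (row ks) as) (map (row ks) bs) ≡ true
    sided-complete {ks} {as} {bs} five = all-complete _ λ {r} i → enough r (∈-map⁻ (row ks) i)
      where
      enough : ∀ r → (∃ λ x → x ∈ as × r ≡ row ks x) → (5 ≤ᵇ size r + count (disjoint r) (map (row ks) bs)) ≡ true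
      enough _ (x , i , refl) = ≤⇒≤ᵇ-true (begin
        5 ≡⟨ sym (trans (+-comm (deg x ks) _) (All.lookup five i)) ⟩
        deg x ks + deg x bs ≤⟨ +-mono-≤ (≤-reflexive (sym (size-row x ks))) (∑-mono bs (All.tabulate λ {b} _ → avoid b)) ⟩
        size (row ks x) + ∑ (λ b → 𝟙 (disjoint (row ks x) (row ks b))) bs
          ≡⟨ cong (size (row ks x) +_) (sym (∑-map (𝟙 ∘ disjoint (row ks x)) (row ks) bs)) ⟩
        size (row ks x) + count (disjoint (row ks x)) (map (row ks) bs) ∎)
        where
        open ≤-Reasoning
        avoid : ∀ b → 𝟙 (h x b) ≤ 𝟙 (disjoint (row ks x) (row ks b))
        avoid b with h x b in e
        ... | false = z≤n
        ... | true = ≤-reflexive (cong 𝟙 (sym (disjoint-map (h x) (h b) ks λ y p q → triangle-free x b y e q p)))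

    within-complete : ∀ {ks cs as} → Independent (cs ++ as) → α≤ 6 ((cs ++ as) ++ ks) →
      within 6 (stable (pattern-of ks)) (map (row ks) cs ++ map (row ks) as) ≡ true
    within-complete {ks} {cs} {as} ind a = subst (λ rs → within 6 (stable (pattern-of ks)) rs ≡ true) (map-++ (row ks) cs as)
      (all-complete _ λ i → ≤⇒≤ᵇ-true (within-α ind a i))

    survives-complete : ∀ {ks as bs cs} → All (λ x → deg x bs + deg x ks ≡ 5) as →
      All (λ w → deg w cs + (deg w as + (deg w bs + deg w ks)) ≡ 6) ks →
      All (λ c → deg c ks ≡ 4) cs → length cs ≡ 3 →
      Independent (cs ++ as) → α≤ 6 ((cs ++ as) ++ ks) →
      Independent (cs ++ bs) → α≤ 6 ((cs ++ bs) ++ ks) →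
      survives (pattern-of ks) (map (row ks) as) (map (row ks) bs) ≡ true
    survives-complete {ks} {as} {bs} {cs} five six four three indA αA indB αB = cong₂ _∧_ (sided-complete {ks} {as} {bs} five)
        (found (completions-complete {ks} {as} {bs} {cs} six four three))
      where
      P : Pattern
      P = pattern-of ks
      rows : List V → List Mask
      rows = map (row ks)
      found : (∃ λ cs′ → cs ↭ cs′ × rows cs′ ∈ completions P (rows as) (rows bs)) →
        any (λ rs → within 6 (stable P) (rs ++ rows as) ∧ within 6 (stable P) (rs ++ rows bs)) (completions P (rows as) (rows bs)) ≡ true
      found (cs′ , p , i) = any-complete _ i (cong₂ _∧_
        (within-complete {ks} {cs′} (independent-↭ (++⁺ʳ as p) indA) (α-⊑ (↭⇒⊑ (++⁺ʳ ks (++⁺ʳ as p))) αA))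
        (within-complete {ks} {cs′} (independent-↭ (++⁺ʳ bs p) indB) (α-⊑ (↭⇒⊑ (++⁺ʳ ks (++⁺ʳ bs p))) αB)))

    -- R(3,7) ≤ 23: the 6-regular case.

    module Regular {xs : List V} (len : length xs ≡ 23) (a : α≤ 6 xs) (regular : All (λ v → deg v xs ≡ 6) xs) where

      -- Of the total 138, the 36 edges that meet the neighbourhood of `v` take 72.
      vol-far : ∀ {v} (H : Hood v xs) → v ∈ xs → vol (far H) ≡ 66
      vol-far {v} H i = +-cancelʳ-≡ 72 _ _ (trans (cong (λ s → vol (far H) + 2 * s)
        (sym (trans (∑-≡ {n = 6} (near H) (⊑-All (near-⊑ H) regular))
          (cong (_* 6) (trans (sym (deg-near H)) (All.lookup regular i))))))
        (trans (sym (vol-split H)) (trans (∑-≡ {n = 6} xs regular) (scaled 23 6 len))))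

      far-16 : ∀ {v} (H : Hood v xs) → v ∈ xs → length (far H) ≡ 16
      far-16 H i = far-length H 6 len (All.lookup regular i)

      near-6 : ∀ {v} (H : Hood v xs) → v ∈ xs → length (near H) ≡ 6
      near-6 H i = trans (sym (deg-near H)) (All.lookup regular i)

      far-∈ : ∀ {v u} (H : Hood v xs) → u ∈ far H → u ∈ xs
      far-∈ {v} H j = ∈-resp-↭ (↭-sym (splits H)) (there (∈-++⁺ʳ (near H) j))

      far-degree : ∀ {v u} (H : Hood v xs) → u ∈ far H → deg u (near H) + deg u (far H) ≡ 6
      far-degree H j = trans (sym (All.lookup (deg-of-far H) j)) (All.lookup regular (far-∈ H j))

      adjacent-deg : ∀ {u w} ys → h u w ≡ true → deg u ys + deg w ys ≤ length ys
      adjacent-deg {u} {w} ys e = ≤-trans (≤-reflexive (sym (∑-+ (𝟙 ∘ h u) (𝟙 ∘ h w) ys)))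
        (≤-trans (∑-≤ {n = 1} ys (All.tabulate λ {x} _ → once x)) (≤-reflexive (*-identityʳ _)))
        where
        once : ∀ x → 𝟙 (h u x) + 𝟙 (h w x) ≤ 1
        once x with h u x in p | h w x in q
        ... | true | true = ⊥-elim (triangle-free u w x e q p)
        ... | true | false = ≤-refl
        ... | false | true = ≤-refl
        ... | false | false = z≤n

      far-degree≤ : ∀ {v u} (H : Hood v xs) → u ∈ far H → deg u (far H) ≤ 5
      far-degree≤ H j = degree≤ (α-far H a) j

      far-degree≥2 : ∀ {v u} (H : Hood v xs) → v ∈ xs → u ∈ far H → 2 ≤ deg u (far H)
      far-degree≥2 H i j = degree≥ bound₄ (α-far H a) 2 (far-16 H i) j

      -- Here `u` and `v` would have four common neighbours. Their 13 common non-neighbours have all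
      -- degrees at least 4, since R(3,4) ≤ 9. A neighbour of `u` in `far H` misses the four common
      -- ones, so it has at most 2 neighbours in `near H` and at least 4 in `far H`. But 52 + 2 · 8
      -- exceeds 66.
      far-degree≢2 : ∀ {v u} (H : Hood v xs) → v ∈ xs → u ∈ far H → deg u (far H) ≢ 2
      far-degree≢2 {v} {u} H i j d = contradiction (begin
        52 + 2 * 8 ≤⟨ +-mono-≤ vol-W (*-monoʳ-≤ 2 sum-A) ⟩
        vol (far HU) + 2 * ∑ (λ w → deg w (far H)) (near HU) ≡⟨ sym (vol-split HU) ⟩
        vol (far H) ≡⟨ vol-far H i ⟩
        66 ∎) (<⇒≱ (m≤n+m 67 1))
        where
        open ≤-Reasoning
        HU : Hood u (far H)
        HU = hood j
        W-13 : length (far HU) ≡ 13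
        W-13 = far-length HU 2 (far-16 H i) d
        vol-W : 52 ≤ vol (far HU)
        vol-W = ≤-trans (≤-reflexive (sym (scaled 13 4 W-13)))
          (∑-≥ {n = 4} (far HU) (All.tabulate (degree≥ bound₃ (α-far HU (α-far H a)) 4 W-13)))
        deg-A : ∀ {w} → w ∈ near HU → h u w ≡ true → 4 ≤ deg w (far H)
        deg-A {w} k e = +-cancelˡ-≤ (deg w (near H)) _ _ (begin
          deg w (near H) + 4 ≡⟨ cong (deg w (near H) +_) (sym (+-cancelʳ-≡ 2 _ 4 (trans (cong (deg u (near H) +_) (sym d)) (far-degree H j)))) ⟩
          deg w (near H) + deg u (near H) ≡⟨ +-comm (deg w (near H)) _ ⟩
          deg u (near H) + deg w (near H) ≤⟨ adjacent-deg (near H) e ⟩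
          length (near H) ≡⟨ near-6 H i ⟩
          6 ≡⟨ sym (far-degree H (⊑-∈ k)) ⟩
          deg w (near H) + deg w (far H) ∎)
          where
          ⊑-∈ : w ∈ near HU → w ∈ far H
          ⊑-∈ k = All.lookup (⊑-All (near-⊑ HU) (members (far H))) k
        sum-A : 8 ≤ ∑ (λ w → deg w (far H)) (near HU)
        sum-A = ≤-trans (≤-reflexive (cong (_* 4) (trans (sym d) (deg-near HU))))
          (∑-≥ {n = 4} (near HU) (All.zipWith (λ (e , k) → deg-A k e) (adjacent HU , members (near HU))))

      far-degree≥3 : ∀ {v u} (H : Hood v xs) → v ∈ xs → u ∈ far H → 3 ≤ deg u (far H)
      far-degree≥3 H i j = ≤∧≢⇒< (far-degree≥2 H i j) (far-degree≢2 H i j ∘ sym)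

      deg-pieces : ∀ {v u C B A W} → xs ↭ v ∷ (C ++ B) ++ (u ∷ A ++ W) → ∀ x →
        deg x xs ≡ 𝟙 (h x v) + ((deg x C + deg x B) + (𝟙 (h x u) + (deg x A + deg x W)))
      deg-pieces {v} {u} {C} {B} {A} {W} p x = trans (deg-↭ x p) (cong (𝟙 (h x v) +_)
        (trans (∑-++ f (C ++ B) (u ∷ A ++ W)) (cong₂ _+_ (∑-++ f C B) (cong (𝟙 (h x u) +_) (∑-++ f A W)))))
        where
        f = 𝟙 ∘ h x

      -- C = N(v) ∩ N(u), B = N(v) ∖ N(u), A = N(u) ∖ N(v), and W is the rest.
      record Pair (v u : V) : Set where
        field
          {C B A W} : List V
          pieces : xs ↭ v ∷ (C ++ B) ++ (u ∷ A ++ W)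
          vC : All (λ x → h v x ≡ true) C
          vB : All (λ x → h v x ≡ true) B
          vA : All (λ x → h v x ≡ false) A
          vW : All (λ x → h v x ≡ false) W
          uC : All (λ x → h u x ≡ true) C
          uB : All (λ x → h u x ≡ false) B
          uA : All (λ x → h u x ≡ true) A
          uW : All (λ x → h u x ≡ false) W
          vu : h v u ≡ false

        six : ∀ {x} → x ∈ v ∷ (C ++ B) ++ (u ∷ A ++ W) →
          𝟙 (h x v) + ((deg x C + deg x B) + (𝟙 (h x u) + (deg x A + deg x W))) ≡ 6
        six {x} i = trans (sym (deg-pieces {C = C} {B} {A} {W} pieces x)) (All.lookup regular (∈-resp-↭ (↭-sym pieces) i))

        CB-independent : Independent (C ++ B)
        CB-independent = adjacent-nonadjacent (All.++⁺ vC vB)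

        CA-independent : Independent (C ++ A)
        CA-independent = adjacent-nonadjacent (All.++⁺ uC uA)

        B-degree : ∀ {b} → b ∈ B → deg b A + deg b W ≡ 5
        B-degree {b} i = suc-injective (begin
          suc (deg b A + deg b W) ≡⟨ cong₂ (λ s t → s + ((t + 0) + (0 + (deg b A + deg b W)))) (cong 𝟙 (sym bv)) (sym (proj₁ bCB)) ⟩
          𝟙 (h b v) + ((deg b C + 0) + (0 + (deg b A + deg b W)))
            ≡⟨ cong₂ (λ s t → 𝟙 (h b v) + ((deg b C + s) + (t + (deg b A + deg b W)))) (sym (proj₂ bCB)) (cong 𝟙 (sym bu)) ⟩
          𝟙 (h b v) + ((deg b C + deg b B) + (𝟙 (h b u) + (deg b A + deg b W))) ≡⟨ six (there (∈-++⁺ˡ (∈-++⁺ʳ C i))) ⟩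
          6 ∎)
          where
          open ≡-Reasoning
          bv : h b v ≡ true
          bv = trans (h-sym b v) (All.lookup vB i)
          bu : h b u ≡ false
          bu = trans (h-sym b u) (All.lookup uB i)
          none-bCB : deg b C + deg b B ≡ 0
          none-bCB = trans (sym (∑-++ (𝟙 ∘ h b) C B)) (All.lookup (independent-deg CB-independent) (∈-++⁺ʳ C i))
          bCB : deg b C ≡ 0 × deg b B ≡ 0
          bCB = m+n≡0⇒m≡0 (deg b C) none-bCB , m+n≡0⇒n≡0 (deg b C) none-bCB

        A-degree : ∀ {x} → x ∈ A → deg x B + deg x W ≡ 5
        A-degree {x} i = suc-injective (begin
          suc (deg x B + deg x W) ≡⟨ sym (+-suc (deg x B) (deg x W)) ⟩
          deg x B + suc (deg x W) ≡⟨ cong₂ (λ s t → s + ((t + deg x B) + suc (deg x W))) (cong 𝟙 (sym xv)) (sym (proj₁ xCA)) ⟩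
          𝟙 (h x v) + ((deg x C + deg x B) + suc (deg x W))
            ≡⟨ cong₂ (λ s t → 𝟙 (h x v) + ((deg x C + deg x B) + (s + (t + deg x W)))) (cong 𝟙 (sym xu)) (sym (proj₂ xCA)) ⟩
          𝟙 (h x v) + ((deg x C + deg x B) + (𝟙 (h x u) + (deg x A + deg x W)))
            ≡⟨ six (there (∈-++⁺ʳ (C ++ B) (there (∈-++⁺ˡ i)))) ⟩
          6 ∎)
          where
          open ≡-Reasoning
          xv : h x v ≡ false
          xv = trans (h-sym x v) (All.lookup vA i)
          xu : h x u ≡ true
          xu = trans (h-sym x u) (All.lookup uA i)
          none-xCA : deg x C + deg x A ≡ 0
          none-xCA = trans (sym (∑-++ (𝟙 ∘ h x) C A)) (All.lookup (independent-deg CA-independent) (∈-++⁺ʳ C i))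
          xCA : deg x C ≡ 0 × deg x A ≡ 0
          xCA = m+n≡0⇒m≡0 (deg x C) none-xCA , m+n≡0⇒n≡0 (deg x C) none-xCA

        C-degree : ∀ {c} → c ∈ C → deg c W ≡ 4
        C-degree {c} i = suc-injective (suc-injective (begin
          2 + deg c W ≡⟨ cong₂ (λ s t → s + (0 + (t + (0 + deg c W)))) (cong 𝟙 (sym cv)) (cong 𝟙 (sym cu)) ⟩
          𝟙 (h c v) + (0 + (𝟙 (h c u) + (0 + deg c W)))
            ≡⟨ cong₂ (λ s t → 𝟙 (h c v) + (s + (𝟙 (h c u) + (t + deg c W)))) (sym cCB) (sym cA) ⟩
          𝟙 (h c v) + ((deg c C + deg c B) + (𝟙 (h c u) + (deg c A + deg c W))) ≡⟨ six (there (∈-++⁺ˡ (∈-++⁺ˡ i))) ⟩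
          6 ∎))
          where
          open ≡-Reasoning
          cv : h c v ≡ true
          cv = trans (h-sym c v) (All.lookup vC i)
          cu : h c u ≡ true
          cu = trans (h-sym c u) (All.lookup uC i)
          cCB : deg c C + deg c B ≡ 0
          cCB = trans (sym (∑-++ (𝟙 ∘ h c) C B)) (All.lookup (independent-deg CB-independent) (∈-++⁺ˡ i))
          cA : deg c A ≡ 0
          cA = m+n≡0⇒n≡0 (deg c C) (trans (sym (∑-++ (𝟙 ∘ h c) C A))
            (All.lookup (independent-deg CA-independent) (∈-++⁺ˡ i)))

        W-degree : ∀ {w} → w ∈ W → deg w C + (deg w A + (deg w B + deg w W)) ≡ 6
        W-degree {w} i = begin
          deg w C + (deg w A + (deg w B + deg w W)) ≡⟨ shuffle (deg w C) (deg w A) (deg w B) (deg w W) ⟩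
          0 + ((deg w C + deg w B) + (0 + (deg w A + deg w W)))
            ≡⟨ cong₂ (λ s t → s + ((deg w C + deg w B) + (t + (deg w A + deg w W)))) (cong 𝟙 (sym wv)) (cong 𝟙 (sym wu)) ⟩
          𝟙 (h w v) + ((deg w C + deg w B) + (𝟙 (h w u) + (deg w A + deg w W)))
            ≡⟨ six (there (∈-++⁺ʳ (C ++ B) (there (∈-++⁺ʳ A i)))) ⟩
          6 ∎
          where
          open ≡-Reasoning
          shuffle : ∀ c a b w → c + (a + (b + w)) ≡ 0 + ((c + b) + (0 + (a + w)))
          shuffle = solve-∀
          wv : h w v ≡ false
          wv = trans (h-sym w v) (All.lookup vW i)
          wu : h w u ≡ false
          wu = trans (h-sym w u) (All.lookup uW i)

        cut-A : cut A B + cut A W ≡ length A * 5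
        cut-A = trans (sym (∑-+ (λ x → deg x B) (λ x → deg x W) A)) (∑-≡ {n = 5} A (All.tabulate A-degree))

        cut-B : cut A B + cut B W ≡ length B * 5
        cut-B = trans (cong (_+ cut B W) (cut-sym A B))
          (trans (sym (∑-+ (λ x → deg x A) (λ x → deg x W) B)) (∑-≡ {n = 5} B (All.tabulate B-degree)))

      pair : ∀ {v u} (H : Hood v xs) → u ∈ far H → Pair v u
      pair {v} {u} H j with partitionᵇ (h u) (near H)
      ... | C , B , p , uC , uB = record
        { pieces = ↭-trans (splits H) (↭-prep v (++⁺ p (splits HU)))
        ; vC = All.++⁻ˡ C (All-resp-↭ p (adjacent H)) ; vB = All.++⁻ʳ C (All-resp-↭ p (adjacent H))
        ; vA = ⊑-All (near-⊑ HU) (apart H) ; vW = All.tail (⊑-All (far-⊑ HU) (apart H))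
        ; uC = uC ; uB = uB ; uA = adjacent HU ; uW = apart HU ; vu = All.lookup (apart H) j }
        where
        HU : Hood u (far H)
        HU = hood j

      module Triple {v u : V} (H : Hood v xs) (i : v ∈ xs) (j : u ∈ far H) (d : deg u (far H) ≡ 3) where

        open Pair (pair H j)

        HU : Hood u (far H)
        HU = hood j

        A-3 : length A ≡ 3
        A-3 = trans (sym (deg-near HU)) d

        W-12 : length W ≡ 12
        W-12 = far-length HU 3 (far-16 H i) d

        αW : α≤ 4 W
        αW = α-far HU (α-far H a)

        C-3 : length C ≡ 3
        C-3 = +-cancelʳ-≡ 3 _ 3 (trans (cong₂ _+_ (sym C-count) (sym d)) (far-degree H j))
          where
          C-count : deg u (near H) ≡ length C
          C-count = trans (deg-↭ u CB↭) (trans (∑-++ (𝟙 ∘ h u) C B)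
            (trans (cong₂ _+_ (count-true uC) (count-false uB)) (+-identityʳ _)))
            where
            CB↭ : near H ↭ C ++ B
            CB↭ = proj₁ (proj₂ (proj₂ (partitionᵇ (h u) (near H))))

        B-3 : length B ≡ 3
        B-3 = +-cancelˡ-≡ 3 _ 3 (trans (cong (_+ length B) (sym C-3)) (trans (sym (length-++ C))
          (trans (sym (↭-length (proj₁ (proj₂ (proj₂ (partitionᵇ (h u) (near H))))))) (near-6 H i))))

        vol-W : vol W + 2 * (3 + cut A W) ≡ 66
        vol-W = trans (cong (λ s → vol W + 2 * s) (trans (cong (_+ cut A W) (sym A-3)) (sym (∑-near HU))))
          (trans (sym (vol-split HU)) (vol-far H i))

        -- The degree sum 66 would leave at most 6 edges between `A` and `W`. Then 6 of the 12
        -- vertices of `W` have no neighbour in `A`, and by R(3,3) ≤ 6 a stable triple among them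
        -- extends `A` to a stable 6-set of non-neighbours of `v`.
        light : ¬ 48 ≤ vol W
        light big = contradiction (begin
          12 ≡⟨ sym W-12 ⟩
          length W ≤⟨ cover bound₂ A W (near-independent HU) (subst (λ n → α≤ (n + 2) (A ++ W)) (sym A-3)
                        (α-⊑ (rest-⊑ HU) (α-far H a))) ⟩
          5 + cut A W ≤⟨ +-monoʳ-≤ 5 cut≤6 ⟩
          11 ∎) (<⇒≱ ≤-refl)
          where
          open ≤-Reasoning
          cut≤6 : cut A W ≤ 6
          cut≤6 = *-cancelˡ-≤ 2 (+-cancelˡ-≤ (48 + 6) _ _ (begin
            (48 + 6) + 2 * cut A W ≡⟨ shuffle 48 (cut A W) ⟩
            48 + 2 * (3 + cut A W) ≤⟨ +-monoˡ-≤ (2 * (3 + cut A W)) big ⟩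
            vol W + 2 * (3 + cut A W) ≡⟨ vol-W ⟩
            (48 + 6) + 2 * 6 ∎))
            where
            shuffle : ∀ w c → (w + 6) + 2 * c ≡ w + 2 * (3 + c)
            shuffle = solve-∀

        -- At most three of the five neighbours lie in `ys`, and those in `W` form a stable set.
        row-between : ∀ {x ks} → W ↭ ks → ∀ ys → length ys ≡ 3 → deg x ys + deg x W ≡ 5 → between 2 4 (size (row ks x)) ≡ true
        row-between {x} {ks} p ys len3 five = subst (λ s → between 2 4 s ≡ true) (trans (deg-↭ x p) (sym (size-row x ks)))
          (between-true
            (+-cancelˡ-≤ 3 _ _ (≤-trans (≤-reflexive (sym five)) (+-monoˡ-≤ (deg x W) (≤-trans (deg-≤ x ys) (≤-reflexive len3)))))
            (deg-α′ x αW))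

        refuted : ∀ {ks} → W ↭ ks → pattern-of ks ∈ graphs12 → ⊥
        refuted {ks} p P∈ = conclude
          (glue-realised {5} {3} {between 2 4} (near-independent HU) (rest-α HU (α-far H a) p) A-3
            (All.tabulate λ k → row-between p B B-3 (A-degree k)))
          (glue-realised {5} {3} {between 2 4} B-independent αB B-3
            (All.tabulate λ k → row-between p A A-3 (B-degree k)))
          where
          P : Pattern
          P = pattern-of ks
          ks↭ : ks ↭ W
          ks↭ = ↭-sym p
          B-independent : Independent B
          B-independent = independent-⊑ (⊑-++ʳ C B) CB-independent
          αB : α≤ 5 (B ++ ks)
          αB = α-apart {x = u} {xs = xs} sub (All.++⁺ uB (All-resp-↭ p uW)) a
            where
            sub : u ∷ (B ++ ks) ⊑ xs
            sub = v ∷ C ++ A , ↭-trans pieces (rearrange ks↭)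
              where
              rearrange : ks ↭ W → v ∷ (C ++ B) ++ (u ∷ A ++ W) ↭ u ∷ (B ++ ks) ++ (v ∷ C ++ A)
              rearrange q = ↭-trans (++⁺ˡ (v ∷ C ++ B) (↭-prep u (++⁺ˡ A (↭-sym q))))
                (solve 6 (λ v C B u A W → (v ⊕ ((C ⊕ B) ⊕ (u ⊕ (A ⊕ W)))) ⊜ (u ⊕ ((B ⊕ W) ⊕ (v ⊕ (C ⊕ A)))))
                  ↭-refl (v ∷ []) C B (u ∷ []) A ks)
          conclude : (∃ λ A′ → A ↭ A′ × map (row ks) A′ ∈ glue 5 3 (between 2 4) P) →
                     (∃ λ B′ → B ↭ B′ × map (row ks) B′ ∈ glue 5 3 (between 2 4) P) → ⊥
          conclude (A′ , pA , rA) (B′ , pB , rB) = contradiction survive (λ e → case trans (sym e) fails of λ ())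
            where
            rows : List V → List Mask
            rows = map (row ks)
            cutA : cut A W ≡ ∑ size (rows A′)
            cutA = trans (cut-↭ʳ A p) (trans (∑-↭ (λ x → deg x ks) pA) (sym (∑-size-rows A′ ks)))
            cutB : cut B W ≡ ∑ size (rows B′)
            cutB = trans (cut-↭ʳ B p) (trans (∑-↭ (λ x → deg x ks) pB) (sym (∑-size-rows B′ ks)))
            -- Each of `A` and `B` sends 15 edges to `W` and to the other side, so the sum condition
            -- of `triples` passes from the rows of `A` to those of `B`.
            cutA≡cutB : cut A W ≡ cut B W
            cutA≡cutB = +-cancelˡ-≡ (cut A B) _ _ (trans cut-A (trans (cong (_* 5) (trans A-3 (sym B-3))) (sym cut-B)))
            thirty : edges P + cut A W ≡ 30
            thirty = *-cancelˡ-≡ _ _ 2 (+-cancelʳ-≡ 6 _ _ (begin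
              2 * (edges P + cut A W) + 6 ≡⟨ shuffle (edges P) (cut A W) ⟩
              2 * edges P + 2 * (3 + cut A W) ≡⟨ cong (_+ 2 * (3 + cut A W)) (sym (trans (vol-↭ p) (vol-edges ks))) ⟩
              vol W + 2 * (3 + cut A W) ≡⟨ vol-W ⟩
              2 * 30 + 6 ∎))
              where
              open ≡-Reasoning
              shuffle : ∀ e c → 2 * (e + c) + 6 ≡ 2 * e + 2 * (3 + c)
              shuffle = solve-∀
            triple : ∀ {rs} → rs ∈ glue 5 3 (between 2 4) P → cut A W ≡ ∑ size rs → rs ∈ triples P
            triple r e = filterᵇ-∈ (λ rs → edges P + ∑ size rs ≡ᵇ 30) r
              (≡⇒≡ᵇ-true {n = 30} (trans (cong (edges P +_) (sym e)) thirty))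
            fails : survives P (rows A′) (rows B′) ≡ false
            fails = not-true (all-sound (λ t → not (survives P (rows A′) t)) (triples P)
              (all-sound (λ s → all (λ t → not (survives P s t)) (triples P)) (triples P)
                (all-sound check23 graphs12 graphs12-check23 P∈) (triple rA cutA))
              (triple rB (trans cutA≡cutB cutB)))
              where
              not-true : ∀ {b} → not b ≡ true → b ≡ false
              not-true {false} _ = refl
            CA-α : α≤ 6 ((C ++ A′) ++ ks)
            CA-α = α-⊑ (v ∷ B ++ u ∷ [] , ↭-trans pieces (↭-trans (++⁺ˡ (v ∷ C ++ B) (↭-prep u (++⁺ pA p)))
              (solve 6 (λ v C B u A W → (v ⊕ ((C ⊕ B) ⊕ (u ⊕ (A ⊕ W)))) ⊜ (((C ⊕ A) ⊕ W) ⊕ (v ⊕ (B ⊕ u))))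
                ↭-refl (v ∷ []) C B (u ∷ []) A′ ks))) a
            CB-α : α≤ 6 ((C ++ B′) ++ ks)
            CB-α = α-⊑ (v ∷ A ++ u ∷ [] , ↭-trans pieces (↭-trans (++⁺ (↭-prep v (++⁺ˡ C pB)) (↭-prep u (++⁺ˡ A p)))
              (solve 6 (λ v C B u A W → (v ⊕ ((C ⊕ B) ⊕ (u ⊕ (A ⊕ W)))) ⊜ (((C ⊕ B) ⊕ W) ⊕ (v ⊕ (A ⊕ u))))
                ↭-refl (v ∷ []) C B′ (u ∷ []) A ks))) a
            survive : survives P (rows A′) (rows B′) ≡ true
            survive = survives-complete {ks} {A′} {B′} {C}
              (All.tabulate λ {x} k → trans (cong₂ _+_ (sym (deg-↭ x pB)) (sym (deg-↭ x p))) (A-degree (∈-resp-↭ (↭-sym pA) k)))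
              (All.tabulate λ {w} k → trans (cong (deg w C +_) (cong₂ _+_ (sym (deg-↭ w pA))
                (cong₂ _+_ (sym (deg-↭ w pB)) (sym (deg-↭ w p))))) (W-degree (∈-resp-↭ ks↭ k)))
              (All.tabulate λ {c} k → trans (sym (deg-↭ c p)) (C-degree k)) C-3
              (independent-↭ (++⁺ˡ C pA) CA-independent) CA-α
              (independent-↭ (++⁺ˡ C pB) CB-independent) CB-α

      far-degree≢3 : ∀ {v u} (H : Hood v xs) → v ∈ xs → u ∈ far H → deg u (far H) ≢ 3
      far-degree≢3 {v} {u} H i j d = cases (twelve W-12 αW)
        where
        open Triple H i j d
        open Pair (pair H j) using (W)
        cases : Any (Realises W) graphs12 ⊎ 48 ≤ vol W → ⊥
        cases (inj₂ big) = light big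
        cases (inj₁ r) = let ks , p , P∈ = realised graphs12 r in refuted p P∈

      far-degree≥4 : ∀ {v u} (H : Hood v xs) → v ∈ xs → u ∈ far H → 4 ≤ deg u (far H)
      far-degree≥4 H i j = ≤∧≢⇒< (far-degree≥3 H i j) (far-degree≢3 H i j ∘ sym)

      near-degree≤2 : ∀ {v u} (H : Hood v xs) → v ∈ xs → u ∈ far H → deg u (near H) ≤ 2
      near-degree≤2 {v} {u} H i j = +-cancelʳ-≤ 4 _ _
        (≤-trans (+-monoʳ-≤ (deg u (near H)) (far-degree≥4 H i j)) (≤-reflexive (far-degree H j)))

      near-degree≥1 : ∀ {v u} (H : Hood v xs) → v ∈ xs → u ∈ far H → 1 ≤ deg u (near H)
      near-degree≥1 {v} {u} H i j = +-cancelʳ-≤ 5 _ _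
        (≤-trans (≤-reflexive (sym (far-degree H j))) (+-monoʳ-≤ (deg u (near H)) (far-degree≤ H j)))

      common≤2 : ∀ {x y zs} → xs ↭ x ∷ y ∷ zs → h x y ≡ false → ∀ ts → ts ⊑ zs →
        All (λ t → h x t ≡ true) ts → All (λ t → h y t ≡ true) ts → length ts ≤ 2
      common≤2 {x} {y} {zs} p e ts (us , q) tx ty = bounded (partitionᵇ (h x) zs)
        where
        bounded : (∃₂ λ N F → zs ↭ N ++ F × All (λ t → h x t ≡ true) N × All (λ t → h x t ≡ false) F) → length ts ≤ 2
        bounded (N , F , r , t , f) = begin
          length ts ≡⟨ sym (trans (∑-≡ {n = 1} ts (All.zipWith (λ (s , t) → cong₂ (λ b c → 𝟙 b * 𝟙 c) s t) (tx , ty))) (*-identityʳ _)) ⟩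
          ∑ g ts ≤⟨ m≤m+n (∑ g ts) (∑ g us) ⟩
          ∑ g ts + ∑ g us ≡⟨ sym (∑-++ g ts us) ⟩
          ∑ g (ts ++ us) ≡⟨ trans (∑-↭ g (↭-sym q)) (trans (∑-↭ g r) (∑-++ g N F)) ⟩
          ∑ g N + ∑ g F ≡⟨ cong₂ _+_
            (∑-cong N (All.map (λ {w} s → trans (cong (λ b → 𝟙 b * 𝟙 (h y w)) s) (+-identityʳ _)) t))
            (trans (∑-≡ {n = 0} F (All.map (λ {w} s → cong (λ b → 𝟙 b * 𝟙 (h y w)) s) f)) (*-zeroʳ (length F))) ⟩
          deg y N + 0 ≡⟨ +-identityʳ _ ⟩
          deg y N ≤⟨ near-degree≤2 Hx (∈-resp-↭ (↭-sym p) (here refl)) (here refl) ⟩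
          2 ∎
          where
          open ≤-Reasoning
          g : V → ℕ
          g w = 𝟙 (h x w) * 𝟙 (h y w)
          Hx : Hood x xs
          Hx = record { near = N ; far = y ∷ F
            ; splits = ↭-trans p (↭-prep x (↭-trans (↭-prep y r) (↭-sym (shift y N F))))
            ; adjacent = t ; apart = e ∷ f }

      -- Here non-adjacent vertices have at most two common neighbours, v and p have exactly
      -- one, and the edges between N(p) and N(v) are counted in two ways.
      module Sparse {v p : V} (H : Hood v xs) (i : v ∈ xs) (j : p ∈ far H) (d : deg p (far H) ≡ 5) where

        open Pair (pair H j)

        HP : Hood p (far H)
        HP = hood j

        Hv : Hood v xs
        Hv = record { splits = pieces ; adjacent = All.++⁺ vC vB ; apart = vu ∷ All.++⁺ vA vW }

        Hp : Hood p xs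
        Hp = record { near = C ++ A ; far = v ∷ B ++ W
          ; splits = ↭-trans pieces (solve 6 (λ v C B u A W → (v ⊕ ((C ⊕ B) ⊕ (u ⊕ (A ⊕ W)))) ⊜ (u ⊕ ((C ⊕ A) ⊕ (v ⊕ (B ⊕ W)))))
              ↭-refl (v ∷ []) C B (p ∷ []) A W)
          ; adjacent = All.++⁺ uC uA ; apart = trans (h-sym p v) vu ∷ All.++⁺ uB uW }

        p∈ : p ∈ xs
        p∈ = far-∈ H j

        A-5 : length A ≡ 5
        A-5 = trans (sym (deg-near HP)) d

        W-10 : length W ≡ 10
        W-10 = far-length HP 5 (far-16 H i) d

        C-1 : length C ≡ 1
        C-1 = +-cancelʳ-≡ 5 _ 1 (trans (cong (length C +_) (sym A-5)) (trans (sym (length-++ C)) (near-6 Hp p∈)))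

        B-5 : length B ≡ 5
        B-5 = +-cancelˡ-≡ 1 _ 5 (trans (cong (_+ length B) (sym C-1)) (trans (sym (length-++ C)) (near-6 Hv i)))

        -- As `b` has no neighbour in `C`, this counts the common neighbours of the non-adjacent
        -- vertices `b` and `p`, and lies between 1 and 2.
        dB : V → ℕ
        dB b = deg b A

        B-near : ∀ {b} → b ∈ B → deg b (C ++ A) ≡ dB b
        B-near {b} k = trans (∑-++ (𝟙 ∘ h b) C A) (cong (_+ dB b) (m+n≡0⇒m≡0 (deg b C)
          (trans (sym (∑-++ (𝟙 ∘ h b) C B)) (All.lookup (independent-deg CB-independent) (∈-++⁺ʳ C k)))))

        dB≤2 : ∀ {b} → b ∈ B → dB b ≤ 2
        dB≤2 k = subst (_≤ 2) (B-near k) (near-degree≤2 Hp p∈ (there (∈-++⁺ˡ k)))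

        dB≥1 : ∀ {b} → b ∈ B → 1 ≤ dB b
        dB≥1 k = subst (1 ≤_) (B-near k) (near-degree≥1 Hp p∈ (there (∈-++⁺ˡ k)))

        W-CA : ∀ {z} → z ∈ W → deg z C + deg z A ≤ 2
        W-CA {z} k = subst (_≤ 2) (∑-++ (𝟙 ∘ h z) C A) (near-degree≤2 Hp p∈ (there (∈-++⁺ʳ B k)))

        W-CB : ∀ {z} → z ∈ W → deg z C + deg z B ≤ 2
        W-CB {z} k = subst (_≤ 2) (∑-++ (𝟙 ∘ h z) C B) (near-degree≤2 Hv i (there (∈-++⁺ʳ A k)))

        both : V → V → V → ℕ
        both z x b = 𝟙 (h z b ∧ h x b)

        -- Two vertices of `B` adjacent to both `x` and `z` would be non-adjacent with three common
        -- neighbours `v`, `z` and `x`.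
        joint≤1 : ∀ {x z} → x ∈ A → z ∈ W → ∑ (both z x) B ≤ 1
        joint≤1 {x} {z} k l = bounded (partitionᵇ (λ b → h z b ∧ h x b) B) (extract k) (extract l)
          where
          bounded : (∃₂ λ T F → B ↭ T ++ F × All (λ b → h z b ∧ h x b ≡ true) T × All (λ b → h z b ∧ h x b ≡ false) F) →
            (∃ λ A₀ → A ↭ x ∷ A₀) → (∃ λ W₀ → W ↭ z ∷ W₀) → ∑ (both z x) B ≤ 1
          bounded (T , F , q , t , f) (A₀ , pA) (W₀ , pW) = ≤-trans (≤-reflexive (trans (∑-↭ (both z x) q)
            (trans (∑-++ (both z x) T F) (trans (cong₂ _+_ (count-true t) (count-false f)) (+-identityʳ _))))) (short T q t)
            where
            short : ∀ T → B ↭ T ++ F → All (λ b → h z b ∧ h x b ≡ true) T → length T ≤ 1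
            short [] _ _ = z≤n
            short (_ ∷ []) _ _ = s≤s z≤n
            short (b ∷ b′ ∷ T) q (e ∷ e′ ∷ _) = contradiction
              (common≤2 {b} {b′} positions apart′ (v ∷ z ∷ x ∷ []) (⊑-++ˡ (v ∷ z ∷ x ∷ []) _)
                (adj b (here refl) e) (adj b′ (there (here refl)) e′)) (<⇒≱ ≤-refl)
              where
              positions : xs ↭ b ∷ b′ ∷ (v ∷ z ∷ x ∷ []) ++ (C ++ T ++ F ++ p ∷ A₀ ++ W₀)
              positions = ↭-trans pieces (↭-trans (↭-prep v (++⁺ (++⁺ˡ C q) (↭-prep p (++⁺ pA pW))))
                (solve 11 (λ v C b b′ T F p x A₀ z W₀ →
                    (v ⊕ ((C ⊕ ((b ⊕ (b′ ⊕ T)) ⊕ F)) ⊕ (p ⊕ ((x ⊕ A₀) ⊕ (z ⊕ W₀))))) ⊜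
                    (b ⊕ (b′ ⊕ ((v ⊕ (z ⊕ x)) ⊕ (C ⊕ (T ⊕ (F ⊕ (p ⊕ (A₀ ⊕ W₀)))))))))
                  ↭-refl (v ∷ []) C (b ∷ []) (b′ ∷ []) T F (p ∷ []) (x ∷ []) A₀ (z ∷ []) W₀))
              apart′ : h b b′ ≡ false
              apart′ = All.head (AllPairs.head (independent-↭ q (independent-⊑ (⊑-++ʳ C B) CB-independent)))
              adj : ∀ c → c ∈ b ∷ b′ ∷ T ++ F → h z c ∧ h x c ≡ true → All (λ t → h c t ≡ true) (v ∷ z ∷ x ∷ [])
              adj c m e = trans (h-sym c v) (All.lookup vB (∈-resp-↭ (↭-sym q) m)) ∷
                trans (h-sym c z) (proj₁ (∧-true {h z c} e)) ∷ trans (h-sym c x) (proj₂ (∧-true {h z c} e)) ∷ []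

        joint-or-adjacent : ∀ {x z} → x ∈ A → z ∈ W → ∑ (both z x) B + 𝟙 (h z x) ≤ 1
        joint-or-adjacent {x} {z} k l with h z x in e
        ... | false = ≤-trans (≤-reflexive (+-identityʳ _)) (joint≤1 k l)
        ... | true = ≤-reflexive (cong (_+ 1) (trans (∑-≡ {n = 0} B (All.tabulate λ {b} _ → never b)) (*-zeroʳ (length B))))
          where
          never : ∀ b → 𝟙 (h z b ∧ h x b) ≡ 0
          never b with h z b in e₁ | h x b in e₂
          ... | true | true = ⊥-elim (triangle-free z x b e e₂ e₁)
          ... | true | false = refl
          ... | false | _ = refl

        -- slack z is positive only if some neighbour of z in B has a single neighbour in A.
        slack : V → ℕ
        slack z = ∑ (λ b → 𝟙 (h z b) * (2 ∸ dB b)) B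

        -- Summed over `x` in `A`, the joint neighbours of `z` and `x` in `B` number the sum of
        -- `dB b` over the neighbours `b` of `z`, that is `2 * deg z B` less `slack z`. Each of the
        -- five `x` contributes at most one, either as a joint neighbour or by being adjacent to
        -- `z`.
        W-AB : ∀ {z} → z ∈ W → 2 * deg z B + deg z A ≤ 5 + slack z
        W-AB {z} l = begin
          2 * deg z B + deg z A ≡⟨ cong (_+ deg z A) (sym twice) ⟩
          (∑ (λ x → ∑ (both z x) B) A + slack z) + deg z A ≡⟨ shuffle _ (slack z) (deg z A) ⟩
          (∑ (λ x → ∑ (both z x) B) A + deg z A) + slack z ≡⟨ cong (_+ slack z) (sym (∑-+ (λ x → ∑ (both z x) B) (λ x → 𝟙 (h z x)) A)) ⟩
          ∑ (λ x → ∑ (both z x) B + 𝟙 (h z x)) A + slack z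
            ≤⟨ +-monoˡ-≤ (slack z) (≤-trans (∑-≤ {n = 1} A (All.tabulate λ k → joint-or-adjacent k l)) (≤-reflexive (scaled 5 1 A-5))) ⟩
          5 + slack z ∎
          where
          open ≤-Reasoning
          shuffle : ∀ a b c → (a + b) + c ≡ (a + c) + b
          shuffle = solve-∀
          factor : ∀ s b → ∑ (λ x → 𝟙 (s ∧ h x b)) A ≡ 𝟙 s * dB b
          factor false b = trans (∑-const 0 A) (*-zeroʳ (length A))
          factor true b = trans (∑-cong A (All.tabulate λ {x} _ → cong 𝟙 (h-sym x b))) (sym (+-identityʳ _))
          complete : ∀ {b} → b ∈ B → ∑ (λ x → both z x b) A + 𝟙 (h z b) * (2 ∸ dB b) ≡ 2 * 𝟙 (h z b)
          complete {b} k = trans (cong (_+ 𝟙 (h z b) * (2 ∸ dB b)) (factor (h z b) b))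
            (trans (sym (*-distribˡ-+ (𝟙 (h z b)) (dB b) (2 ∸ dB b)))
              (trans (cong (𝟙 (h z b) *_) (m+[n∸m]≡n (dB≤2 k))) (*-comm (𝟙 (h z b)) 2)))
          twice : ∑ (λ x → ∑ (both z x) B) A + slack z ≡ 2 * deg z B
          twice = trans (cong (_+ slack z) (∑-swap (both z) A B))
            (trans (sym (∑-+ (λ b → ∑ (λ x → both z x b) A) (λ b → 𝟙 (h z b) * (2 ∸ dB b)) B))
              (trans (∑-cong B (All.tabulate complete)) (∑-*ˡ 2 (𝟙 ∘ h z) B)))

        -- If `deg z B` is at most 1, `W-CA` suffices. If it is 2, then `W-CB` forbids neighbours in
        -- `C` and `W-AB` bounds those in `A`.
        W-total : ∀ {z} → z ∈ W → deg z C + (deg z A + deg z B) ≤ 3 + slack z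
        W-total {z} l = combine (deg z C) (deg z A) (deg z B) (slack z) (W-CA l) (W-CB l) (W-AB l)
          where
          combine : ∀ c a b s → c + a ≤ 2 → c + b ≤ 2 → 2 * b + a ≤ 5 + s → c + (a + b) ≤ 3 + s
          combine c a zero s p _ _ = ≤-trans (≤-reflexive (cong (c +_) (+-identityʳ a)))
            (≤-trans p (m≤n⇒m≤n+o s (s≤s (s≤s z≤n))))
          combine c a 1 s p _ _ = ≤-trans (≤-reflexive (trans (sym (+-assoc c a 1)) (+-comm (c + a) 1)))
            (≤-trans (s≤s p) (m≤m+n 3 s))
          combine zero a 2 s _ _ q = ≤-trans (≤-reflexive (+-comm a 2)) (≤-pred (≤-pred q))
          combine (suc c) a 2 s _ q _ = contradiction q (<⇒≱ (s≤s (m≤n+m 2 c)))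
          combine c a (suc (suc (suc b))) s _ q _ = contradiction (≤-trans (m≤n+m (3 + b) c) q) (<⇒≱ (s≤s (s≤s (s≤s z≤n))))

        Q S X Y : ℕ
        Q = ∑ (λ b → 2 ∸ dB b) B
        S = cut A B
        X = cut A W
        Y = cut B W

        Q+S : Q + S ≡ 10
        Q+S = trans (cong (Q +_) (cut-sym A B)) (trans (sym (∑-+ (λ b → 2 ∸ dB b) dB B))
          (trans (∑-≡ {n = 2} B (All.tabulate λ k → m∸n+n≡m (dB≤2 k))) (scaled 5 2 B-5)))

        -- The degree sum 66 of `far H` consists of 5 at `p`, `5 + X` on `A`, and at least 10 · 4 on
        -- `W`.
        X≤16 : X ≤ 16
        X≤16 = +-cancelˡ-≤ 50 _ _ (begin
          50 + X ≡⟨ shuffle X ⟩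
          5 + ((5 + X) + 40) ≤⟨ +-monoʳ-≤ 5 (+-mono-≤ (≤-reflexive (trans (cong (_+ X) (sym A-5)) (sym (∑-near HP))))
              (≤-trans (≤-reflexive (sym (scaled 10 4 W-10)))
                (∑-≥ {n = 4} W (All.tabulate λ k → far-degree≥4 H i (∈-resp-↭ (↭-sym (splits HP)) (there (∈-++⁺ʳ A k))))))) ⟩
          5 + (∑ (λ w → deg w (far H)) A + ∑ (λ w → deg w (far H)) W)
            ≡⟨ cong₂ _+_ (sym d) (sym (∑-++ (λ w → deg w (far H)) A W)) ⟩
          deg p (far H) + ∑ (λ w → deg w (far H)) (A ++ W) ≡⟨ sym (∑-↭ (λ w → deg w (far H)) (splits HP)) ⟩
          vol (far H) ≡⟨ vol-far H i ⟩
          50 + 16 ∎)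
          where
          open ≤-Reasoning
          shuffle : ∀ x → 50 + x ≡ 5 + ((5 + x) + 40)
          shuffle = solve-∀

        -- A vertex of `B` has five neighbours in `A` and `W` together, at least one of them in `A`,
        -- hence at most 4 in `W`.
        total-slack : ∑ slack W ≤ 4 * Q
        total-slack = begin
          ∑ slack W ≡⟨ ∑-swap (λ z b → 𝟙 (h z b) * (2 ∸ dB b)) W B ⟩
          ∑ (λ b → ∑ (λ z → 𝟙 (h z b) * (2 ∸ dB b)) W) B ≤⟨ ∑-mono B (All.tabulate each) ⟩
          ∑ (λ b → 4 * (2 ∸ dB b)) B ≡⟨ ∑-*ˡ 4 (λ b → 2 ∸ dB b) B ⟩
          4 * Q ∎
          where
          open ≤-Reasoning
          each : ∀ {b} → b ∈ B → ∑ (λ z → 𝟙 (h z b) * (2 ∸ dB b)) W ≤ 4 * (2 ∸ dB b)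
          each {b} k = begin
            ∑ (λ z → 𝟙 (h z b) * (2 ∸ dB b)) W
              ≡⟨ ∑-cong W (All.tabulate λ {z} _ → trans (*-comm (𝟙 (h z b)) _) (cong (λ s → (2 ∸ dB b) * 𝟙 s) (h-sym z b))) ⟩
            ∑ (λ z → (2 ∸ dB b) * 𝟙 (h b z)) W ≡⟨ ∑-*ˡ (2 ∸ dB b) (𝟙 ∘ h b) W ⟩
            (2 ∸ dB b) * deg b W ≤⟨ *-monoʳ-≤ (2 ∸ dB b) (≤-pred (≤-trans (+-monoˡ-≤ (deg b W) (dB≥1 k)) (≤-reflexive (B-degree k)))) ⟩
            (2 ∸ dB b) * 4 ≡⟨ *-comm (2 ∸ dB b) 4 ⟩
            4 * (2 ∸ dB b) ∎

        -- The left side counts the edges leaving `W`; the single vertex of `C` sends four edges to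
        -- `W`.
        counted : 4 + (X + Y) ≤ 30 + 4 * Q
        counted = begin
          4 + (X + Y) ≡⟨ cong₂ _+_ (sym C-total) (cong₂ _+_ (cut-sym A W) (cut-sym B W)) ⟩
          cut W C + (cut W A + cut W B)
            ≡⟨ sym (trans (∑-+ (λ z → deg z C) (λ z → deg z A + deg z B) W)
                 (cong (cut W C +_) (∑-+ (λ z → deg z A) (λ z → deg z B) W))) ⟩
          ∑ (λ z → deg z C + (deg z A + deg z B)) W ≤⟨ ∑-mono W (All.tabulate W-total) ⟩
          ∑ (λ z → 3 + slack z) W ≡⟨ trans (∑-+ (λ _ → 3) slack W) (cong (_+ ∑ slack W) (trans (∑-const 3 W) (scaled 10 3 W-10))) ⟩
          30 + ∑ slack W ≤⟨ +-monoʳ-≤ 30 total-slack ⟩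
          30 + 4 * Q ∎
          where
          open ≤-Reasoning
          C-total : cut W C ≡ 4
          C-total = trans (cut-sym W C) (trans (∑-≡ {n = 4} C (All.tabulate C-degree)) (scaled 1 4 C-1))

        -- `S + X = S + Y = 25` and `X ≤ 16` give `S ≥ 9`, while `counted` and `Q + S = 10` give
        -- `S ≤ 8`.
        impossible : ⊥
        impossible = contradiction (begin
          54 + (50 + 18) ≤⟨ +-monoʳ-≤ 54 (+-monoʳ-≤ 50 18≤2S) ⟩
          54 + (50 + 2 * S) ≡⟨ cong (λ n → 54 + (n + 2 * S)) (sym (cong₂ _+_ (trans cut-A (scaled 5 5 A-5)) (trans cut-B (scaled 5 5 B-5)))) ⟩
          54 + (((S + X) + (S + Y)) + 2 * S) ≡⟨ shuffle S X Y ⟩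
          50 + ((4 + (X + Y)) + 4 * S) ≤⟨ +-monoʳ-≤ 50 (+-monoˡ-≤ (4 * S) counted) ⟩
          50 + ((30 + 4 * Q) + 4 * S) ≡⟨ regroup Q S ⟩
          80 + 4 * (Q + S) ≡⟨ cong (λ n → 80 + 4 * n) Q+S ⟩
          120 ∎) (<⇒≱ (m≤n+m 121 1))
          where
          open ≤-Reasoning
          shuffle : ∀ s x y → 54 + (((s + x) + (s + y)) + 2 * s) ≡ 50 + ((4 + (x + y)) + 4 * s)
          shuffle = solve-∀
          regroup : ∀ q s → 50 + ((30 + 4 * q) + 4 * s) ≡ 80 + 4 * (q + s)
          regroup = solve-∀
          18≤2S : 18 ≤ 2 * S
          18≤2S = *-monoʳ-≤ 2 {9} (+-cancelʳ-≤ 16 9 S (≤-trans (≤-reflexive (sym (trans cut-A (scaled 5 5 A-5)))) (+-monoʳ-≤ S X≤16)))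

      -- The vertex `p` of `Sparse` exists because 16 vertices of degree at most 4 reach only 64,
      -- short of 66.
      impossible : ⊥
      impossible = start xs refl
        where
        start : ∀ ys → xs ≡ ys → ⊥
        start [] e = case trans (sym len) (cong length e) of λ ()
        start (v ∷ ys) e = choose (locate (λ w → deg w (far H) ≡ᵇ 5) (far H))
          where
          i : v ∈ xs
          i = subst (v ∈_) (sym e) (here refl)
          H : Hood v xs
          H = hood i
          choose : All (λ w → (deg w (far H) ≡ᵇ 5) ≡ false) (far H) ⊎ (∃ λ w → w ∈ far H × (deg w (far H) ≡ᵇ 5) ≡ true) → ⊥
          choose (inj₂ (p , j , e)) = Sparse.impossible H i j (≡ᵇ-true {deg p (far H)} {5} e)
          choose (inj₁ none) = contradiction (≤-trans (≤-reflexive (sym (vol-far H i)))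
            (≤-trans (∑-≤ {n = 4} (far H) (All.zipWith (λ {w} (e , j) → ≤-pred (≤∧≢⇒< (far-degree≤ H j) (≢ᵇ-false {deg w (far H)} {5} e)))
              (none , members (far H)))) (≤-reflexive (scaled 16 4 (far-16 H i))))) (<⇒≱ (m≤n+m 65 1))

    bound₆ : Bound 6 22
    bound₆ = bound-by λ xs len a → Regular.impossible len a (Irregular.regular len a)

    -- The sharp bounds 2, 5, 8, 13, 17, 22, weakened to the common linear form 4j - 2 on which the
    -- colouring argument runs.
    ramsey : ∀ {k xs} → suc k ≤ 6 → α≤ (suc k) xs → length xs + 2 ≤ 4 * suc k
    ramsey {0} {xs} _ a = +-monoˡ-≤ 2 (bound₁ xs a)
    ramsey {1} {xs} _ a = ≤-trans (+-monoˡ-≤ 2 (bound₂ xs a)) (m≤n+m 7 1)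
    ramsey {2} {xs} _ a = ≤-trans (+-monoˡ-≤ 2 (bound₃ xs a)) (m≤n+m 10 2)
    ramsey {3} {xs} _ a = ≤-trans (+-monoˡ-≤ 2 (bound₄ xs a)) (m≤n+m 15 1)
    ramsey {4} {xs} _ a = ≤-trans (+-monoˡ-≤ 2 (bound₅ xs a)) (m≤n+m 19 1)
    ramsey {5} {xs} _ a = +-monoˡ-≤ 2 (bound₆ xs a)
    ramsey {suc (suc (suc (suc (suc (suc k)))))} (s≤s (s≤s (s≤s (s≤s (s≤s (s≤s ())))))) _

-- Colourings from maximum matchings of the complement.

module Colouring where

  open import Data.Bool using (Bool; true; false; not; _∧_)
  open import Data.Empty using (⊥; ⊥-elim)
  open import Data.Nat using (ℕ; zero; suc; _+_; _*_; _≤_; _<_; z≤n; s≤s; _≤?_)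
  open import Data.Nat.Properties
  open import Data.List using (List; []; _∷_; _++_; map; length; allFin; lookup; tabulate; concat)
  open import Data.List.Properties
    using (length-++; length-map; map-++; tabulate-lookup; map-tabulate; length-tabulate)
  open import Data.List.Relation.Unary.All as All using (All; []; _∷_)
  import Data.List.Relation.Unary.All.Properties as All
  open import Data.List.Relation.Unary.AllPairs as AllPairs using (AllPairs; []; _∷_)
  import Data.List.Relation.Unary.AllPairs.Properties as AllPairs
  open import Data.List.Relation.Unary.Any using (here; there)
  open import Data.List.Membership.Propositional using (_∈_)
  open import Data.List.Membership.Propositional.Properties using (∈-++⁺ˡ; ∈-++⁺ʳ; ∈-++⁻; ∈-allFin)
  open import Data.List.Relation.Binary.Permutation.Propositional
    using (_↭_; ↭-refl; ↭-sym; ↭-trans; ↭-reflexive; ↭-prep; ↭-swap)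
  open import Data.List.Relation.Binary.Permutation.Propositional.Properties
    using (↭-length; ∈-resp-↭; shift; ++⁺; ++⁺ˡ; ++⁺ʳ; ++-comm; map⁺; drop-∷;
      ++-commutativeMonoid)
  open import Data.Product using (_×_; _,_; proj₁; proj₂; ∃; ∃₂)
  open import Data.Sum using (_⊎_; inj₁; inj₂)
  open import Relation.Nullary using (¬_; contradiction; yes; no; Dec)
  open import Relation.Binary.PropositionalEquality
    using (_≡_; _≢_; refl; sym; trans; cong; cong₂; subst)
  open import Data.Nat.Tactic.RingSolver using (solve-∀)
  open import Data.Fin as Fin using (Fin)
  import Data.Fin.Properties as Fin
  open import Data.List.Relation.Unary.Unique.Propositional using (Unique)
  open import Data.List.Relation.Unary.Unique.Propositional.Properties using (allFin⁺)
  open import Relation.Nullary.Decidable using (⌊_⌋)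
  open Search
  open Lists
  open Soundness
  open Ramsey

  module Graphs {V : Set} (g : V → V → Bool) (g-sym : ∀ x y → g x y ≡ g y x) where

    Apart : V → V → Set
    Apart x y = g x y ≡ false

    Clique : List V → Set
    Clique = AllPairs (λ x y → g x y ≡ true)

    NoTriple : List V → Set
    NoTriple xs = ∀ {x y z} → x ∷ y ∷ z ∷ [] ⊑ xs → Apart x y → Apart y z → Apart x z → ⊥

    noTriple-⊑ : ∀ {xs ys} → xs ⊑ ys → NoTriple ys → NoTriple xs
    noTriple-⊑ s t u = t (⊑-trans u s)

    module Positions (xs : List V) (noTriple : NoTriple xs) where

      n : ℕ
      n = length xs

      at : Fin n → V
      at = lookup xs

      -- The complement lives on positions in the list: their equality is decidable, so that no
      -- vertex is joined to itself.
      h : Fin n → Fin n → Bool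
      h i j = not ⌊ i Fin.≟ j ⌋ ∧ not (g (at i) (at j))

      h-true : ∀ {i j} → h i j ≡ true → i ≢ j × Apart (at i) (at j)
      h-true {i} {j} e with i Fin.≟ j | g (at i) (at j)
      ... | no i≢j | false = i≢j , refl

      h-false : ∀ {i j} → h i j ≡ false → i ≢ j → g (at i) (at j) ≡ true
      h-false {i} {j} e i≢j with i Fin.≟ j | g (at i) (at j)
      ... | yes i≡j | _ = contradiction i≡j i≢j
      ... | no _ | true = refl

      h-sym : ∀ i j → h i j ≡ h j i
      h-sym i j with i Fin.≟ j | j Fin.≟ i
      ... | yes _ | yes _ = refl
      ... | yes e | no ne = contradiction (sym e) ne
      ... | no ne | yes e = contradiction (sym e) ne
      ... | no _ | no _ = cong not (g-sym (at i) (at j))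

      h-irrefl : ∀ i → h i i ≡ false
      h-irrefl i with i Fin.≟ i
      ... | yes _ = refl
      ... | no ne = contradiction refl ne

      other : ∀ {i j : Fin n} {is ys} → ys ↭ i ∷ is → j ∈ ys → i ≢ j → j ∈ is
      other p j∈ i≢j with ∈-resp-↭ p j∈
      ... | here refl = contradiction refl i≢j
      ... | there k = k

      at-allFin : map at (allFin n) ≡ xs
      at-allFin = trans (map-tabulate (λ i → i) at) (tabulate-lookup xs)

      at-⊑ : ∀ {is} → is ⊑ allFin n → map at is ⊑ xs
      at-⊑ {is} (js , p) = map at js ,
        ↭-trans (↭-reflexive (sym at-allFin)) (↭-trans (map⁺ at p) (↭-reflexive (map-++ at is js)))

      triangle-free : ∀ i j k → h i j ≡ true → h j k ≡ true → h i k ≡ true → ⊥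
      triangle-free i j k p q r with extract (∈-allFin i)
      ... | is , e₁ with extract (other e₁ (∈-allFin j) (proj₁ (h-true p)))
      ... | js , e₂ with extract (other e₂ (other e₁ (∈-allFin k) (proj₁ (h-true r))) (proj₁ (h-true q)))
      ... | ks , e₃ = noTriple (at-⊑ (ks , ↭-trans e₁ (↭-prep i (↭-trans e₂ (↭-prep j e₃)))))
        (proj₂ (h-true {i} {j} p)) (proj₂ (h-true {j} {k} q)) (proj₂ (h-true {i} {k} r))

      open TriangleFree h h-sym h-irrefl triangle-free using (α≤; Independent; ramsey)

      clique-of : ∀ {is} → is ⊑ allFin n → Independent is → Clique (map at is)
      clique-of {is} (js , p) ind = AllPairs.map⁺ (AllPairs.zipWith (λ (e , ne) → h-false e ne) (ind , unique))
        where
        open import Data.List.Relation.Binary.Permutation.Propositional using (↭⇒↭ₛ)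
        import Data.List.Relation.Binary.Permutation.Setoid.Properties as Permutation
        open import Relation.Binary.PropositionalEquality using (setoid)
        prefix : ∀ (xs : List (Fin n)) {zs} → Unique (xs ++ zs) → Unique xs
        prefix [] _ = []
        prefix (x ∷ xs) (e ∷ es) = All.++⁻ˡ xs e ∷ prefix xs es
        unique : Unique is
        unique = prefix is (Permutation.Unique-resp-↭ (setoid (Fin n)) (↭⇒↭ₛ p) (allFin⁺ n))

      few : ∀ {k} → suc k ≤ 6 → (∀ {as} → as ⊑ xs → Clique as → length as ≤ suc k) → length xs + 2 ≤ 4 * suc k
      few {k} k≤ cliques = subst (λ m → m + 2 ≤ 4 * suc k) (length-tabulate (λ i → i))
        (ramsey {k} {allFin n} k≤ λ {is} s ind → subst (_≤ suc k) (length-map at is) (cliques (at-⊑ s) (clique-of s ind)))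

    flat : List (V × V) → List V
    flat [] = []
    flat ((x , y) ∷ ps) = x ∷ y ∷ flat ps

    record Matching (xs : List V) (m : ℕ) (L : List V) : Set where
      constructor matching
      field
        pairs : List (V × V)
        size≡ : length pairs ≡ m
        apart : All (λ (x , y) → Apart x y) pairs
        covers : xs ↭ flat pairs ++ L

    matching-↭ : ∀ {xs ys m L} → ys ↭ xs → Matching xs m L → Matching ys m L
    matching-↭ p (matching ps s a c) = matching ps s a (↭-trans p c)

    leftover-↭ : ∀ {xs m K L} → K ↭ L → Matching xs m K → Matching xs m L
    leftover-↭ p (matching ps s a c) = matching ps s a (↭-trans c (++⁺ˡ (flat ps) p))

    join : ∀ {xs m x y L} → Apart x y → Matching xs m (x ∷ y ∷ L) → Matching xs (suc m) L
    join {x = x} {y} {L} e (matching ps s a c) = matching ((x , y) ∷ ps) (cong suc s) (e ∷ a)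
      (↭-trans c (↭-trans (shift x (flat ps) (y ∷ L)) (↭-prep x (shift y (flat ps) L))))

    unjoin : ∀ {xs m x y L} → Apart x y → Matching xs m L → Matching (x ∷ y ∷ xs) (suc m) L
    unjoin {x = x} {y} e (matching ps s a c) = matching ((x , y) ∷ ps) (cong suc s) (e ∷ a) (↭-prep x (↭-prep y c))

    keep : ∀ {xs m x L} → Matching xs m L → Matching (x ∷ xs) m (x ∷ L)
    keep {x = x} {L} (matching ps s a c) = matching ps s a (↭-trans (↭-prep x c) (↭-sym (shift x (flat ps) L)))

    mate : ∀ {w} ps → w ∈ flat ps → All (λ (x , y) → Apart x y) ps →
      ∃₂ λ x qs → Apart w x × suc (length qs) ≡ length ps × All (λ (x , y) → Apart x y) qs × flat ps ↭ w ∷ x ∷ flat qs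
    mate ((x , y) ∷ ps) (here refl) (e ∷ es) = y , ps , e , refl , es , ↭-refl
    mate ((x , y) ∷ ps) (there (here refl)) (e ∷ es) = x , ps , trans (g-sym y x) e , refl , es , ↭-swap x y ↭-refl
    mate {w} ((x , y) ∷ ps) (there (there i)) (e ∷ es) with mate ps i es
    ... | z , qs , e′ , l , es′ , p = z , (x , y) ∷ qs , e′ , cong suc l , e ∷ es′ ,
      ↭-trans (↭-prep x (↭-prep y p)) (shifts (x ∷ y ∷ []) (w ∷ z ∷ []))
      where open import Data.List.Relation.Binary.Permutation.Propositional.Properties using (shifts)

    -- The outcomes of switching along the alternating path from `w`: the path ends in a vertex that
    -- lets one matching grow, or it reaches at most one of `u` and `v` and the other stays
    -- unmatched together with `w`.
    Exchanged : List V → ℕ → V → V → V → Set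
    Exchanged xs m u v w = (∃ λ L → Matching xs (suc m) L)
      ⊎ (∃ λ L → Matching xs m (w ∷ u ∷ L)) ⊎ (∃ λ L → Matching xs m (w ∷ v ∷ L))

    exchange-unmatched : ∀ {xs m L u v w} → w ∈ u ∷ v ∷ L → Matching xs m (u ∷ v ∷ L) → Exchanged xs m u v w
    exchange-unmatched {L = L} (here refl) M = inj₂ (inj₂ (L , M))
    exchange-unmatched {L = L} {u} {v} (there (here refl)) M = inj₂ (inj₁ (L , leftover-↭ (↭-swap u v ↭-refl) M))
    exchange-unmatched {L = L} {u} {v} {w} (there (there i)) M with extract i
    ... | L′ , p = inj₂ (inj₁ (v ∷ L′ , leftover-↭ (↭-trans (↭-prep u (↭-prep v p))
      (↭-trans (↭-prep u (↭-swap v w ↭-refl)) (↭-swap u w ↭-refl))) M))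

    -- The alternating path from w, followed two edges at a time.
    exchange : ∀ m {xs L K u v w} → Matching xs m (u ∷ v ∷ L) → Matching xs m (w ∷ K) → Exchanged xs m u v w
    exchange zero M@(matching [] _ _ c) (matching qs _ _ c′) =
      exchange-unmatched (∈-resp-↭ (↭-trans (↭-sym c′) c) (∈-++⁺ʳ (flat qs) (here refl))) M
    exchange (suc m) {xs} {L} {K} {u} {v} {w} M@(matching ps s a c) (matching qs s′ a′ c′)
      with ∈-++⁻ (flat ps) (∈-resp-↭ (↭-trans (↭-sym c′) c) (∈-++⁺ʳ (flat qs) (here refl)))
    ... | inj₂ i = exchange-unmatched i M
    ... | inj₁ i with mate ps i a
    ... | x , ps′ , wx , l , a₁ , p
      with ∈-++⁻ (flat qs) (∈-resp-↭ (drop-∷ (↭-trans (↭-sym (↭-trans c (++⁺ʳ (u ∷ v ∷ L) p)))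
             (↭-trans c′ (shift w (flat qs) K)))) (here refl))
    ... | inj₂ k with extract k
    ... | K′ , q = inj₁ (K′ , join wx (matching qs s′ a′ (↭-trans c′ (++⁺ˡ (flat qs) (↭-prep w q)))))
    exchange (suc m) {xs} {L} {K} {u} {v} {w} M@(matching ps s a c) (matching qs s′ a′ c′) | inj₁ i
      | x , ps′ , wx , l , a₁ , p | inj₁ k with mate qs k a′
    ... | y , qs′ , xy , l′ , a₂ , q = extend (exchange m {xs′} {L} {K} {u} {v} {y} M′ N′)
      where
      xs′ : List V
      xs′ = flat ps′ ++ u ∷ v ∷ L
      M′ : Matching xs′ m (u ∷ v ∷ L)
      M′ = matching ps′ (suc-injective (trans l s)) a₁ ↭-refl
      left : xs ↭ w ∷ x ∷ xs′
      left = ↭-trans c (++⁺ʳ (u ∷ v ∷ L) p)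
      right : xs ↭ w ∷ x ∷ y ∷ flat qs′ ++ K
      right = ↭-trans c′ (↭-trans (shift w (flat qs) K) (↭-prep w (++⁺ʳ K q)))
      N′ : Matching xs′ m (y ∷ K)
      N′ = matching qs′ (suc-injective (trans l′ s′)) a₂
        (↭-trans (drop-∷ (drop-∷ (↭-trans (↭-sym left) right))) (↭-sym (shift y (flat qs′) K)))
      rotate : ∀ {t R} → Matching xs′ m (y ∷ t ∷ R) → Matching xs (suc m) (w ∷ t ∷ R)
      rotate {t} {R} N = join xy (leftover-↭
        (↭-trans (↭-prep w (↭-prep x (↭-swap y t ↭-refl))) (rotation t R))
        (matching-↭ left (keep (keep N))))
        where
        open import Algebra.Solver.CommutativeMonoid (++-commutativeMonoid {A = V}) using (solve; _⊕_; _⊜_)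
        rotation : ∀ t R → w ∷ x ∷ t ∷ y ∷ R ↭ x ∷ y ∷ w ∷ t ∷ R
        rotation t R = solve 5 (λ w x t y R → (w ⊕ (x ⊕ (t ⊕ (y ⊕ R)))) ⊜ (x ⊕ (y ⊕ (w ⊕ (t ⊕ R)))))
          ↭-refl (w ∷ []) (x ∷ []) (t ∷ []) (y ∷ []) R
      extend : Exchanged xs′ m u v y → Exchanged xs (suc m) u v w
      extend (inj₁ (R , N)) = inj₁ (R , matching-↭ left (unjoin wx N))
      extend (inj₂ (inj₁ (R , N))) = inj₂ (inj₁ (R , rotate N))
      extend (inj₂ (inj₂ (R , N))) = inj₂ (inj₂ (R , rotate N))

    matching-length : ∀ {xs m L} → Matching xs m L → length xs ≡ 2 * m + length L
    matching-length {L = L} (matching ps refl _ c) = trans (↭-length c)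
      (trans (length-++ (flat ps)) (cong (_+ length L) (flat-length ps)))
      where
      flat-length : ∀ ps → length (flat ps) ≡ 2 * length ps
      flat-length [] = refl
      flat-length (_ ∷ ps) = trans (cong (2 +_) (flat-length ps)) (sym (*-suc 2 (length ps)))

    matching-++ : ∀ {xs ys m n K L} → Matching xs m K → Matching ys n L → Matching (xs ++ ys) (m + n) (K ++ L)
    matching-++ {K = K} {L} (matching ps refl a c) (matching qs refl b d) = matching (ps ++ qs) (length-++ ps) (All.++⁺ a b)
      (↭-trans (++⁺ c d) (↭-trans (solve 4 (λ p k q l → ((p ⊕ k) ⊕ (q ⊕ l)) ⊜ ((p ⊕ q) ⊕ (k ⊕ l))) ↭-refl (flat ps) K (flat qs) L)
        (++⁺ʳ (K ++ L) (↭-reflexive (sym (flat-++ ps))))))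
      where
      open import Algebra.Solver.CommutativeMonoid (++-commutativeMonoid {A = V}) using (solve; _⊕_; _⊜_)
      flat-++ : ∀ ps → flat (ps ++ qs) ≡ flat ps ++ flat qs
      flat-++ [] = refl
      flat-++ ((x , y) ∷ ps) = cong (λ l → x ∷ y ∷ l) (flat-++ ps)

    Maximum : List V → ℕ → Set
    Maximum xs m = ∀ {n L} → Matching xs n L → n ≤ m

    -- If no matching were maximum, one could climb from the empty matching beyond the bound set by
    -- the number of vertices.
    ¬¬maximum : ∀ xs → ¬ ¬ ∃₂ λ m L → Matching xs m L × Maximum xs m
    ¬¬maximum xs none = climb (length xs) (matching [] refl [] ↭-refl) (≤-reflexive (sym (+-identityʳ _)))
      where
      climb : ∀ f {m L} → Matching xs m L → length xs ≤ f + m → ⊥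
      climb f {m} {L} M le = none (m , L , M , λ {n} N → maximal f le N (n ≤? m))
        where
        maximal : ∀ f → length xs ≤ f + m → ∀ {n K} → Matching xs n K → Dec (n ≤ m) → n ≤ m
        maximal f le N (yes n≤m) = n≤m
        maximal (suc f) le {n} N (no n≰m) =
          ⊥-elim (climb f N (≤-trans le (≤-trans (≤-reflexive (sym (+-suc f m))) (+-monoʳ-≤ f (≰⇒> n≰m)))))
        maximal zero le {n} N (no n≰m) = contradiction (≤-trans (≤-trans (m≤m+n n (n + 0))
          (≤-trans (m≤m+n (2 * n) _) (≤-reflexive (sym (matching-length N))))) le) n≰m

    ¬¬partition : (P : V → Set) (xs : List V) → ¬ ¬ ∃₂ λ ys zs → xs ↭ ys ++ zs × All (λ x → ¬ P x) ys × All P zs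
    ¬¬partition P [] k = k ([] , [] , ↭-refl , [] , [])
    ¬¬partition P (x ∷ xs) k = ¬¬partition P xs λ (ys , zs , p , n , q) →
      k (x ∷ ys , zs , ↭-prep x p , (λ px → k (ys , x ∷ zs , ↭-trans (↭-prep x p) (↭-sym (shift x ys zs)) , n , px ∷ q)) ∷ n , q)

    -- With c = n - m colours, c + 12 ≤ n becomes 12 ≤ m, and 3c ≤ n + 2a becomes 2n ≤ 3m + 2a. In
    -- this form the inequality adds up over a join, as matchings and cliques do.
    record Balanced (xs : List V) : Set where
      constructor balanced
      field
        {m} : ℕ
        {L clique} : List V
        pairing : Matching xs m L
        clique⊑ : clique ⊑ xs
        isClique : Clique clique
        enough : 12 ≤ m ⊎ 2 * length xs ≤ 3 * m + 2 * length clique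

    balanced-++ : ∀ {xs ys} → (∀ {x y} → x ∈ xs → y ∈ ys → g x y ≡ true) → Balanced xs → Balanced ys → Balanced (xs ++ ys)
    balanced-++ {xs} {ys} cross (balanced {m} {L} {as} M s c e) (balanced {n} {K} {bs} N t d f) = balanced (matching-++ M N)
      (proj₁ s ++ proj₁ t , ↭-trans (++⁺ (proj₂ s) (proj₂ t))
        (solve 4 (λ a b c d → ((a ⊕ b) ⊕ (c ⊕ d)) ⊜ ((a ⊕ c) ⊕ (b ⊕ d))) ↭-refl as (proj₁ s) bs (proj₁ t)))
      (AllPairs.++⁺ c d (⊑-All s (All.tabulate λ i → ⊑-All t (All.tabulate λ j → cross i j))))
      (bound e f)
      where
      open import Algebra.Solver.CommutativeMonoid (++-commutativeMonoid {A = V}) using (solve; _⊕_; _⊜_)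
      bound : 12 ≤ m ⊎ 2 * length xs ≤ 3 * m + 2 * length as → 12 ≤ n ⊎ 2 * length ys ≤ 3 * n + 2 * length bs →
        12 ≤ m + n ⊎ 2 * length (xs ++ ys) ≤ 3 * (m + n) + 2 * length (as ++ bs)
      bound (inj₁ e) _ = inj₁ (≤-trans e (m≤m+n m n))
      bound (inj₂ _) (inj₁ f) = inj₁ (≤-trans f (m≤n+m n m))
      bound (inj₂ e) (inj₂ f) = inj₂ (begin
        2 * length (xs ++ ys) ≡⟨ trans (cong (2 *_) (length-++ xs)) (*-distribˡ-+ 2 (length xs) (length ys)) ⟩
        2 * length xs + 2 * length ys ≤⟨ +-mono-≤ e f ⟩
        (3 * m + 2 * length as) + (3 * n + 2 * length bs) ≡⟨ shuffle m n (length as) (length bs) ⟩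
        3 * (m + n) + 2 * (length as + length bs) ≡⟨ cong (λ l → 3 * (m + n) + 2 * l) (sym (length-++ as)) ⟩
        3 * (m + n) + 2 * length (as ++ bs) ∎)
        where
        open ≤-Reasoning
        shuffle : ∀ m n a b → (3 * m + 2 * a) + (3 * n + 2 * b) ≡ 3 * (m + n) + 2 * (a + b)
        shuffle = solve-∀

    balanced-↭ : ∀ {xs ys} → ys ↭ xs → Balanced xs → Balanced ys
    balanced-↭ p (balanced {m} {_} {as} M s c e) = balanced (matching-↭ p M) (⊑-trans s (↭⇒⊑ p)) c
      (Data.Sum.map (λ e → e) (subst (λ l → 2 * l ≤ 3 * m + 2 * length as) (sym (↭-length p))) e)
      where import Data.Sum

    -- Meant for `t = m + 2ℓ`, where a clique is large enough once twice its size reaches `t`. Up to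
    -- 2 a single vertex will do; in the other range a clique that falls short has at most `k + 1`
    -- vertices.
    half : ∀ t → t ≤ 2 ⊎ ∃ λ k → 2 * k + 3 ≤ t × t ≤ 2 * k + 4
    half 0 = inj₁ z≤n
    half 1 = inj₁ (s≤s z≤n)
    half 2 = inj₁ ≤-refl
    half 3 = inj₂ (0 , ≤-refl , n≤1+n 3)
    half 4 = inj₂ (0 , n≤1+n 3 , ≤-refl)
    half (suc (suc t@(suc (suc (suc _))))) with half t
    ... | inj₁ (s≤s (s≤s ()))
    ... | inj₂ (k , p , q) = inj₂ (suc k , subst (λ n → n + 3 ≤ 2 + t) (sym (*-suc 2 k)) (s≤s (s≤s p)) ,
      subst (λ n → 2 + t ≤ n + 4) (sym (*-suc 2 k)) (s≤s (s≤s q)))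

    -- With at most one unmatched vertex, the Ramsey bounds R(3,j+1) ≤ 4j-1 supply the clique.
    nearly-perfect : ∀ {xs m L} → NoTriple xs → Matching xs m L → length L ≤ 1 → ¬ ¬ Balanced xs
    nearly-perfect {xs} {m} {L} noTriple M ℓ≤1 none = cases (12 ≤? m) (half (m + 2 * ℓ))
      where
      ℓ : ℕ
      ℓ = length L
      len : length xs ≡ 2 * m + ℓ
      len = matching-length M
      unbalanced : ∀ {as} → as ⊑ xs → Clique as → 2 * length as < m + 2 * ℓ
      unbalanced {as} s c = ≰⇒> λ le → none (balanced M s c (inj₂ (begin
        2 * length xs ≡⟨ cong (2 *_) len ⟩
        2 * (2 * m + ℓ) ≡⟨ shuffle m ℓ ⟩
        3 * m + (m + 2 * ℓ) ≤⟨ +-monoʳ-≤ (3 * m) le ⟩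
        3 * m + 2 * length as ∎)))
        where
        open ≤-Reasoning
        shuffle : ∀ m l → 2 * (2 * m + l) ≡ 3 * m + (m + 2 * l)
        shuffle = solve-∀
      cases : Dec (12 ≤ m) → m + 2 * ℓ ≤ 2 ⊎ (∃ λ k → 2 * k + 3 ≤ m + 2 * ℓ × m + 2 * ℓ ≤ 2 * k + 4) → ⊥
      cases (yes big) _ = none (balanced M (_ , ↭-refl) [] (inj₁ big))
      cases (no _) (inj₁ small) = start xs refl
        where
        start : ∀ ys → xs ≡ ys → ⊥
        start [] e = none (balanced M (_ , ↭-refl) [] (inj₂ (≤-trans (≤-reflexive (cong (λ zs → 2 * length zs) e)) z≤n)))
        start (x ∷ ys) e = contradiction (unbalanced (subst (x ∷ [] ⊑_) (sym e) (⊑-++ˡ (x ∷ []) ys)) ([] ∷ [])) (≤⇒≯ small)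
      cases (no m≱12) (inj₂ (k , lo , hi)) = contradiction (begin
        4 * suc k + 2 ≡⟨ shuffle k ⟩
        2 * (2 * k + 3) ≤⟨ *-monoʳ-≤ 2 lo ⟩
        2 * (m + 2 * ℓ) ≡⟨ regroup m ℓ ⟩
        (2 * m + ℓ) + 3 * ℓ ≤⟨ +-monoʳ-≤ (2 * m + ℓ) (*-monoʳ-≤ 3 ℓ≤1) ⟩
        (2 * m + ℓ) + 3 ≡⟨ cong (_+ 3) (sym len) ⟩
        length xs + 3 ≡⟨ sym (+-assoc (length xs) 2 1) ⟩
        (length xs + 2) + 1 ≤⟨ +-monoˡ-≤ 1 (Positions.few xs noTriple {k} small cliques) ⟩
        4 * suc k + 1 ∎) (<⇒≱ (≤-reflexive (sym (+-suc (4 * suc k) 1))))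
        where
        open ≤-Reasoning
        shuffle : ∀ k → 4 * suc k + 2 ≡ 2 * (2 * k + 3)
        shuffle = solve-∀
        regroup : ∀ m l → 2 * (m + 2 * l) ≡ (2 * m + l) + 3 * l
        regroup = solve-∀
        small : suc k ≤ 6
        small = *-cancelˡ-≤ 2 (+-cancelʳ-≤ 1 _ _ (begin
          2 * suc k + 1 ≡⟨ odd k ⟩
          2 * k + 3 ≤⟨ lo ⟩
          m + 2 * ℓ ≤⟨ +-mono-≤ (≤-pred (≰⇒> m≱12)) (*-monoʳ-≤ 2 ℓ≤1) ⟩
          2 * 6 + 1 ∎))
          where
          odd : ∀ k → 2 * suc k + 1 ≡ 2 * k + 3
          odd = solve-∀
        cliques : ∀ {as} → as ⊑ xs → Clique as → length as ≤ suc k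
        cliques {as} s c = ≤-pred (*-cancelˡ-< 2 _ _ (<-≤-trans (unbalanced s c) (≤-trans hi (≤-reflexive (even k)))))
          where
          even : ∀ k → 2 * k + 4 ≡ 2 * suc (suc k)
          even = solve-∀

    ¬¬balanced : ∀ f xs → length xs ≤ f → NoTriple xs → ¬ ¬ Balanced xs
    ¬¬balanced zero [] _ _ none = none (balanced (matching [] refl [] ↭-refl) (_ , ↭-refl) [] (inj₂ z≤n))
    ¬¬balanced (suc f) xs len noTriple none = ¬¬maximum xs λ (m , L , M , max) → cases M max
      where
      module _ {m : ℕ} (max : Maximum xs m) where

        -- This supplies the hypothesis of Gallai's lemma. Without `x` the list is balanced by
        -- induction. If the matching found there has size `m`, it is a maximum matching missing
        -- `x`. If it is smaller, `M` gains a pair worth 3, which pays for the 2 that the vertex `x`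
        -- costs, and `xs` would be balanced.
        missable : ∀ {x L} → Matching xs m L → x ∈ xs → ¬ ¬ ∃ λ K → Matching xs m (x ∷ K)
        missable {x} {L} M x∈ never = delete (extract x∈)
          where
          delete : (∃ λ ys → xs ↭ x ∷ ys) → ⊥
          delete (ys , p) = ¬¬balanced f ys (≤-pred (≤-trans (≤-reflexive (sym (↭-length p))) len))
            (noTriple-⊑ ys⊑ noTriple) conclude
            where
            ys⊑ : ys ⊑ xs
            ys⊑ = ⊑-trans (⊑-++ʳ (x ∷ []) ys) (↭⇒⊑ p)
            conclude : Balanced ys → ⊥
            conclude (balanced {n} {K} {as} N s c e) = compare e (m≤n⇒m<n∨m≡n (max N′))
              where
              N′ : Matching xs n (x ∷ K)
              N′ = matching-↭ p (keep N)
              compare : 12 ≤ n ⊎ 2 * length ys ≤ 3 * n + 2 * length as → n < m ⊎ n ≡ m → ⊥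
              compare _ (inj₂ refl) = never (K , N′)
              compare (inj₁ big) (inj₁ _) = none (balanced N′ (_ , ↭-refl) [] (inj₁ big))
              compare (inj₂ e) (inj₁ n<m) = none (balanced M (⊑-trans s ys⊑) c (inj₂ (begin
                2 * length xs ≡⟨ trans (cong (2 *_) (↭-length p)) (*-suc 2 (length ys)) ⟩
                2 + 2 * length ys ≤⟨ +-monoʳ-≤ 2 e ⟩
                2 + (3 * n + 2 * length as) ≤⟨ n≤1+n _ ⟩
                3 + (3 * n + 2 * length as) ≡⟨ sym (trans (cong (_+ 2 * length as) (*-suc 3 n)) (+-assoc 3 (3 * n) _)) ⟩
                3 * suc n + 2 * length as ≤⟨ +-monoˡ-≤ (2 * length as) (*-monoʳ-≤ 3 n<m) ⟩
                3 * m + 2 * length as ∎)))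
                where open ≤-Reasoning

        -- Gallai: no apart pair joins a vertex that some maximum matching misses together
        -- with u to a vertex without this property.
        separate : ∀ {u v L} → Matching xs m (u ∷ v ∷ L) → ⊥
        separate {u} {v} {L} M = ¬¬partition Together ys split
          where
          Together : V → Set
          Together b = ∃ λ R → Matching xs m (u ∷ b ∷ R)
          ys : List V
          ys = v ∷ (flat (Matching.pairs M) ++ L)
          xs↭ : xs ↭ u ∷ ys
          xs↭ = ↭-trans (Matching.covers M) (shifts (flat (Matching.pairs M)) (u ∷ v ∷ []))
            where open import Data.List.Relation.Binary.Permutation.Propositional.Properties using (shifts)
          split : ¬ ∃₂ λ as bs → ys ↭ as ++ bs × All (λ x → ¬ Together x) as × All Together bs
          split (as , bs , p , alone , together) = ¬¬balanced f (u ∷ as) (≤-pred (≤-trans (m<m+n _ bs>0) lengths))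
            (noTriple-⊑ (bs , xs↭′) noTriple) λ G → ¬¬balanced f bs (≤-pred (≤-trans (m<n+m _ (s≤s z≤n)) lengths))
            (noTriple-⊑ (u ∷ as , ↭-trans xs↭′ (++-comm (u ∷ as) bs)) noTriple) λ G′ →
            none (balanced-↭ xs↭′ (balanced-++ cross G G′))
            where
            xs↭′ : xs ↭ (u ∷ as) ++ bs
            xs↭′ = ↭-trans xs↭ (↭-prep u p)
            lengths : length (u ∷ as) + length bs ≤ suc f
            lengths = ≤-trans (≤-reflexive (sym (trans (↭-length xs↭′) (length-++ (u ∷ as))))) len
            bs>0 : 0 < length bs
            bs>0 with ∈-++⁻ as (∈-resp-↭ p (here refl))
            ... | inj₁ i = contradiction (L , M) (All.lookup alone i)
            ... | inj₂ i = nonempty i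
              where
              nonempty : ∀ {x} {bs : List V} → x ∈ bs → 0 < length bs
              nonempty (here _) = s≤s z≤n
              nonempty (there _) = s≤s z≤n
            too-many : ∀ {R} → Matching xs (suc m) R → ⊥
            too-many N = 1+n≰n (max N)
            cross : ∀ {x y} → x ∈ u ∷ as → y ∈ bs → g x y ≡ true
            cross {x} {y} i j with g x y in e
            ... | true = refl
            ... | false = ⊥-elim (clash i (All.lookup together j))
              where
              clash : x ∈ u ∷ as → Together y → ⊥
              clash (here refl) (R , N) = too-many (join e N)
              clash (there i) (R , N) = missable M (∈-resp-↭ (↭-sym xs↭′) (there (∈-++⁺ˡ i)))
                λ (K , N′) → resolve (exchange m N N′)
                where
                resolve : Exchanged xs m u y x → ⊥
                resolve (inj₁ (_ , N)) = too-many N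
                resolve (inj₂ (inj₁ (R , N))) = All.lookup alone i (R , leftover-↭ (↭-swap x u ↭-refl) N)
                resolve (inj₂ (inj₂ (_ , N))) = too-many (join e N)

      cases : ∀ {m L} → Matching xs m L → Maximum xs m → ⊥
      cases {L = []} M _ = nearly-perfect noTriple M z≤n none
      cases {L = _ ∷ []} M _ = nearly-perfect noTriple M ≤-refl none
      cases {L = _ ∷ _ ∷ _} M max = separate max M

    record Coloured (xs : List V) : Set where
      constructor coloured
      field
        classes : List (List V)
        independent : All (AllPairs Apart) classes
        covers : concat classes ↭ xs
        {clique} : List V
        clique⊑ : clique ⊑ xs
        isClique : Clique clique
        economical : length classes + 12 ≤ length xs ⊎ 3 * length classes ≤ length xs + 2 * length clique

    balanced⇒coloured : ∀ {xs} → Balanced xs → Coloured xs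
    balanced⇒coloured {xs} (balanced {m} {L} {as} M@(matching ps s a c) t d e) = coloured
      (map pair-class ps ++ map (_∷ []) L) (All.++⁺ (All.map⁺ (All.map (λ e → (e ∷ []) ∷ [] ∷ []) a)) (All.map⁺ (All.tabulate λ _ → [] ∷ [])))
      (↭-trans (↭-reflexive (trans (sym (concat-++ (map pair-class ps) _)) (cong₂ _++_ (flat-classes ps) (concat-map-[_] L)))) (↭-sym c))
      t d (bound e)
      where
      open import Data.List.Properties using (concat-++; concat-map-[_])
      pair-class : V × V → List V
      pair-class (x , y) = x ∷ y ∷ []
      flat-classes : ∀ ps → concat (map pair-class ps) ≡ flat ps
      flat-classes [] = refl
      flat-classes ((x , y) ∷ ps) = cong (λ l → x ∷ y ∷ l) (flat-classes ps)
      count≡ : length (map pair-class ps ++ map (_∷ []) L) ≡ m + length L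
      count≡ = trans (length-++ (map pair-class ps)) (cong₂ _+_ (trans (length-map pair-class ps) s) (length-map (_∷ []) L))
      bound : 12 ≤ m ⊎ 2 * length xs ≤ 3 * m + 2 * length as →
        length (map pair-class ps ++ map (_∷ []) L) + 12 ≤ length xs
        ⊎ 3 * length (map pair-class ps ++ map (_∷ []) L) ≤ length xs + 2 * length as
      bound (inj₁ big) = inj₁ (begin
        _ ≡⟨ cong (_+ 12) count≡ ⟩
        (m + length L) + 12 ≤⟨ +-monoʳ-≤ (m + length L) big ⟩
        (m + length L) + m ≡⟨ shuffle m (length L) ⟩
        2 * m + length L ≡⟨ sym (matching-length M) ⟩
        length xs ∎)
        where
        open ≤-Reasoning
        shuffle : ∀ m l → (m + l) + m ≡ 2 * m + l
        shuffle = solve-∀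
      bound (inj₂ e) = inj₂ (begin
        3 * length (map pair-class ps ++ map (_∷ []) L) ≡⟨ cong (3 *_) count≡ ⟩
        3 * (m + length L) ≡⟨ shuffle m (length L) ⟩
        (2 * m + length L) + (m + 2 * length L) ≤⟨ +-mono-≤ (≤-reflexive (sym (matching-length M))) singles ⟩
        length xs + 2 * length as ∎)
        where
        open ≤-Reasoning
        shuffle : ∀ m l → 3 * (m + l) ≡ (2 * m + l) + (m + 2 * l)
        shuffle = solve-∀
        regroup : ∀ m l → 3 * m + (m + 2 * l) ≡ 2 * (2 * m + l)
        regroup = solve-∀
        singles : m + 2 * length L ≤ 2 * length as
        singles = +-cancelˡ-≤ (3 * m) _ _ (≤-trans
          (≤-reflexive (trans (regroup m (length L)) (cong (2 *_) (sym (matching-length M))))) e)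

    ¬¬coloured : ∀ f xs → length xs ≤ f → ¬ ¬ Coloured xs
    ¬¬coloured f xs len none = ¬¬balanced f xs len (noTriple f len) λ G → none (balanced⇒coloured G)
      where
      noTriple : ∀ f → length xs ≤ f → NoTriple xs
      noTriple f len {x} {y} {z} s@(ys , p) xy yz xz = peel f (≤-trans (≤-reflexive (sym (↭-length p))) len)
        where
        peel : ∀ f → 3 + length ys ≤ f → ⊥
        peel (suc f) le = ¬¬coloured f ys (≤-trans (m≤n+m (length ys) 2) (≤-pred le)) λ (coloured css st c {as} t d e) →
          none (coloured ((x ∷ y ∷ z ∷ []) ∷ css) (((xy ∷ xz ∷ []) ∷ (yz ∷ []) ∷ [] ∷ []) ∷ st)
            (↭-trans (↭-prep x (↭-prep y (↭-prep z c))) (↭-sym p)) (⊑-trans t (⊑-trans (⊑-++ʳ (x ∷ y ∷ z ∷ []) ys) (↭⇒⊑ p))) d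
            (bound (length css) (length as) e))
          where
          bound : ∀ c a → c + 12 ≤ length ys ⊎ 3 * c ≤ length ys + 2 * a →
            suc c + 12 ≤ length xs ⊎ 3 * suc c ≤ length xs + 2 * a
          bound c a (inj₁ e) = inj₁ (≤-trans (s≤s e) (≤-trans (m≤n+m (suc (length ys)) 2) (≤-reflexive (sym (↭-length p)))))
          bound c a (inj₂ e) = inj₂ (≤-trans (≤-reflexive (*-suc 3 c))
            (≤-trans (+-monoʳ-≤ 3 e) (≤-reflexive (cong (_+ 2 * a) (sym (↭-length p))))))

-- Folkman numbers: cliques, monochromatic edges and the lower bound.

module Folkman where

  open import Defs hiding (sym)
  open import Data.Bool using (Bool; true; false; not; _∧_; _∨_)
  open import Data.Bool.Properties using (∨-comm; ¬-not)
  open import Data.Bool.ListAction using (all; any)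
  open import Data.Empty using (⊥; ⊥-elim)
  open import Data.Fin as Fin using (Fin; toℕ; inject≤; punchIn; punchOut)
  import Data.Fin.Properties as Fin
  open import Data.Integer using (ℤ; +_; -[1+_]; _-_) renaming (_+_ to _+ℤ_; _*_ to _*ℤ_)
  import Data.Integer as ℤ
  import Data.Integer.Properties as ℤ
  open import Data.Nat using (ℕ; zero; suc; _+_; _*_; _∸_; _≤_; _<_; _≡ᵇ_; z≤n; s≤s; _≤?_)
  open import Data.Nat.Properties
  open import Data.List
    using (List; []; _∷_; _++_; map; length; filterᵇ; lookup; tabulate; allFin; upTo)
  open import Data.List.Properties using (length-tabulate)
  open import Data.List.Relation.Unary.All as All using (All; []; _∷_)
  import Data.List.Relation.Unary.All.Properties as All
  open import Data.List.Relation.Unary.AllPairs as AllPairs using (AllPairs; []; _∷_)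
  import Data.List.Relation.Unary.AllPairs.Properties as AllPairs
  open import Data.List.Relation.Unary.Any as Any using (Any; here; there)
  import Data.List.Relation.Unary.Any.Properties as Any
  open import Data.List.Membership.Propositional using (_∈_)
  open import Data.List.Membership.Propositional.Properties
    using (∈-allFin; ∈-concat⁻; ∈-upTo⁺; ∈-lookup)
  open import Data.List.Relation.Binary.Permutation.Propositional using (_↭_; ↭-sym; ↭⇒↭ₛ)
  open import Data.List.Relation.Binary.Permutation.Propositional.Properties
    using (↭-length; All-resp-↭; ∈-resp-↭)
  open import Data.List.Relation.Unary.Unique.Propositional.Properties using (allFin⁺)
  import Data.List.Relation.Binary.Permutation.Setoid.Properties as Permutation
  open import Data.Product using (Σ; _×_; _,_; proj₁; proj₂; ∃; ∃₂)
  open import Data.Sum using (_⊎_; inj₁; inj₂)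
  open import Function using (_∘_; case_of_; Injective)
  open import Relation.Nullary using (¬_; contradiction; yes; no; Dec)
  open import Relation.Nullary.Decidable using (decidable-stable)
  open import Relation.Binary.PropositionalEquality
    using (_≡_; _≢_; refl; sym; trans; cong; cong₂; subst; setoid)
  open import Data.Nat.Tactic.RingSolver using (solve-∀)
  open Search using (𝟙; ∑; count)
  open Lists
  open Soundness using (≡ᵇ-true; any-complete; split-∷; ∧-true; ≡⇒≡ᵇ-true)
  open Colouring
  open Soundness using (≡ᵇ-true; all-sound; any-sound; any-complete; split-∷; ∧-true; ≡⇒≡ᵇ-true)

  ≡ᵇ-refl : ∀ n → (n ≡ᵇ n) ≡ true
  ≡ᵇ-refl n = ≡⇒≡ᵇ-true {n} refl

  ≡ᵇ-sym : ∀ m n → (m ≡ᵇ n) ≡ (n ≡ᵇ m)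
  ≡ᵇ-sym zero zero = refl
  ≡ᵇ-sym zero (suc n) = refl
  ≡ᵇ-sym (suc m) zero = refl
  ≡ᵇ-sym (suc m) (suc n) = ≡ᵇ-sym m n

  allPairs-lookup : ∀ {A : Set} {R : A → A → Set} → (∀ {x y} → R x y → R y x) → ∀ {xs} → AllPairs R xs →
    ∀ {i j} → i ≢ j → R (lookup xs i) (lookup xs j)
  allPairs-lookup s (e ∷ es) {Fin.zero} {Fin.zero} ne = contradiction refl ne
  allPairs-lookup s {x ∷ xs} (e ∷ es) {Fin.zero} {Fin.suc j} ne = All.lookup e (∈-lookup {xs = xs} j)
  allPairs-lookup s {x ∷ xs} (e ∷ es) {Fin.suc i} {Fin.zero} ne = s (All.lookup e (∈-lookup {xs = xs} i))
  allPairs-lookup s (e ∷ es) {Fin.suc i} {Fin.suc j} ne = allPairs-lookup s es (ne ∘ cong Fin.suc)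

  allPairs-∈ : ∀ {A : Set} {R : A → A → Set} → (∀ {x y} → R x y → R y x) → ∀ {xs} → AllPairs R xs →
    ∀ {x y} → x ∈ xs → y ∈ xs → x ≢ y → R x y
  allPairs-∈ s (e ∷ es) (here refl) (here refl) ne = contradiction refl ne
  allPairs-∈ s (e ∷ es) (here refl) (there j) ne = All.lookup e j
  allPairs-∈ s (e ∷ es) (there i) (here refl) ne = s (All.lookup e i)
  allPairs-∈ s (e ∷ es) (there i) (there j) ne = allPairs-∈ s es i j ne

  two : ∀ {A : Set} → A → A → Fin 2 → A
  two x y Fin.zero = x
  two x y (Fin.suc _) = y

  adjacent-≢ : ∀ {n} (G : Graph n) {u v} → adj G u v ≡ true → u ≢ v
  adjacent-≢ G e refl = case trans (sym e) (irrefl G _) of λ ()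

  edge-clique : ∀ {n} (G : Graph n) {u v} → adj G u v ≡ true → IsClique G (two u v)
  edge-clique G {u} {v} e = injective , adjacent
    where
    injective : Injective _≡_ _≡_ (two u v)
    injective {Fin.zero} {Fin.zero} _ = refl
    injective {Fin.zero} {Fin.suc Fin.zero} u≡v = contradiction u≡v (adjacent-≢ G e)
    injective {Fin.suc Fin.zero} {Fin.zero} v≡u = contradiction (sym v≡u) (adjacent-≢ G e)
    injective {Fin.suc Fin.zero} {Fin.suc Fin.zero} _ = refl
    adjacent : ∀ i j → i ≢ j → adj G (two u v i) (two u v j) ≡ true
    adjacent Fin.zero Fin.zero ne = contradiction refl ne
    adjacent Fin.zero (Fin.suc _) _ = e
    adjacent (Fin.suc _) Fin.zero _ = trans (Graph.sym G v u) e
    adjacent (Fin.suc Fin.zero) (Fin.suc Fin.zero) ne = contradiction refl ne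

  clique-list : ∀ {n} (G : Graph n) {q} as → AllPairs (λ x y → adj G x y ≡ true) as → q ≤ length as → HasClique G q
  clique-list G {q} as c q≤ = f , (λ {i} {j} → injective i j) , adjacent
    where
    f : Fin q → _
    f i = lookup as (inject≤ i q≤)
    adjacent : ∀ i j → i ≢ j → adj G (f i) (f j) ≡ true
    adjacent i j ne = allPairs-lookup (λ {x} {y} e → trans (Graph.sym G y x) e) c (ne ∘ Fin.inject≤-injective q≤ q≤ i j)
    injective : ∀ i j → f i ≡ f j → i ≡ j
    injective i j e with i Fin.≟ j
    ... | yes i≡j = i≡j
    ... | no ne = contradiction e (adjacent-≢ G (adjacent i j ne))

  MonoEdge : ∀ {n r} → Graph n → (Fin n → Fin r) → Set
  MonoEdge G c = ∃₂ λ u v → adj G u v ≡ true × c u ≡ c v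

  arrows-edge : ∀ {n r} (G : Graph n) → VArrows G r (twos r) → (c : Fin n → Fin r) → MonoEdge G c
  arrows-edge G arr c with arr c
  ... | i , f , (_ , adjacent) , mono =
    f Fin.zero , f (Fin.suc Fin.zero) , adjacent Fin.zero (Fin.suc Fin.zero) (λ ()) , trans (mono Fin.zero) (sym (mono (Fin.suc Fin.zero)))

  edge-arrows : ∀ {n r} (G : Graph n) → ((c : Fin n → Fin r) → MonoEdge G c) → VArrows G r (twos r)
  edge-arrows G edge c with edge c
  ... | u , v , e , same = c u , two u v , edge-clique G e , λ { Fin.zero → refl ; (Fin.suc Fin.zero) → sym same }

  -- At least `r + 1` colours are needed and cliques have at most `q - 1` vertices, so the two
  -- alternatives read m ≥ r + 13 and m ≥ 3(r+1) - 2(q-1) = 3r + 5 - 2q.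
  lower-bound : ∀ {m} (G : Graph m) {r q N} → InHv G r (twos r) q → N ≤ r + 13 → N + 2 * q ≤ 3 * r + 5 → N ≤ m
  lower-bound {m} G {r} {q} {N} (arr , ω<q) N≤ N+2q≤ = decidable-stable (N ≤? m) λ N≰m →
    ¬¬coloured m (allFin m) (≤-reflexive (length-tabulate (λ i → i))) λ C → N≰m (conclude C)
    where
    open Graphs (adj G) (Graph.sym G)
    conclude : Coloured (allFin m) → N ≤ m
    conclude (coloured css ind covers {as} _ isClique e) = bound (length css ≤? r)
      (subst (λ n → length css + 12 ≤ n ⊎ 3 * length css ≤ n + 2 * length as) (length-tabulate {n = m} (λ i → i)) e)
      where
      class : ∀ v → Any (v ∈_) css
      class v = ∈-concat⁻ css (∈-resp-↭ (↭-sym covers) (∈-allFin v))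
      few-colours : length css ≤ r → ⊥
      few-colours le with arrows-edge G arr (λ v → inject≤ (Any.index (class v)) le)
      ... | u , v , e , same = case trans (sym e) (allPairs-∈ (λ {x} {y} e → trans (Graph.sym G y x) e)
          (All.lookup ind (∈-lookup {xs = css} (Any.index (class u)))) (Any.lookup-index (class u))
          (subst (λ i → v ∈ lookup css i) (sym (Fin.inject≤-injective le le _ _ same)) (Any.lookup-index (class v)))
          (adjacent-≢ G e)) of λ ()
      clique< : length as < q
      clique< with suc (length as) ≤? q
      ... | yes lt = lt
      ... | no ¬lt = contradiction (clique-list G as isClique (≤-pred (≰⇒> ¬lt))) ω<q
      bound : Dec (length css ≤ r) → length css + 12 ≤ m ⊎ 3 * length css ≤ m + 2 * length as → N ≤ m
      bound (yes le) _ = ⊥-elim (few-colours le)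
      bound (no gt) (inj₁ e) = ≤-trans N≤ (≤-trans (≤-reflexive (+-suc r 12)) (≤-trans (+-monoˡ-≤ 12 (≰⇒> gt)) e))
      bound (no gt) (inj₂ e) = +-cancelʳ-≤ (2 * q) _ _ (begin
        N + 2 * q ≤⟨ N+2q≤ ⟩
        3 * r + 5 ≡⟨ shuffle r ⟩
        3 * suc r + 2 ≤⟨ +-monoˡ-≤ 2 (*-monoʳ-≤ 3 (≰⇒> gt)) ⟩
        3 * length css + 2 ≤⟨ +-monoˡ-≤ 2 e ⟩
        (m + 2 * length as) + 2 ≡⟨ regroup m (length as) ⟩
        m + 2 * suc (length as) ≤⟨ +-monoʳ-≤ m (*-monoʳ-≤ 2 clique<) ⟩
        m + 2 * q ∎)
        where
        open ≤-Reasoning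
        shuffle : ∀ r → 3 * r + 5 ≡ 3 * suc r + 2
        shuffle = solve-∀
        regroup : ∀ m a → (m + 2 * a) + 2 ≡ m + 2 * suc a
        regroup = solve-∀

  -- Searches certifying clique-freeness and non-colourability.

  noClique : ∀ {A : Set} → (A → A → Bool) → ℕ → List A → Bool
  noClique r zero xs = false
  noClique r (suc k) [] = true
  noClique r (suc k) (x ∷ xs) = noClique r k (filterᵇ (r x) xs) ∧ noClique r (suc k) xs

  module CliqueSearch {A : Set} (r : A → A → Bool) (r-irrefl : ∀ x → r x x ≡ false) (r-sym : ∀ x y → r x y ≡ r y x) where

    Sound : ℕ → List A → Set
    Sound k xs = noClique r k xs ≡ true → ∀ as → length as ≡ k → All (_∈ xs) as → ¬ AllPairs (λ x y → r x y ≡ true) as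

    sound-suc : ∀ k → (∀ xs → Sound k xs) → ∀ xs → Sound (suc k) xs
    sound-suc k ih [] e (a ∷ as) len (() ∷ _) c
    sound-suc k ih (x ∷ xs) e as len mem c with split-∷ as mem
    ... | inj₁ mem′ = sound-suc k ih xs (proj₂ (∧-true {noClique r k _} e)) as len mem′ c
    ... | inj₂ (bs , p) = ih (filterᵇ (r x) xs) (proj₁ (∧-true e)) bs
      (suc-injective (trans (sym (↭-length p)) len))
      (All.zipWith inside (All.tail (All-resp-↭ p mem) , AllPairs.head c′)) (AllPairs.tail c′)
      where
      c′ = Permutation.AllPairs-resp-↭ (setoid A) (λ {x} {y} e → trans (r-sym y x) e)
        ((λ { refl e → e }) , (λ { refl e → e })) (↭⇒↭ₛ p) c
      inside : ∀ {y} → y ∈ x ∷ xs × r x y ≡ true → y ∈ filterᵇ (r x) xs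
      inside (here refl , e) = case trans (sym e) (r-irrefl x) of λ ()
      inside (there j , e) = filterᵇ-∈ (r x) j e

    noClique-sound : ∀ k xs → Sound k xs
    noClique-sound zero xs ()
    noClique-sound (suc k) = sound-suc k (noClique-sound k)

  pigeonhole : ∀ {n r} (c : Fin n → Fin r) → 2 * r < n →
    ∃ λ as → length as ≡ 3 × AllPairs (λ u v → u ≢ v × c u ≡ c v) as
  pigeonhole {n} {r} c 2r<n with locate (λ i → 3 Data.Nat.≤ᵇ count (λ v → toℕ (c v) ≡ᵇ toℕ i) (allFin n)) (allFin r)
    where import Data.Nat
  ... | inj₁ none = contradiction (begin
    n ≡⟨ sym (length-tabulate (λ i → i)) ⟩
    length (allFin n) ≡⟨ sym (trans (∑-≡ {n = 1} (allFin n) (All.tabulate λ {v} _ → once (c v))) (*-identityʳ _)) ⟩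
    ∑ (λ v → ∑ (λ i → 𝟙 (toℕ (c v) ≡ᵇ toℕ i)) (allFin r)) (allFin n) ≡⟨ ∑-swap (λ v i → 𝟙 (toℕ (c v) ≡ᵇ toℕ i)) (allFin n) (allFin r) ⟩
    ∑ (λ i → count (λ v → toℕ (c v) ≡ᵇ toℕ i) (allFin n)) (allFin r) ≤⟨ ∑-≤ {n = 2} (allFin r) (All.map (≤-pred ∘ ≤ᵇ-false) none) ⟩
    length (allFin r) * 2 ≡⟨ trans (cong (_* 2) (length-tabulate {n = r} (λ i → i))) (*-comm r 2) ⟩
    2 * r ∎) (<⇒≱ 2r<n)
    where
    open ≤-Reasoning
    open Soundness using (≤ᵇ-false)
    once : ∀ (j : Fin r) → ∑ (λ i → 𝟙 (toℕ j ≡ᵇ toℕ i)) (allFin r) ≡ 1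
    once j with extract (∈-allFin j)
    ... | is , p = trans (∑-↭ _ p) (cong₂ _+_ (cong 𝟙 (≡ᵇ-refl (toℕ j)))
      (trans (∑-≡ {n = 0} is (All.map (λ {i} ne → cong 𝟙 (¬-not (ne ∘ Fin.toℕ-injective ∘ ≡ᵇ-true))) others)) (*-zeroʳ (length is))))
      where
      others : All (j ≢_) is
      others = AllPairs.head (Permutation.Unique-resp-↭ (setoid _) (↭⇒↭ₛ p) (allFin⁺ r))
  ... | inj₂ (i , _ , e) with partitionᵇ (λ v → toℕ (c v) ≡ᵇ toℕ i) (allFin n)
  ... | ts , fs , p , t , f = first ts p t (≤-trans (≤ᵇ-true e) (≤-reflexive (trans (∑-↭ _ p) (trans (∑-++ _ ts fs)
          (trans (cong₂ _+_ (count-true t) (count-false f)) (+-identityʳ _))))))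
    where
    open Soundness using (≤ᵇ-true)
    first : ∀ ts → allFin n ↭ ts ++ fs → All (λ v → (toℕ (c v) ≡ᵇ toℕ i) ≡ true) ts → 3 ≤ length ts →
      ∃ λ as → length as ≡ 3 × AllPairs (λ u v → u ≢ v × c u ≡ c v) as
    first (u ∷ v ∷ w ∷ ts) p (eu ∷ ev ∷ ew ∷ _) _ = u ∷ v ∷ w ∷ [] , refl , distinct
      where
      unique : AllPairs _≢_ (u ∷ v ∷ w ∷ ts ++ fs)
      unique = Permutation.Unique-resp-↭ (setoid _) (↭⇒↭ₛ p) (allFin⁺ n)
      same : ∀ {x y} → (toℕ (c x) ≡ᵇ toℕ i) ≡ true → (toℕ (c y) ≡ᵇ toℕ i) ≡ true → c x ≡ c y
      same ex ey = Fin.toℕ-injective (trans (≡ᵇ-true ex) (sym (≡ᵇ-true ey)))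
      distinct : AllPairs (λ u v → u ≢ v × c u ≡ c v) (u ∷ v ∷ w ∷ [])
      distinct with unique
      ... | (uv ∷ uw ∷ _) ∷ (vw ∷ _) ∷ _ =
        ((uv , same eu ev) ∷ (uw , same eu ew) ∷ []) ∷ ((vw , same ev ew) ∷ []) ∷ [] ∷ []
    first [] _ _ ()
    first (_ ∷ []) _ _ (s≤s ())
    first (_ ∷ _ ∷ []) _ _ (s≤s (s≤s ()))

  -- Backtracking over partial colourings: every colour for `v` either repeats on an assigned
  -- neighbour or fails further on.
  refutes : ∀ {A : Set} → (A → A → Bool) → ℕ → List (A × ℕ) → List A → Bool
  refutes l r assigned [] = false
  refutes l r assigned (v ∷ vs) =
    all (λ k → any (λ p → l v (proj₁ p) ∧ (k ≡ᵇ proj₂ p)) assigned ∨ refutes l r ((v , k) ∷ assigned) vs) (upTo r)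

  refutes-sound : ∀ {A : Set} (l : A → A → Bool) r (c : A → ℕ) → (∀ v → c v < r) → ∀ assigned vs →
    All (λ p → c (proj₁ p) ≡ proj₂ p) assigned → refutes l r assigned vs ≡ true →
    ∃₂ λ u v → l u v ≡ true × c u ≡ c v
  refutes-sound l r c c< assigned (v ∷ vs) ok e
    with any (λ p → l v (proj₁ p) ∧ (c v ≡ᵇ proj₂ p)) assigned in found
       | all-sound (λ k → any (λ p → l v (proj₁ p) ∧ (k ≡ᵇ proj₂ p)) assigned ∨ refutes l r ((v , k) ∷ assigned) vs) (upTo r) e (∈-upTo⁺ (c< v))
  ... | true | _ = clash (any-sound (λ p → l v (proj₁ p) ∧ (c v ≡ᵇ proj₂ p)) assigned found)
    where
    clash : _ → _
    clash ((w , k) , i , e) = v , w , proj₁ (∧-true e) , trans (≡ᵇ-true (proj₂ (∧-true {l v w} e))) (sym (All.lookup ok i))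
  ... | false | e′ = refutes-sound l r c c< ((v , c v) ∷ assigned) vs (refl ∷ ok) e′

  module Complement (nbrs : ℕ → List ℕ) where

    -- The graph has adjacency `link`; `nbrs` describes its complement, and an edge of the
    -- complement may be listed at one end only.
    joined link nonlink : ℕ → ℕ → Bool
    joined a b = any (b ≡ᵇ_) (nbrs a) ∨ any (a ≡ᵇ_) (nbrs b)
    link a b = not (a ≡ᵇ b) ∧ not (joined a b)
    nonlink a b = not (a ≡ᵇ b) ∧ joined a b

    link-sym : ∀ a b → link a b ≡ link b a
    link-sym a b = cong₂ (λ s t → not s ∧ not t) (≡ᵇ-sym a b) (∨-comm (any (b ≡ᵇ_) (nbrs a)) _)

    nonlink-sym : ∀ a b → nonlink a b ≡ nonlink b a
    nonlink-sym a b = cong₂ (λ s t → not s ∧ t) (≡ᵇ-sym a b) (∨-comm (any (b ≡ᵇ_) (nbrs a)) _)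

    link-irrefl : ∀ a → link a a ≡ false
    link-irrefl a rewrite ≡ᵇ-refl a = refl

    nonlink-irrefl : ∀ a → nonlink a a ≡ false
    nonlink-irrefl a rewrite ≡ᵇ-refl a = refl

    graph : ∀ n → Graph n
    graph n = record
      { adj = λ u v → link (toℕ u) (toℕ v)
      ; sym = λ u v → link-sym (toℕ u) (toℕ v)
      ; irrefl = λ v → link-irrefl (toℕ v) }

    clique-free : ∀ n q → noClique link q (upTo n) ≡ true → CliqueNumberLt (graph n) q
    clique-free n q e (f , _ , adjacent) = CliqueSearch.noClique-sound link link-irrefl link-sym q (upTo n) e
      (tabulate (toℕ ∘ f)) (length-tabulate (toℕ ∘ f)) (All.tabulate⁺ λ i → ∈-upTo⁺ (Fin.toℕ<n (f i)))
      (AllPairs.tabulate⁺ λ {i} {j} → adjacent i j)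

    pigeonhole-arrows : ∀ n r → noClique nonlink 3 (upTo n) ≡ true → 2 * r < n → VArrows (graph n) r (twos r)
    pigeonhole-arrows n r e 2r<n = edge-arrows (graph n) λ c → search c (pigeonhole c 2r<n)
      where
      search : (c : Fin n → Fin r) → (∃ λ as → length as ≡ 3 × AllPairs (λ u v → u ≢ v × c u ≡ c v) as) → MonoEdge (graph n) c
      search c (u ∷ v ∷ w ∷ [] , _ , ((uv , cuv) ∷ (uw , cuw) ∷ []) ∷ ((vw , cvw) ∷ []) ∷ [] ∷ [])
        with link (toℕ u) (toℕ v) in e₁ | link (toℕ u) (toℕ w) in e₂ | link (toℕ v) (toℕ w) in e₃
      ... | true | _ | _ = u , v , e₁ , cuv
      ... | false | true | _ = u , w , e₂ , cuw
      ... | false | false | true = v , w , e₃ , cvw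
      ... | false | false | false = ⊥-elim (CliqueSearch.noClique-sound nonlink nonlink-irrefl nonlink-sym 3 (upTo n) e
        (toℕ u ∷ toℕ v ∷ toℕ w ∷ []) refl (inside u ∷ inside v ∷ inside w ∷ [])
        ((apart uv e₁ ∷ apart uw e₂ ∷ []) ∷ (apart vw e₃ ∷ []) ∷ [] ∷ []))
        where
        inside : ∀ x → toℕ x ∈ upTo n
        inside x = ∈-upTo⁺ (Fin.toℕ<n x)
        apart : ∀ {x y : Fin n} → x ≢ y → link (toℕ x) (toℕ y) ≡ false → nonlink (toℕ x) (toℕ y) ≡ true
        apart {x} {y} ne e with toℕ x ≡ᵇ toℕ y in e′ | joined (toℕ x) (toℕ y)
        ... | true | _ = contradiction (Fin.toℕ-injective (≡ᵇ-true e′)) ne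
        ... | false | true = refl

    brute-force-arrows : ∀ n r → refutes (adj (graph n)) r [] (allFin n) ≡ true → VArrows (graph n) r (twos r)
    brute-force-arrows n r e = edge-arrows (graph n) λ c → edge c (refutes-sound (adj (graph n)) r (toℕ ∘ c) (Fin.toℕ<n ∘ c) [] (allFin n) [] e)
      where
      edge : (c : Fin n → Fin r) → (∃₂ λ u v → adj (graph n) u v ≡ true × toℕ (c u) ≡ toℕ (c v)) → MonoEdge (graph n) c
      edge c (u , v , e , same) = u , v , e , Fin.toℕ-injective same

  -- Graphs for the smallest values of r.

  distances : List ℕ → ℕ → List ℕ
  distances ds a = map (λ d → a + d) ds

  -- A 17-vertex triangle-free graph without independent 6-set; no cyclic one exists.
  table17 : ℕ → List ℕ
  table17 0 = 4 ∷ 6 ∷ 9 ∷ 13 ∷ []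
  table17 1 = 5 ∷ 7 ∷ 8 ∷ 12 ∷ []
  table17 2 = 6 ∷ 8 ∷ 11 ∷ 12 ∷ 14 ∷ []
  table17 3 = 7 ∷ 9 ∷ 10 ∷ 12 ∷ 13 ∷ []
  table17 4 = 8 ∷ 10 ∷ 11 ∷ 12 ∷ []
  table17 5 = 9 ∷ 10 ∷ 11 ∷ 13 ∷ []
  table17 6 = 10 ∷ 15 ∷ []
  table17 7 = 11 ∷ 14 ∷ []
  table17 8 = 13 ∷ 15 ∷ []
  table17 9 = 14 ∷ 15 ∷ []
  table17 10 = 14 ∷ []
  table17 11 = 15 ∷ []
  table17 12 = 16 ∷ []
  table17 13 = 16 ∷ []
  table17 14 = 16 ∷ []
  table17 15 = 16 ∷ []
  table17 _ = []

  Folkman : ℕ → ℕ → ℕ → Set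
  Folkman n r q = Σ (Graph n) λ G → InHv G r (twos r) q

  -- For r = 2k+2 the required order is 2r+1 = 4k+5, which calls for a triangle-free complement on
  -- 4k+5 vertices without stable (k+3)-set. For k = 1 this would contradict R(3,4) ≤ 9, whence the
  -- exceptional condition r ≥ 2k+3 there.
  by-search : ∀ (nbrs : ℕ → List ℕ) n r q → let open Complement nbrs in
    noClique nonlink 3 (upTo n) ≡ true → 2 * r < n → noClique link q (upTo n) ≡ true → Folkman n r q
  by-search nbrs n r q e lt e′ = graph n , pigeonhole-arrows n r e lt , clique-free n q e′
    where open Complement nbrs

  -- For k = -1: adding universal vertices to a point gives the complete graph on `r + 1` vertices.
  base₁ : Folkman 1 0 2
  base₁ = by-search (distances []) 1 0 2 refl ≤-refl refl

  -- The 5-cycle. Sums are not reduced modulo the order, so a cyclic distance d is listed together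
  -- with 5 - d.
  base₅ : Folkman 5 2 3
  base₅ = by-search (distances (1 ∷ 4 ∷ [])) 5 2 3 refl ≤-refl refl

  -- The complement of two disjoint 5-cycles, i.e. the join of two 5-cycles.
  base₁₀ : Folkman 10 5 5
  base₁₀ = graph 10 , brute-force-arrows 10 5 refl , clique-free 10 5 refl
    where open Complement (distances (2 ∷ 8 ∷ []))

  base₁₃ : Folkman 13 6 5
  base₁₃ = by-search (distances (1 ∷ 5 ∷ 8 ∷ 12 ∷ [])) 13 6 5 refl ≤-refl refl

  base₁₇ : Folkman 17 8 6
  base₁₇ = by-search table17 17 8 6 refl ≤-refl refl

  base₂₁ : Folkman 21 10 7
  base₂₁ = by-search (distances (1 ∷ 3 ∷ 8 ∷ 13 ∷ 18 ∷ 20 ∷ [])) 21 10 7 refl ≤-refl refl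

  -- Unlike the cyclic graphs above, this one uses plain differences of the numbers below 25: 1, and
  -- those congruent to 3 modulo 5. Two of the latter add up to at least 6 and to 1 modulo 5, and
  -- the other sums are 2 or 4 modulo 5, so there is no triangle.
  base₂₅ : Folkman 25 12 8
  base₂₅ = by-search (distances (1 ∷ 3 ∷ 8 ∷ 13 ∷ 18 ∷ 23 ∷ [])) 25 12 8 refl ≤-refl refl

  -- Adding universal vertices.

  cone : ∀ {n} → Graph n → Graph (suc n)
  cone {n} G = record { adj = adjacent ; sym = symmetric ; irrefl = irreflexive }
    where
    adjacent : Fin (suc n) → Fin (suc n) → Bool
    adjacent Fin.zero Fin.zero = false
    adjacent Fin.zero (Fin.suc _) = true
    adjacent (Fin.suc _) Fin.zero = true
    adjacent (Fin.suc u) (Fin.suc v) = adj G u v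
    symmetric : ∀ u v → adjacent u v ≡ adjacent v u
    symmetric Fin.zero Fin.zero = refl
    symmetric Fin.zero (Fin.suc _) = refl
    symmetric (Fin.suc _) Fin.zero = refl
    symmetric (Fin.suc u) (Fin.suc v) = Graph.sym G u v
    irreflexive : ∀ v → adjacent v v ≡ false
    irreflexive Fin.zero = refl
    irreflexive (Fin.suc v) = irrefl G v

  -- If the colour of the universal vertex occurs nowhere else, the remaining vertices are coloured
  -- with one colour less.
  cone-edge : ∀ {n r} (G : Graph n) → (∀ (c : Fin n → Fin r) → MonoEdge G c) → (c : Fin (suc n) → Fin (suc r)) → MonoEdge (cone G) c
  cone-edge {n} {r} G edge c with Fin.any? (λ v → c Fin.zero Fin.≟ c (Fin.suc v))
  ... | yes (v , same) = Fin.zero , Fin.suc v , refl , same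
  ... | no fresh = lift (edge c′)
    where
    differs : ∀ v → c Fin.zero ≢ c (Fin.suc v)
    differs v same = fresh (v , same)
    c′ : Fin n → Fin r
    c′ v = punchOut (differs v)
    lift : MonoEdge G c′ → MonoEdge (cone G) c
    lift (u , v , e , same) = Fin.suc u , Fin.suc v , e , Fin.punchOut-injective (differs u) (differs v) same

  cone-clique : ∀ {n q} (G : Graph n) → HasClique (cone G) (suc q) → HasClique G q
  cone-clique {n} {q} G (f , inj , adjacent) = descend (Fin.any? (λ i → f i Fin.≟ Fin.zero))
    where
    without : (i : Fin (suc q)) → (∀ j → f (punchIn i j) ≢ Fin.zero) → HasClique G q
    without i nonzero = f′ , injective , adjacent′
      where
      f′ : Fin q → Fin n
      f′ j = punchOut (nonzero j ∘ sym)
      suc-f′ : ∀ j → f (punchIn i j) ≡ Fin.suc (f′ j)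
      suc-f′ j = sym (Fin.punchIn-punchOut (nonzero j ∘ sym))
      injective : Injective _≡_ _≡_ f′
      injective {j} {k} e = Fin.punchIn-injective i j k (inj (trans (suc-f′ j) (trans (cong Fin.suc e) (sym (suc-f′ k)))))
      adjacent′ : ∀ j k → j ≢ k → adj G (f′ j) (f′ k) ≡ true
      adjacent′ j k ne = trans (cong₂ (adj (cone G)) (sym (suc-f′ j)) (sym (suc-f′ k)))
        (adjacent _ _ (ne ∘ Fin.punchIn-injective i j k))
    descend : Dec (∃ λ i → f i ≡ Fin.zero) → HasClique G q
    descend (yes (i , e)) = without i λ j e′ → Fin.punchInᵢ≢i i j (inj (trans e′ (sym e)))
    -- The universal vertex is not in the clique, so any vertex may be dropped, here the first.
    descend (no none) = without Fin.zero λ j e → none (_ , e)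

  cones : ∀ t {n} → Graph n → Graph (t + n)
  cones zero G = G
  cones (suc t) G = cone (cones t G)

  cones-InHv : ∀ t {n} (G : Graph n) {r q} → InHv G r (twos r) q → InHv (cones t G) (t + r) (twos (t + r)) (t + q)
  cones-InHv zero G H = H
  cones-InHv (suc t) G H with cones-InHv t G H
  ... | arr , ω = edge-arrows (cone (cones t G)) (cone-edge (cones t G) (arrows-edge (cones t G) arr)) , ω ∘ cone-clique (cones t G)

  -- Each universal vertex raises the order, the number of colours and the clique bound by one, so
  -- their differences are invariant; the equations express this without subtraction.
  upper-bound : ∀ {n₀ r₀ q₀ r q N} → Folkman n₀ r₀ q₀ → r₀ ≤ r →
    q + r₀ ≡ r + q₀ → N + r₀ ≡ r + n₀ → Folkman N r q
  upper-bound {n₀} {r₀} {q₀} {r} (G , H) r₀≤r eq eN =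
    transport (shifted n₀ eN) (m∸n+n≡m r₀≤r) (shifted q₀ eq) (cones (r ∸ r₀) G , cones-InHv (r ∸ r₀) G H)
    where
    transport : ∀ {n n′ r r′ q q′} → n ≡ n′ → r ≡ r′ → q ≡ q′ → Folkman n r q → Folkman n′ r′ q′
    transport refl refl refl H = H
    shifted : ∀ {x} y → x + r₀ ≡ r + y → r ∸ r₀ + y ≡ x
    shifted {x} y e = +-cancelʳ-≡ r₀ _ x (trans (shuffle (r ∸ r₀) y r₀) (trans (cong (_+ y) (m∸n+n≡m r₀≤r)) (sym e)))
      where
      shuffle : ∀ t y s → (t + y) + s ≡ (t + s) + y
      shuffle = solve-∀

  -- Passing from the integer parameter k to natural numbers.

  module Parameters where
    import Data.Integer.Tactic.RingSolver as ℤ-Solver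

    q-equation : ∀ c {r q} → + q ≡ (+ r - + c) +ℤ + 1 → q + c ≡ r + 1
    q-equation c {r} {q} e = ℤ.+-injective (trans (cong (_+ℤ + c) e) (cancel (+ r) (+ c)))
      where
      cancel : ∀ r c → ((r - c) +ℤ + 1) +ℤ c ≡ r +ℤ + 1
      cancel = ℤ-Solver.solve-∀

    N-equation : ∀ {r N} → + N ≡ (+ r +ℤ + 2 *ℤ -[1+ 0 ]) +ℤ + 3 → N ≡ r + 1
    N-equation {r} e = ℤ.+-injective (trans e (shift (+ r)))
      where
      shift : ∀ r → (r +ℤ + 2 *ℤ -[1+ 0 ]) +ℤ + 3 ≡ r +ℤ + 1
      shift = ℤ-Solver.solve-∀

  open Parameters

  -- Here `c` is k: N + 2q equals 3r + 5 identically, and `c ≤ 5` is what makes N ≤ r + 13.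
  lower : ∀ {c r q N} → c ≤ 5 → q + c ≡ r + 1 → N ≡ (r + 2 * c) + 3 → ∀ m (G : Graph m) → InHv G r (twos r) q → N ≤ m
  lower {c} {r} {q} c≤5 eq refl m G H = lower-bound G H
    (≤-trans (≤-reflexive (+-assoc r (2 * c) 3)) (+-monoʳ-≤ r (+-monoˡ-≤ 3 (*-monoʳ-≤ 2 c≤5))))
    (≤-reflexive (trans (regroup r c q) (trans (cong (λ s → (r + 3) + 2 * s) eq) (collect r))))
    where
    regroup : ∀ r c q → ((r + 2 * c) + 3) + 2 * q ≡ (r + 3) + 2 * (q + c)
    regroup = solve-∀
    collect : ∀ r → (r + 3) + 2 * (r + 1) ≡ 3 * r + 5
    collect = solve-∀

  -- `c` is k and `c + d` is the smallest r of the construction, at which q = r - k + 1 equals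
  -- `1 + d`.
  solution : ∀ c d {n₀ r q N} → Folkman n₀ (c + d) (1 + d) → c ≤ 5 → n₀ ≡ 2 * c + (3 + (c + d)) →
    + q ≡ (+ r - + c) +ℤ + 1 → N ≡ (r + 2 * c) + 3 →
    (∀ m (G : Graph m) → InHv G r (twos r) q → N ≤ m) × (c + d ≤ r → FvIs r (twos r) q N)
  solution c d {r = r} {q} base c≤5 refl eq refl = least , λ r₀≤r →
    upper-bound base r₀≤r
      (trans (sym (+-assoc q c d)) (trans (cong (_+ d) q+c) (+-assoc r 1 d)))
      (trans (+-assoc (r + 2 * c) 3 (c + d)) (+-assoc r (2 * c) (3 + (c + d)))) , least
    where
    q+c : q + c ≡ r + 1
    q+c = q-equation c eq
    least : ∀ m (G : Graph m) → InHv G r (twos r) q → (r + 2 * c) + 3 ≤ m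
    least = lower c≤5 q+c refl

  solution₋₁ : ∀ {r q N} → + q ≡ (+ r - -[1+ 0 ]) +ℤ + 1 → + N ≡ (+ r +ℤ + 2 *ℤ -[1+ 0 ]) +ℤ + 3 →
    (∀ m (G : Graph m) → InHv G r (twos r) q → N ≤ m) × FvIs r (twos r) q N
  solution₋₁ {r} eq eN = solve (ℤ.+-injective eq) (N-equation {r} eN)
    where
    solve : ∀ {r q N} → q ≡ r + 1 + 1 → N ≡ r + 1 →
      (∀ m (G : Graph m) → InHv G r (twos r) q → N ≤ m) × FvIs r (twos r) q N
    solve {r} refl refl = least , upper-bound base₁ z≤n (trans (+-identityʳ _) (+-assoc r 1 1)) (+-identityʳ _) , least
      where
      shuffle : ∀ r → (r + 1) + 2 * (r + 1 + 1) ≡ 3 * r + 5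
      shuffle = solve-∀
      least : ∀ m (G : Graph m) → InHv G r (twos r) (r + 1 + 1) → r + 1 ≤ m
      least m G H = lower-bound G H (+-monoʳ-≤ r (s≤s z≤n)) (≤-reflexive (shuffle r))

open import Defs
open import Data.Nat using (ℕ; _≤_)
open import Data.Integer using (ℤ; +_; -[1+_]; _+_; _-_; _*_) renaming (_≤_ to _≤ℤ_)
open import Data.Product using (_×_)
open import Data.Sum using (_⊎_)
open import Relation.Binary.PropositionalEquality using (_≡_)
open Folkman using (solution; solution₋₁; base₅; base₁₀; base₁₃; base₁₇; base₂₁; base₂₅)
open import Data.Integer using (-≤-; +≤+)
open import Data.Nat using (suc; z≤n; s≤s)
open import Data.Nat.Properties using (≤-trans; n≤1+n)
open import Data.Integer.Properties using (+-injective; drop‿+≤+)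
open import Data.Product using (_,_; map₂)
open import Data.Sum using (inj₁; inj₂)
open import Relation.Binary.PropositionalEquality using (refl)

theorem1p1 : (r : ℕ) (k : ℤ) → -[1+ 0 ] ≤ℤ k → k ≤ℤ + 5 → k + + 2 ≤ℤ + r →
    (q N : ℕ) → + q ≡ (+ r - k) + + 1 → + N ≡ (+ r + + 2 * k) + + 3 →
    ((∀ (m : ℕ) (G : Graph m) → InHv G r (twos r) q → N ≤ m)
    × ((((k ≡ + 0 ⊎ k ≡ + 2 ⊎ k ≡ + 3 ⊎ k ≡ + 4 ⊎ k ≡ + 5) × (+ 2 * k) + + 2 ≤ℤ + r)
    ⊎ ((k ≡ -[1+ 0 ] ⊎ k ≡ + 1) × (+ 2 * k) + + 3 ≤ℤ + r))
    → FvIs r (twos r) q N))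
theorem1p1 r -[1+ 0 ] _ _ _ q N eq eN = map₂ (λ F _ → F) (solution₋₁ eq eN)
theorem1p1 r -[1+ suc _ ] (-≤- ()) _ _ q N eq eN
theorem1p1 r (+ 0) _ _ _ q N eq eN = map₂ (λ F → λ where
  (inj₁ (_ , le)) → F (drop‿+≤+ le)
  (inj₂ (_ , le)) → F (≤-trans (n≤1+n 2) (drop‿+≤+ le)))
  (solution 0 2 base₅ z≤n refl eq (+-injective eN))
theorem1p1 r (+ 1) _ _ _ q N eq eN = map₂ (λ F → λ where
  (inj₁ (inj₁ () , _))
  (inj₁ (inj₂ (inj₁ ()) , _))
  (inj₁ (inj₂ (inj₂ (inj₁ ())) , _))
  (inj₁ (inj₂ (inj₂ (inj₂ (inj₁ ()))) , _))
  (inj₁ (inj₂ (inj₂ (inj₂ (inj₂ ()))) , _))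
  (inj₂ (_ , le)) → F (drop‿+≤+ le))
  (solution 1 4 base₁₀ (s≤s z≤n) refl eq (+-injective eN))
theorem1p1 r (+ 2) _ _ _ q N eq eN = map₂ (λ F → λ where
  (inj₁ (_ , le)) → F (drop‿+≤+ le)
  (inj₂ (_ , le)) → F (≤-trans (n≤1+n 6) (drop‿+≤+ le)))
  (solution 2 4 base₁₃ (s≤s (s≤s z≤n)) refl eq (+-injective eN))
theorem1p1 r (+ 3) _ _ _ q N eq eN = map₂ (λ F → λ where
  (inj₁ (_ , le)) → F (drop‿+≤+ le)
  (inj₂ (_ , le)) → F (≤-trans (n≤1+n 8) (drop‿+≤+ le)))
  (solution 3 5 base₁₇ (s≤s (s≤s (s≤s z≤n))) refl eq (+-injective eN))
theorem1p1 r (+ 4) _ _ _ q N eq eN = map₂ (λ F → λ where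
  (inj₁ (_ , le)) → F (drop‿+≤+ le)
  (inj₂ (_ , le)) → F (≤-trans (n≤1+n 10) (drop‿+≤+ le)))
  (solution 4 6 base₂₁ (s≤s (s≤s (s≤s (s≤s z≤n)))) refl eq (+-injective eN))
theorem1p1 r (+ 5) _ _ _ q N eq eN = map₂ (λ F → λ where
  (inj₁ (_ , le)) → F (drop‿+≤+ le)
  (inj₂ (_ , le)) → F (≤-trans (n≤1+n 12) (drop‿+≤+ le)))
  (solution 5 7 base₂₅ (s≤s (s≤s (s≤s (s≤s (s≤s z≤n))))) refl eq (+-injective eN))
theorem1p1 r (+ (suc (suc (suc (suc (suc (suc _))))))) _ (+≤+ (s≤s (s≤s (s≤s (s≤s (s≤s ())))))) _ q N eq eN
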